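{- Let $\varepsilon\in(0,1)$ and let $T\sim T\left(n,\frac{1+\varepsilon}{n}\right)$. Then with high probability (as $n\to\infty$), $\mathrm{Dist}_{\mathrm{Tour\text{ - }BP}}(T)=\Theta(\varepsilon^3)\,n$; that is, there are absolute constants $0<c_1\le c_2$ such that w.h.p. $c_1\varepsilon^3 n\le \mathrm{Dist}_{\mathrm{Tour\text{ - }BP}}(T)\le c_2\varepsilon^3 n$.
   Context: For $p\in[0,1]$, the $p$-random tournament $T\sim T(n,p)$ on vertex set $[n]$ is obtained by orienting, independently for every $1\le i<j\le n$, the edge $\{i,j\}$ as $\overrightarrow{ji}$ with probability $p$ and as $\overrightarrow{ij}$ with probability $1-p$. A tournament is $2$-colorable (bipartite) if its vertex set can be partitioned into two sets each inducing a transitive subtournament. $\mathrm{Dist}_{\mathrm{Tour\text{ - }BP}}(T)$ is the minimum number of arcs of $T$ that must be reversed to make $T$ $2$-colorable.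
   Formalization: The parameter ε ranges over the rational numbers in (0,1) rather than all real numbers in (0,1). -}

module Defs where

open import Data.Bool using (Bool; true; false; _∧_; _∨_; not; if_then_else_)
open import Data.Nat as ℕ using (ℕ; zero; suc)
open import Data.Fin using (Fin; toℕ)
open import Data.Fin.Properties using () renaming (_≟_ to _≟F_)
open import Data.Product using (_×_; _,_)
open import Data.List using (List; []; _∷_; _++_; map; concatMap; allFin; foldr; zipWith; length)
open import Data.Bool.ListAction using (any; all)
open import Data.Vec using (Vec; lookup) renaming ([] to []ᵥ; _∷_ to _∷ᵥ_)
open import Data.Integer using (+_)
open import Data.Rational using (ℚ; 0ℚ; 1ℚ; _+_; _*_; _-_; _/_)
open import Relation.Nullary.Decidable using (⌊_⌋)

pairs : (n : ℕ) → List (Fin n × Fin n)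
pairs n = concatMap (λ i → concatMap (λ j → if ⌊ toℕ i ℕ.<? toℕ j ⌋ then (i , j) ∷ [] else []) (allFin n)) (allFin n)

npairs : ℕ → ℕ
npairs n = length (pairs n)

-- An outcome (tournament) is a list of bits, one per pair in 'pairs n':
-- bit true on pair (i,j), i<j, means the arc j → i (probability p);
-- bit false means the arc i → j (probability 1 - p).
orient : {n : ℕ} → Fin n × Fin n → Bool → Fin n × Fin n
orient (i , j) true  = (j , i)
orient (i , j) false = (i , j)

arcs : (n : ℕ) → List Bool → List (Fin n × Fin n)
arcs n bs = zipWith orient (pairs n) bs

hasArc : {n : ℕ} → List (Fin n × Fin n) → Fin n → Fin n → Bool
hasArc as u v = any (λ { (a , b) → ⌊ a ≟F u ⌋ ∧ ⌊ b ≟F v ⌋ }) as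

allBools : ℕ → List (List Bool)
allBools zero    = [] ∷ []
allBools (suc m) = map (true ∷_) (allBools m) ++ map (false ∷_) (allBools m)

allColourings : (n : ℕ) → List (Vec Bool n)
allColourings zero    = []ᵥ ∷ []
allColourings (suc n) = map (true ∷ᵥ_) (allColourings n) ++ map (false ∷ᵥ_) (allColourings n)

transitiveClass : {n : ℕ} → List (Fin n × Fin n) → Vec Bool n → Bool → Bool
transitiveClass {n} as col c =
  all (λ a → all (λ b → all (λ d →
    not (⌊ lookup col a Data.Bool.≟ c ⌋ ∧ ⌊ lookup col b Data.Bool.≟ c ⌋ ∧ ⌊ lookup col d Data.Bool.≟ c ⌋)
    ∨ not (hasArc as a b ∧ hasArc as b d) ∨ hasArc as a d)
    (allFin n)) (allFin n)) (allFin n)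
  where import Data.Bool

isBP : (n : ℕ) → List Bool → Bool
isBP n bs = any (λ col → transitiveClass (arcs n bs) col true ∧ transitiveClass (arcs n bs) col false) (allColourings n)

hamming : List Bool → List Bool → ℕ
hamming [] _ = 0
hamming (_ ∷ _) [] = 0
hamming (x ∷ xs) (y ∷ ys) = (if ⌊ x Data.Bool.≟ y ⌋ then 0 else 1) ℕ.+ hamming xs ys
  where import Data.Bool

-- Dist_{Tour-BP}(T): minimum number of arcs to reverse to make T 2-colourable.
-- Minimum over all 2-colourable tournaments T' on [n] of the number of pairs
-- oriented differently; the initial value npairs n is a valid upper bound
-- (the transitive tournament is 2-colourable), so this is the true minimum.
distBP : (n : ℕ) → List Bool → ℕ
distBP n bs = foldr ℕ._⊓_ (npairs n)
  (map (λ bs' → if isBP n bs' then hamming bs bs' else npairs n) (allBools (npairs n)))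

ℕtoℚ : ℕ → ℚ
ℕtoℚ k = (+ k) / 1

-- 1/n (with the irrelevant convention 1/0 = 0).
inv : ℕ → ℚ
inv zero    = 0ℚ
inv (suc k) = (+ 1) / suc k

weight : ℚ → List Bool → ℚ
weight p [] = 1ℚ
weight p (true ∷ bs)  = p * weight p bs
weight p (false ∷ bs) = (1ℚ - p) * weight p bs

Pr : (n : ℕ) → ℚ → (List Bool → Bool) → ℚ
Pr n p E = sum′ (allBools (npairs n))
  where
  sum′ : List (List Bool) → ℚ
  sum′ [] = 0ℚ
  sum′ (bs ∷ bss) = (if E bs then weight p bs else 0ℚ) + sum′ bss

{-# OPTIONS --safe #-}
-- The back edges form a random graph G(n, p). Changing one bit changes the distance by at most 1, so by Efron–Stein
-- the variance of the distance is O(n), and by Chebyshev it suffices that its mean is of order ε³ n.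
--
-- Upper bound. Deleting the monochromatic back edges of any vertex colouring makes the tournament 2-colourable.
-- Explore the graph vertex by vertex and give the new neighbours of the explored vertex the opposite colour: the
-- expected number of monochromatic edges is at most p times the sum of the sizes of the active sets. The drift of
-- the active set is at most ε - t/n at time t, and a quadratic potential bounds this sum by O(ε³ n²).
--
-- Lower bound. Write the graph as a union of independent graphs with densities about (1 + ε/2)/n and ε/(2n).
-- Until Θ(εn) vertices are found, the exploration of the first one has drift of order ε, so only O(1/ε) trees are
-- started. Cut closed walks around these trees into blocks of length of order ε⁻². A colouring with
-- few monochromatic edges alternates along most blocks, so it is determined on most of the forest by O(ε³ n) bits,
-- and for each choice of these bits the second graph has fewer than c ε³ n monochromatic edges with probability
-- e^(-C ε³ n): a union bound applies. It remains to pass from graphs to tournaments, where a colour class may be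
-- transitive in another order. A back edge inside a class with γ n class vertices between its ends forces, by
-- transitivity, many reversals at one of its ends, because degrees are small. For a fixed colouring there are
-- only γ n² pairs with fewer class vertices between them, so a union bound over all 2ⁿ colourings shows that
-- these carry few back edges.
module Submission where

-- Probability enters only through means. In the lower bound each failure (too many trees, many
-- short back edges, a large degree, a code with too few edges) is charged to a nonnegative variable
-- that is at least 1 when the failure occurs and has mean at most 1/8. The claimed order x of the
-- distance is then at most the distance plus x times these variables, so linearity of the mean does
-- the work of Markov's inequality and the union bounds, and four failures leave x/2. Exponential
-- moments are taken at powers of 2, so that Bernoulli's inequality is all the analysis required and
-- everything stays rational. The degree bound Δ is linear in n with a tiny constant. This suffices
-- because only back edges that span fewer than 4Δ class vertices escape the transitivity argument,
-- and for small Δ/n these pairs are so few that even a factor 2ⁿ for the colourings is affordable.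
-- The price is a threshold for n that is doubly exponential in a power of 1/ε. Both explorations
-- are instances of one search, controlled by a potential in the numbers of remaining and of active
-- vertices, which reduces each estimate to an inequality about one binomial variable.

open import Relation.Binary.Definitions using (DecidableEquality)

-- Rational arithmetic and the embedding of the natural numbers.

module Rationals where

  open import Defs using (ℕtoℚ; inv)
  open import Data.Nat as ℕ using (ℕ; zero; suc)
  import Data.Nat.Properties as ℕₚ
  import Data.Nat.Coprimality as Coprime
  open import Data.Integer as ℤ using (+_; -[1+_])
  import Data.Integer.Properties as ℤₚ
  open import Data.Rational
  open import Data.Rational.Properties
  import Data.Rational.Unnormalised as ℚᵘ
  import Data.Rational.Unnormalised.Properties as ℚᵘₚ
  open import Data.Product using (Σ; _,_)
  open import Data.Sum using (inj₁; inj₂)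
  open import Data.Bool using (Bool; if_then_else_)
  open import Relation.Nullary.Decidable using (dec⇒maybe)
  open import Relation.Binary.PropositionalEquality
  open import Tactic.RingSolver using (solve-∀)
  open import Tactic.RingSolver.Core.AlmostCommutativeRing using (AlmostCommutativeRing; fromCommutativeRing)

  ℚ-ring : AlmostCommutativeRing _ _
  ℚ-ring = fromCommutativeRing +-*-commutativeRing (λ x → dec⇒maybe (0ℚ ≟ x))

  0≤+ : ∀ {x y} → 0ℚ ≤ x → 0ℚ ≤ y → 0ℚ ≤ x + y
  0≤+ = +-mono-≤

  0≤* : ∀ {x y} → 0ℚ ≤ x → 0ℚ ≤ y → 0ℚ ≤ x * y
  0≤* {x} {y} 0≤x 0≤y = subst (_≤ x * y) (*-zeroʳ x) (*-monoˡ-≤-nonNeg x {{nonNegative 0≤x}} 0≤y)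

  -- Most polynomial inequalities below go through this: the difference `d` is written as a sum of
  -- products of nonnegative factors, and the ring solver checks the identity.
  ≤-by : ∀ {x y} d → 0ℚ ≤ d → y ≡ x + d → x ≤ y
  ≤-by {x} d 0≤d refl = subst (_≤ x + d) (+-identityʳ x) (+-monoʳ-≤ x 0≤d)

  0≤gap : ∀ {x y} → x ≤ y → 0ℚ ≤ y - x
  0≤gap {x} {y} x≤y = subst (_≤ y - x) (+-inverseʳ x) (+-monoˡ-≤ (- x) x≤y)

  *-monoˡ : ∀ {c x y} → 0ℚ ≤ c → x ≤ y → c * x ≤ c * y
  *-monoˡ {c} 0≤c = *-monoˡ-≤-nonNeg c {{nonNegative 0≤c}}

  *-monoʳ : ∀ {c x y} → 0ℚ ≤ c → x ≤ y → x * c ≤ y * c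
  *-monoʳ {c} 0≤c = *-monoʳ-≤-nonNeg c {{nonNegative 0≤c}}

  *-mono : ∀ {x y z w} → 0ℚ ≤ x → 0ℚ ≤ w → x ≤ y → z ≤ w → x * z ≤ y * w
  *-mono 0≤x 0≤w x≤y z≤w = ≤-trans (*-monoˡ 0≤x z≤w) (*-monoʳ 0≤w x≤y)

  0≤sq : ∀ x → 0ℚ ≤ x * x
  0≤sq x with ≤-total 0ℚ x
  ... | inj₁ 0≤x = 0≤* 0≤x 0≤x
  ... | inj₂ x≤0 = subst (0ℚ ≤_) (lem x) (0≤* -x≥0 -x≥0)
    where
    -x≥0 : 0ℚ ≤ - x
    -x≥0 = neg-antimono-≤ x≤0
    lem : ∀ x → (- x) * (- x) ≡ x * x
    lem = solve-∀ ℚ-ring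

  opaque

    -- An opaque copy of `ℕtoℚ`, so that arithmetic uses the laws below instead of normalising
    -- fractions.
    ι : ℕ → ℚ
    ι = ℕtoℚ

    ι≡ℕtoℚ : ∀ k → ι k ≡ ℕtoℚ k
    ι≡ℕtoℚ k = refl

    ι-mk : ∀ k → ι k ≡ mkℚ (+ k) 0 (Coprime.sym (Coprime.1-coprimeTo k))
    ι-mk k = normalize-coprime (Coprime.sym (Coprime.1-coprimeTo k))

    ι-toℚᵘ : ∀ k → toℚᵘ (ι k) ℚᵘ.≃ ℚᵘ.mkℚᵘ (+ k) 0
    ι-toℚᵘ k = toℚᵘ-fromℚᵘ (ℚᵘ.mkℚᵘ (+ k) 0)

    ι-+ : ∀ m n → ι (m ℕ.+ n) ≡ ι m + ι n
    ι-+ m n = toℚᵘ-injective (begin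
      toℚᵘ (ι (m ℕ.+ n))                ≈⟨ ι-toℚᵘ (m ℕ.+ n) ⟩
      ℚᵘ.mkℚᵘ (+ (m ℕ.+ n)) 0              ≈⟨ ℚᵘ.*≡* (cong (ℤ._* + 1) (sym (cong₂ ℤ._+_ (ℤₚ.*-identityʳ (+ m)) (ℤₚ.*-identityʳ (+ n))))) ⟩
      ℚᵘ.mkℚᵘ (+ m) 0 ℚᵘ.+ ℚᵘ.mkℚᵘ (+ n) 0 ≈⟨ ℚᵘₚ.+-cong (ι-toℚᵘ m) (ι-toℚᵘ n) ⟨
      toℚᵘ (ι m) ℚᵘ.+ toℚᵘ (ι n)     ≈⟨ toℚᵘ-homo-+ (ι m) (ι n) ⟨
      toℚᵘ (ι m + ι n)               ∎)
      where open ℚᵘₚ.≃-Reasoning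

    ι-* : ∀ m n → ι (m ℕ.* n) ≡ ι m * ι n
    ι-* m n = toℚᵘ-injective (begin
      toℚᵘ (ι (m ℕ.* n))                ≈⟨ ι-toℚᵘ (m ℕ.* n) ⟩
      ℚᵘ.mkℚᵘ (+ (m ℕ.* n)) 0              ≈⟨ ℚᵘ.*≡* (cong (ℤ._* + 1) (ℤₚ.pos-* m n)) ⟩
      ℚᵘ.mkℚᵘ (+ m) 0 ℚᵘ.* ℚᵘ.mkℚᵘ (+ n) 0 ≈⟨ ℚᵘₚ.*-cong (ι-toℚᵘ m) (ι-toℚᵘ n) ⟨
      toℚᵘ (ι m) ℚᵘ.* toℚᵘ (ι n)     ≈⟨ toℚᵘ-homo-* (ι m) (ι n) ⟨
      toℚᵘ (ι m * ι n)               ∎)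
      where open ℚᵘₚ.≃-Reasoning

    ι-mono : ∀ {m n} → m ℕ.≤ n → ι m ≤ ι n
    ι-mono {m} {n} m≤n rewrite ι-mk m | ι-mk n = *≤* (ℤₚ.*-monoʳ-≤-nonNeg (+ 1) (ℤ.+≤+ m≤n))

    ι-inv : ∀ n → 1 ℕ.≤ n → ι n * inv n ≡ 1ℚ
    ι-inv (suc n) _ = toℚᵘ-injective (begin
      toℚᵘ (ι (suc n) * inv (suc n))             ≈⟨ toℚᵘ-homo-* (ι (suc n)) (inv (suc n)) ⟩
      toℚᵘ (ι (suc n)) ℚᵘ.* toℚᵘ (inv (suc n))   ≈⟨ ℚᵘₚ.*-cong (ι-toℚᵘ (suc n)) (toℚᵘ-fromℚᵘ (ℚᵘ.mkℚᵘ (+ 1) n)) ⟩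
      ℚᵘ.mkℚᵘ (+ (suc n)) 0 ℚᵘ.* ℚᵘ.mkℚᵘ (+ 1) n    ≈⟨ ℚᵘ.*≡* (trans (ℤₚ.*-identityʳ _) (trans (ℤₚ.*-identityʳ (+ suc n))
                                                          (sym (trans (ℤₚ.*-identityˡ _) (cong +_ (ℕₚ.*-identityˡ (suc n))))))) ⟩
      ℚᵘ.1ℚᵘ                                         ∎)
      where open ℚᵘₚ.≃-Reasoning

    archimedes : ∀ q → Σ ℕ λ k → q ≤ ι k
    archimedes (mkℚ (+ m) d c) = m , subst (mkℚ (+ m) d c ≤_) (sym (ι-mk m))
      (*≤* (ℤₚ.*-monoˡ-≤-nonNeg (+ m) (ℤ.+≤+ (ℕ.s≤s ℕ.z≤n))))
    archimedes (mkℚ -[1+ m ] d c) = 0 , *≤* ℤ.-≤+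

  ι-0 : ι 0 ≡ 0ℚ
  ι-0 = ι≡ℕtoℚ 0

  ι-1 : ι 1 ≡ 1ℚ
  ι-1 = ι≡ℕtoℚ 1

  0≤ι : ∀ k → 0ℚ ≤ ι k
  0≤ι k = subst (_≤ ι k) ι-0 (ι-mono {0} {k} ℕ.z≤n)

  0≤1 : 0ℚ ≤ 1ℚ
  0≤1 = subst (0ℚ ≤_) ι-1 (0≤ι 1)

  ι-suc : ∀ k → ι (suc k) ≡ 1ℚ + ι k
  ι-suc k = trans (ι-+ 1 k) (cong (_+ ι k) ι-1)

  0≤inv : ∀ n → 0ℚ ≤ inv n
  0≤inv zero = ≤-refl
  0≤inv (suc n) = nonNegative⁻¹ (inv (suc n)) {{normalize-nonNeg 1 (suc n)}}

  -- Unlike `ι` this unfolds, so that literal coefficients compute inside the ring solver.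
  lit : ℕ → ℚ
  lit k = + k / 1

  0≤lit : ∀ k → 0ℚ ≤ lit k
  0≤lit k = subst (0ℚ ≤_) (ι≡ℕtoℚ k) (0≤ι k)

  pow : ℚ → ℕ → ℚ
  pow x zero    = 1ℚ
  pow x (suc k) = x * pow x k

  pow-+ : ∀ x k l → pow x (k ℕ.+ l) ≡ pow x k * pow x l
  pow-+ x zero    l = sym (*-identityˡ _)
  pow-+ x (suc k) l = trans (cong (x *_) (pow-+ x k l)) (sym (*-assoc x _ _))

  indicator : Bool → ℚ
  indicator b = if b then 1ℚ else 0ℚ

-- Finite sums and counts over lists.

module ListSums where

  open import Data.Bool using (Bool; true; false; if_then_else_)
  open import Data.Nat
  open import Data.Nat.Properties
  open import Data.List using (List; []; _∷_; _++_; map; length)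
  open import Data.List.Membership.Propositional using (_∈_)
  open import Data.List.Membership.Propositional.Properties using (∈-∃++)
  open import Data.List.Relation.Unary.Any using (here; there)
  open import Data.List.Relation.Unary.All using (All; []; _∷_)
  import Data.List.Relation.Unary.All as All
  open import Data.List.Relation.Unary.AllPairs using ([]; _∷_)
  open import Data.List.Relation.Unary.Unique.Propositional using (Unique)
  open import Data.List.Relation.Binary.Permutation.Propositional using (_↭_; refl; prep; swap; trans)
  open import Data.List.Relation.Binary.Permutation.Propositional.Properties using (∈-resp-↭; shift)
  open import Data.Product using (_,_)
  open import Data.Empty using (⊥-elim)
  open import Relation.Binary.PropositionalEquality hiding (trans)
  import Relation.Binary.PropositionalEquality as ≡
  open import Data.Nat.Tactic.RingSolver using (solve-∀)

  private
    variable
      A B : Set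

  bit : Bool → ℕ
  bit b = if b then 1 else 0

  bit≤1 : ∀ b → bit b ≤ 1
  bit≤1 true  = s≤s z≤n
  bit≤1 false = z≤n

  sumOver : (A → ℕ) → List A → ℕ
  sumOver f []       = 0
  sumOver f (x ∷ xs) = f x + sumOver f xs

  count : (A → Bool) → List A → ℕ
  count q = sumOver (λ x → bit (q x))

  sumOver-cong : ∀ {f g : A → ℕ} → (∀ x → f x ≡ g x) → ∀ xs → sumOver f xs ≡ sumOver g xs
  sumOver-cong h []       = refl
  sumOver-cong h (x ∷ xs) = cong₂ _+_ (h x) (sumOver-cong h xs)

  sumOver-mono : ∀ {f g : A → ℕ} xs → (∀ x → x ∈ xs → f x ≤ g x) → sumOver f xs ≤ sumOver g xs
  sumOver-mono []       h = z≤n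
  sumOver-mono (x ∷ xs) h = +-mono-≤ (h x (here refl)) (sumOver-mono xs (λ y y∈ → h y (there y∈)))

  sumOver-++ : ∀ (f : A → ℕ) xs ys → sumOver f (xs ++ ys) ≡ sumOver f xs + sumOver f ys
  sumOver-++ f []       ys = refl
  sumOver-++ f (x ∷ xs) ys = ≡.trans (cong (f x +_) (sumOver-++ f xs ys)) (sym (+-assoc (f x) _ _))

  sumOver-map : ∀ (f : B → ℕ) (g : A → B) xs → sumOver f (map g xs) ≡ sumOver (λ x → f (g x)) xs
  sumOver-map f g []       = refl
  sumOver-map f g (x ∷ xs) = cong (f (g x) +_) (sumOver-map f g xs)

  sumOver-+ : ∀ (f g : A → ℕ) xs → sumOver (λ x → f x + g x) xs ≡ sumOver f xs + sumOver g xs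
  sumOver-+ f g []       = refl
  sumOver-+ f g (x ∷ xs) rewrite sumOver-+ f g xs = lem (f x) (g x) _ _
    where
    lem : ∀ a b c d → a + b + (c + d) ≡ a + c + (b + d)
    lem = solve-∀

  sumOver-* : ∀ c (f : A → ℕ) xs → sumOver (λ x → c * f x) xs ≡ c * sumOver f xs
  sumOver-* c f []       = sym (*-zeroʳ c)
  sumOver-* c f (x ∷ xs) = ≡.trans (cong (c * f x +_) (sumOver-* c f xs)) (sym (*-distribˡ-+ c (f x) _))

  sumOver-≤-length : ∀ c {f : A → ℕ} → (∀ x → f x ≤ c) → ∀ xs → sumOver f xs ≤ length xs * c
  sumOver-≤-length c h []       = z≤n
  sumOver-≤-length c h (x ∷ xs) = +-mono-≤ (h x) (sumOver-≤-length c h xs)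

  count≤length : ∀ (q : A → Bool) xs → count q xs ≤ length xs
  count≤length q xs = ≤-trans (sumOver-≤-length 1 (λ x → bit≤1 (q x)) xs) (≤-reflexive (*-identityʳ _))

  sumOver-↭ : ∀ (f : A → ℕ) {xs ys} → xs ↭ ys → sumOver f xs ≡ sumOver f ys
  sumOver-↭ f refl         = refl
  sumOver-↭ f (prep x p)   = cong (f x +_) (sumOver-↭ f p)
  sumOver-↭ f (swap x y p) rewrite sumOver-↭ f p = lem (f x) (f y) _
    where
    lem : ∀ a b c → a + (b + c) ≡ b + (a + c)
    lem = solve-∀
  sumOver-↭ f (trans p q)  = ≡.trans (sumOver-↭ f p) (sumOver-↭ f q)

  -- Cut the head of `xs` out of `ys`; the other elements of `xs` differ from it, so they lie in
  -- what is left.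
  sumOver-⊆ : ∀ (f : A → ℕ) {xs ys} → Unique xs → (∀ {x} → x ∈ xs → x ∈ ys) → sumOver f xs ≤ sumOver f ys
  sumOver-⊆ f {[]}     []        xs⊆ys = z≤n
  sumOver-⊆ f {x ∷ xs} (x∉ ∷ xs!) xs⊆ys with ∈-∃++ (xs⊆ys (here refl))
  ... | us , vs , refl = ≤-trans (+-monoʳ-≤ (f x) (sumOver-⊆ f xs! sub)) (≤-reflexive (sym (sumOver-↭ f (shift x us vs))))
    where
    sub : ∀ {y} → y ∈ xs → y ∈ us ++ vs
    sub {y} y∈ with ∈-resp-↭ (shift x us vs) (xs⊆ys (there y∈))
    ... | here refl = ⊥-elim (All.lookup x∉ y∈ refl)
    ... | there y∈′ = y∈′

  sumOver-∈ : ∀ (f : A → ℕ) {x xs} → x ∈ xs → f x ≤ sumOver f xs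
  sumOver-∈ f (here refl) = m≤m+n _ _
  sumOver-∈ f (there x∈)  = ≤-trans (sumOver-∈ f x∈) (m≤n+m _ _)

-- Unordered pairs of vertices, listed star by star.

module VertexPairs where

  open import Defs
  open import Data.Bool using (Bool; true; false; T; if_then_else_)
  open import Data.Bool.Properties using (if-float)
  open import Data.Nat as ℕ using (ℕ; zero; suc; _<ᵇ_)
  import Data.Nat.Properties as ℕₚ
  open import Data.Fin using (Fin; zero; suc; toℕ)
  import Data.Fin.Properties as Finₚ
  open import Data.List using (List; []; _∷_; _++_; map; concatMap; allFin; tabulate)
  open import Data.List.Properties using (map-tabulate; concatMap-cong; concatMap-map; map-concatMap; map-cong; map-∘; map-++)
  open import Data.List.Membership.Propositional using (_∈_; _∉_)
  open import Data.List.Membership.Propositional.Properties using (∈-++⁻; ∈-++⁺ˡ; ∈-++⁺ʳ; ∈-map⁻; ∈-map⁺)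
  open import Data.List.Relation.Unary.Any using (here; there)
  open import Data.List.Relation.Unary.All using (All; []; _∷_)
  import Data.List.Relation.Unary.All as All
  open import Data.List.Relation.Unary.AllPairs using ([]; _∷_)
  open import Data.List.Relation.Unary.Unique.Propositional using (Unique)
  open import Data.List.Relation.Unary.Unique.Propositional.Properties using (map⁺; ++⁺; allFin⁺)
  open import Data.List.Relation.Binary.Permutation.Propositional using (_↭_; refl; prep; swap; trans; ↭-reflexive)
  import Data.List.Relation.Binary.Permutation.Propositional.Properties as Perm
  open import Data.Product using (_×_; _,_; proj₁; proj₂)
  open import Data.Sum using (_⊎_; inj₁; inj₂)
  open import Data.Empty using (⊥; ⊥-elim)
  open import Data.Unit using (tt)
  open import Relation.Nullary.Decidable using (isYes≗does)
  open import Relation.Binary.PropositionalEquality hiding (trans)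
  import Relation.Binary.PropositionalEquality as ≡

  -- The unordered pair as it occurs in `pairs`, smaller label first. On the diagonal it is
  -- `(u , u)`, which `pairs` does not contain.
  key : ∀ {n} → Fin n → Fin n → Fin n × Fin n
  key u w = if toℕ u <ᵇ toℕ w then (u , w) else (w , u)

  <ᵇ≡true⇒< : ∀ m n → (m <ᵇ n) ≡ true → m ℕ.< n
  <ᵇ≡true⇒< m n eq = ℕₚ.<ᵇ⇒< m n (subst T (sym eq) tt)

  <⇒<ᵇ≡true : ∀ {m n} → m ℕ.< n → (m <ᵇ n) ≡ true
  <⇒<ᵇ≡true {m} {n} m<n with m <ᵇ n | ℕₚ.<⇒<ᵇ m<n
  ... | true | _ = refl

  ≮ᵇ⇒≥ : ∀ m n → (m <ᵇ n) ≡ false → n ℕ.≤ m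
  ≮ᵇ⇒≥ m n eq = ℕₚ.≮⇒≥ λ m<n → case (≡.trans (sym (<⇒<ᵇ≡true m<n)) eq)
    where
    case : true ≡ false → ⊥
    case ()

  ≥⇒≮ᵇ : ∀ {m n} → n ℕ.≤ m → (m <ᵇ n) ≡ false
  ≥⇒≮ᵇ {m} {n} n≤m with m <ᵇ n in eq
  ... | true  = ⊥-elim (ℕₚ.<⇒≱ (<ᵇ≡true⇒< m n eq) n≤m)
  ... | false = refl

  key-< : ∀ {n} {u w : Fin n} → toℕ u ℕ.< toℕ w → key u w ≡ (u , w)
  key-< u<w rewrite <⇒<ᵇ≡true u<w = refl

  key-> : ∀ {n} {u w : Fin n} → toℕ w ℕ.< toℕ u → key u w ≡ (w , u)
  key-> w<u rewrite ≥⇒≮ᵇ (ℕₚ.<⇒≤ w<u) = refl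

  key-comm : ∀ {n} (u w : Fin n) → key u w ≡ key w u
  key-comm u w with toℕ u <ᵇ toℕ w in uw | toℕ w <ᵇ toℕ u in wu
  ... | true  | true  = ⊥-elim (ℕₚ.<-asym (<ᵇ≡true⇒< (toℕ u) (toℕ w) uw) (<ᵇ≡true⇒< (toℕ w) (toℕ u) wu))
  ... | true  | false = refl
  ... | false | true  = refl
  ... | false | false with Finₚ.toℕ-injective (ℕₚ.≤-antisym (≮ᵇ⇒≥ (toℕ w) (toℕ u) wu) (≮ᵇ⇒≥ (toℕ u) (toℕ w) uw))
  ... | refl = refl

  key-ends : ∀ {n} (u w : Fin n) → (key u w ≡ (u , w)) ⊎ (key u w ≡ (w , u))
  key-ends u w with toℕ u <ᵇ toℕ w
  ... | true  = inj₁ refl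
  ... | false = inj₂ refl

  key-injective : ∀ {n} (v : Fin n) {x y} → key v x ≡ key v y → x ≡ y
  key-injective v {x} {y} eq with key-ends v x | key-ends v y
  ... | inj₁ a | inj₁ b = cong proj₂ (≡.trans (sym a) (≡.trans eq b))
  ... | inj₂ a | inj₂ b = cong proj₁ (≡.trans (sym a) (≡.trans eq b))
  ... | inj₁ a | inj₂ b = let e = ≡.trans (sym a) (≡.trans eq b) in ≡.trans (cong proj₂ e) (cong proj₁ e)
  ... | inj₂ a | inj₁ b = let e = ≡.trans (sym a) (≡.trans eq b) in ≡.trans (cong proj₁ e) (cong proj₂ e)

  -- The pairs at the first vertex precede all pairs among the others. This is the order in which an
  -- exploration reveals edges, and by `pairsOf-↭` every order of the vertices lists the same pairs.
  pairsOf : ∀ {n} → List (Fin n) → List (Fin n × Fin n)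
  pairsOf []       = []
  pairsOf (v ∷ vs) = map (key v) vs ++ pairsOf vs

  pairsOf-↭ : ∀ {n} {vs ws : List (Fin n)} → vs ↭ ws → pairsOf vs ↭ pairsOf ws
  pairsOf-↭ refl = refl
  pairsOf-↭ (prep x p) = Perm.++⁺ (Perm.map⁺ (key x) p) (pairsOf-↭ p)
  pairsOf-↭ {vs = _ ∷ _ ∷ xs} {_ ∷ _ ∷ ys} (swap x y p) =
    trans (↭-reflexive (cong (_∷ map (key x) xs ++ (map (key y) xs ++ pairsOf xs)) (key-comm x y)))
          (prep (key y x) (trans (Perm.shifts (map (key x) xs) (map (key y) xs))
                                 (Perm.++⁺ (Perm.map⁺ (key y) p) (Perm.++⁺ (Perm.map⁺ (key x) p) (pairsOf-↭ p)))))
  pairsOf-↭ (trans p q) = trans (pairsOf-↭ p) (pairsOf-↭ q)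

  pairsOf-ends : ∀ {n} {e : Fin n × Fin n} {vs} → e ∈ pairsOf vs → (proj₁ e ∈ vs) × (proj₂ e ∈ vs)
  pairsOf-ends {vs = v ∷ vs} e∈ with ∈-++⁻ (map (key v) vs) e∈
  ... | inj₂ e∈′ = let (a , b) = pairsOf-ends e∈′ in there a , there b
  ... | inj₁ e∈′ with ∈-map⁻ (key v) e∈′
  ... | x , x∈ , refl with key-ends v x
  ... | inj₁ eq rewrite eq = here refl , there x∈
  ... | inj₂ eq rewrite eq = there x∈ , here refl

  key∈pairsOf⁻ : ∀ {n} {u w : Fin n} {vs} → key u w ∈ pairsOf vs → (u ∈ vs) × (w ∈ vs)
  key∈pairsOf⁻ {u = u} {w} {vs} k∈ with key-ends u w
  ... | inj₁ eq = pairsOf-ends (subst (_∈ pairsOf vs) eq k∈)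
  ... | inj₂ eq = let (a , b) = pairsOf-ends (subst (_∈ pairsOf vs) eq k∈) in b , a

  key∈pairsOf⁺ : ∀ {n} {u w : Fin n} {vs} → u ∈ vs → w ∈ vs → u ≢ w → key u w ∈ pairsOf vs
  key∈pairsOf⁺ (here refl) (here refl) u≢w = ⊥-elim (u≢w refl)
  key∈pairsOf⁺ {u = u} (here refl) (there w∈) _ = ∈-++⁺ˡ (∈-map⁺ (key u) w∈)
  key∈pairsOf⁺ {u = u} {w} {v ∷ vs} (there u∈) (here refl) _ = subst (_∈ pairsOf (v ∷ vs)) (key-comm w u) (∈-++⁺ˡ (∈-map⁺ (key w) u∈))
  key∈pairsOf⁺ {vs = v ∷ vs} (there u∈) (there w∈) u≢w = ∈-++⁺ʳ (map (key v) vs) (key∈pairsOf⁺ u∈ w∈ u≢w)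

  pairsOf-⊆ : ∀ {n} {vs ws : List (Fin n)} → Unique vs → (∀ {x} → x ∈ vs → x ∈ ws) → ∀ {e} → e ∈ pairsOf vs → e ∈ pairsOf ws
  pairsOf-⊆ {vs = v ∷ vs} (v∉ ∷ vs!) sub e∈ with ∈-++⁻ (map (key v) vs) e∈
  ... | inj₂ e∈′ = pairsOf-⊆ vs! (λ x∈ → sub (there x∈)) e∈′
  ... | inj₁ e∈′ with ∈-map⁻ (key v) e∈′
  ... | x , x∈ , refl = key∈pairsOf⁺ (sub (here refl)) (sub (there x∈)) (All.lookup v∉ x∈)

  ∉-unique : ∀ {A : Set} {v : A} {vs} → Unique (v ∷ vs) → v ∉ vs
  ∉-unique (v∉ ∷ _) v∈ = All.lookup v∉ v∈ refl

  pairsOf-unique : ∀ {n} {vs : List (Fin n)} → Unique vs → Unique (pairsOf vs)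
  pairsOf-unique {vs = []}     []         = []
  pairsOf-unique {vs = v ∷ vs} (v∉ ∷ vs!) = ++⁺ (map⁺ (key-injective v) vs!) (pairsOf-unique vs!) disjoint
    where
    disjoint : ∀ {e} → (e ∈ map (key v) vs) × (e ∈ pairsOf vs) → ⊥
    disjoint (e∈₁ , e∈₂) with ∈-map⁻ (key v) e∈₁
    ... | x , _ , refl = ∉-unique (v∉ ∷ vs!) (proj₁ (key∈pairsOf⁻ {u = v} {x} e∈₂))

  private
    suc² : ∀ {n} → Fin n × Fin n → Fin (suc n) × Fin (suc n)
    suc² (i , j) = suc i , suc j

    rowOn : ∀ {n} → Fin n → List (Fin n) → List (Fin n × Fin n)
    rowOn i = concatMap (λ j → if toℕ i <ᵇ toℕ j then (i , j) ∷ [] else [])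

    row : ∀ n → Fin n → List (Fin n × Fin n)
    row n i = rowOn i (allFin n)

    key-suc : ∀ {n} (u w : Fin n) → key (suc u) (suc w) ≡ suc² (key u w)
    key-suc u w with toℕ u <ᵇ toℕ w
    ... | true  = refl
    ... | false = refl

    pairsOf-suc : ∀ {n} (vs : List (Fin n)) → pairsOf (map suc vs) ≡ map suc² (pairsOf vs)
    pairsOf-suc []       = refl
    pairsOf-suc (v ∷ vs) = ≡.trans
      (cong₂ _++_ (≡.trans (sym (map-∘ vs)) (≡.trans (map-cong (key-suc v) vs) (map-∘ vs))) (pairsOf-suc vs))
      (sym (map-++ suc² (map (key v) vs) (pairsOf vs)))

    allFin-suc : ∀ n → tabulate {A = Fin (suc n)} suc ≡ map suc (allFin n)
    allFin-suc n = sym (map-tabulate (λ i → i) suc)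

    row-zero : ∀ n → row (suc n) zero ≡ map (key zero) (map suc (allFin n))
    row-zero n = ≡.trans (cong (λ js → rowOn zero (zero ∷ js)) (allFin-suc n))
      (≡.trans (concatMap-map (λ j → if 0 <ᵇ toℕ j then (zero , j) ∷ [] else []) suc (allFin n))
              (≡.trans (lem (allFin n)) (map-∘ (allFin n))))
      where
      lem : ∀ (js : List (Fin n)) → concatMap (λ j → (Fin.zero {n} , suc j) ∷ []) js ≡ map (λ j → key zero (suc j)) js
      lem []       = refl
      lem (j ∷ js) = cong (_ ∷_) (lem js)

    row-suc : ∀ n i → row (suc n) (suc i) ≡ map suc² (row n i)
    row-suc n i = ≡.trans (cong (λ js → rowOn (suc i) (zero ∷ js)) (allFin-suc n))
      (≡.trans (concatMap-map (λ j → if suc (toℕ i) <ᵇ toℕ j then (suc i , j) ∷ [] else []) suc (allFin n))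
      (≡.trans (concatMap-cong (λ j → sym (if-float (map suc²) (toℕ i <ᵇ toℕ j))) (allFin n))
               (sym (map-concatMap suc² (λ j → if toℕ i <ᵇ toℕ j then (i , j) ∷ [] else []) (allFin n)))))

  private
    rows-pairsOf : ∀ n → concatMap (row n) (allFin n) ≡ pairsOf (allFin n)
    rows-pairsOf zero    = refl
    rows-pairsOf (suc n) = cong₂ _++_ (≡.trans (row-zero n) (cong (map (key zero)) (sym (allFin-suc n)))) rest
      where
      rest : concatMap (row (suc n)) (tabulate suc) ≡ pairsOf (tabulate suc)
      rest = ≡.trans (cong (concatMap (row (suc n))) (allFin-suc n)) (≡.trans (concatMap-map (row (suc n)) suc (allFin n))
        (≡.trans (concatMap-cong (row-suc n) (allFin n))
        (≡.trans (sym (map-concatMap suc² (row n) (allFin n)))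
        (≡.trans (cong (map suc²) (rows-pairsOf n)) (≡.trans (sym (pairsOf-suc (allFin n))) (cong pairsOf (sym (allFin-suc n))))))))

  -- Row i of `pairs` is the star of i towards the larger labels; the induction on n splits off
  -- vertex 0.
  pairs-pairsOf : ∀ n → pairs n ≡ pairsOf (allFin n)
  pairs-pairsOf n = ≡.trans (concatMap-cong (λ i → concatMap-cong (λ j → cong (λ b → if b then (i , j) ∷ [] else []) (isYes≗does (toℕ i ℕ.<? toℕ j))) (allFin n)) (allFin n)) (rows-pairsOf n)

  pairs-unique : ∀ n → Unique (pairs n)
  pairs-unique n = subst Unique (sym (pairs-pairsOf n)) (pairsOf-unique (allFin⁺ n))

  pairs-< : ∀ n {e} → e ∈ pairs n → toℕ (proj₁ e) ℕ.< toℕ (proj₂ e)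
  pairs-< n {e} e∈ = go (allFin n) (allFin⁺ n) (subst (e ∈_) (pairs-pairsOf n) e∈)
    where
    go : ∀ vs → Unique vs → ∀ {e} → e ∈ pairsOf vs → toℕ (proj₁ e) ℕ.< toℕ (proj₂ e)
    go (v ∷ vs) (v∉ ∷ vs!) e∈ with ∈-++⁻ (map (key v) vs) e∈
    ... | inj₂ e∈′ = go vs vs! e∈′
    ... | inj₁ e∈′ with ∈-map⁻ (key v) e∈′
    ... | x , x∈ , refl with toℕ v <ᵇ toℕ x in eq
    ... | true  = <ᵇ≡true⇒< _ _ eq
    ... | false = ℕₚ.≤∧≢⇒< (≮ᵇ⇒≥ (toℕ v) (toℕ x) eq) λ x≡v → All.lookup v∉ x∈ (sym (Finₚ.toℕ-injective x≡v))

-- Means over independent bits, the variance bound and Chebyshev's inequality.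

module Concentration where

  open import Defs
  open Rationals
  open import Data.Bool using (Bool; true; false; if_then_else_)
  open import Data.Nat using (ℕ; zero; suc)
  open import Data.List using (List; []; _∷_; _++_; map; length)
  open import Data.Rational
  open import Data.Rational.Properties
  open import Data.Product using (_×_; _,_; proj₁; proj₂)
  open import Data.Unit using (⊤)
  open import Relation.Binary.PropositionalEquality
  open import Tactic.RingSolver using (solve-∀)

  -- The recursion makes conditioning on the first bit definitional.
  𝔼 : ℚ → (m : ℕ) → (List Bool → ℚ) → ℚ
  𝔼 p zero    f = f []
  𝔼 p (suc m) f = p * 𝔼 p m (λ bs → f (true ∷ bs)) + (1ℚ - p) * 𝔼 p m (λ bs → f (false ∷ bs))

  𝔼-cong : ∀ p m {f g} → (∀ bs → f bs ≡ g bs) → 𝔼 p m f ≡ 𝔼 p m g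
  𝔼-cong p zero    h = h []
  𝔼-cong p (suc m) h = cong₂ (λ x y → p * x + (1ℚ - p) * y) (𝔼-cong p m (λ bs → h (true ∷ bs))) (𝔼-cong p m (λ bs → h (false ∷ bs)))

  𝔼-const : ∀ p m c → 𝔼 p m (λ _ → c) ≡ c
  𝔼-const p zero    c = refl
  𝔼-const p (suc m) c rewrite 𝔼-const p m c = lem p c
    where
    lem : ∀ p c → p * c + (1ℚ - p) * c ≡ c
    lem = solve-∀ ℚ-ring

  𝔼-+ : ∀ p m f g → 𝔼 p m (λ bs → f bs + g bs) ≡ 𝔼 p m f + 𝔼 p m g
  𝔼-+ p zero    f g = refl
  𝔼-+ p (suc m) f g = trans (cong₂ (λ x y → p * x + (1ℚ - p) * y) (𝔼-+ p m _ _) (𝔼-+ p m _ _)) (lem p _ _ _ _)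
    where
    lem : ∀ p a b c d → p * (a + b) + (1ℚ - p) * (c + d) ≡ (p * a + (1ℚ - p) * c) + (p * b + (1ℚ - p) * d)
    lem = solve-∀ ℚ-ring

  𝔼-* : ∀ p m c f → 𝔼 p m (λ bs → c * f bs) ≡ c * 𝔼 p m f
  𝔼-* p zero    c f = refl
  𝔼-* p (suc m) c f = trans (cong₂ (λ x y → p * x + (1ℚ - p) * y) (𝔼-* p m c _) (𝔼-* p m c _)) (lem p c _ _)
    where
    lem : ∀ p c a b → p * (c * a) + (1ℚ - p) * (c * b) ≡ c * (p * a + (1ℚ - p) * b)
    lem = solve-∀ ℚ-ring

  module _ (p : ℚ) (0≤p : 0ℚ ≤ p) (p≤1 : p ≤ 1ℚ) where

    mix-mono : ∀ {a b c d} → a ≤ b → c ≤ d → p * a + (1ℚ - p) * c ≤ p * b + (1ℚ - p) * d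
    mix-mono a≤b c≤d = +-mono-≤ (*-monoˡ 0≤p a≤b) (*-monoˡ (0≤gap p≤1) c≤d)

    𝔼-mono : ∀ m {f g} → (∀ bs → length bs ≡ m → f bs ≤ g bs) → 𝔼 p m f ≤ 𝔼 p m g
    𝔼-mono zero    h = h [] refl
    𝔼-mono (suc m) h = mix-mono (𝔼-mono m (λ bs eq → h (true ∷ bs) (cong suc eq))) (𝔼-mono m (λ bs eq → h (false ∷ bs) (cong suc eq)))

  weightedSum : ℚ → (List Bool → ℚ) → List (List Bool) → ℚ
  weightedSum p f []         = 0ℚ
  weightedSum p f (bs ∷ bss) = f bs * weight p bs + weightedSum p f bss

  weightedSum-++ : ∀ p f bss css → weightedSum p f (bss ++ css) ≡ weightedSum p f bss + weightedSum p f css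
  weightedSum-++ p f []         css = sym (+-identityˡ _)
  weightedSum-++ p f (bs ∷ bss) css = trans (cong (f bs * weight p bs +_) (weightedSum-++ p f bss css)) (sym (+-assoc (f bs * weight p bs) _ _))

  weightedSum-map : ∀ p f b q → (∀ bs → weight p (b ∷ bs) ≡ q * weight p bs) → ∀ bss →
                    weightedSum p f (map (b ∷_) bss) ≡ q * weightedSum p (λ bs → f (b ∷ bs)) bss
  weightedSum-map p f b q h []         = sym (*-zeroʳ q)
  weightedSum-map p f b q h (bs ∷ bss) = trans (cong₂ (λ x y → f (b ∷ bs) * x + y) (h bs) (weightedSum-map p f b q h bss)) (lem (f (b ∷ bs)) q _ _)
    where
    lem : ∀ f q w s → f * (q * w) + q * s ≡ q * (f * w + s)
    lem = solve-∀ ℚ-ring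

  weightedSum-allBools : ∀ p m f → weightedSum p f (allBools m) ≡ 𝔼 p m f
  weightedSum-allBools p zero    f = trans (+-identityʳ _) (*-identityʳ _)
  weightedSum-allBools p (suc m) f =
    trans (weightedSum-++ p f (map (true ∷_) (allBools m)) _)
          (cong₂ _+_ (trans (weightedSum-map p f true p (λ _ → refl) (allBools m)) (cong (p *_) (weightedSum-allBools p m _)))
                     (trans (weightedSum-map p f false (1ℚ - p) (λ _ → refl) (allBools m)) (cong ((1ℚ - p) *_) (weightedSum-allBools p m _))))

  indicator-* : ∀ b w → (if b then w else 0ℚ) ≡ indicator b * w
  indicator-* true  w = sym (*-identityˡ w)
  indicator-* false w = sym (*-zeroˡ w)

  -- The summation inside `Pr` is a local function; it enters here as any `s` that satisfies the
  -- same two equations.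
  Pr-weightedSum : ∀ p (A : List Bool → Bool) (s : List (List Bool) → ℚ) → s [] ≡ 0ℚ →
                   (∀ bs bss → s (bs ∷ bss) ≡ (if A bs then weight p bs else 0ℚ) + s bss) →
                   ∀ bss → s bss ≡ weightedSum p (λ bs → indicator (A bs)) bss
  Pr-weightedSum p A s s[] s∷ []         = s[]
  Pr-weightedSum p A s s[] s∷ (bs ∷ bss) = trans (s∷ bs bss) (cong₂ _+_ (indicator-* (A bs) (weight p bs)) (Pr-weightedSum p A s s[] s∷ bss))

  Pr-𝔼 : ∀ n p A → Pr n p A ≡ 𝔼 p (npairs n) (λ bs → indicator (A bs))
  Pr-𝔼 n p A = trans step (weightedSum-allBools p (npairs n) _)
    where
    unfold-sum = Pr-weightedSum p A _ refl (λ _ _ → refl)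
    step : Pr n p A ≡ weightedSum p (λ bs → indicator (A bs)) (allBools (npairs n))
    step with allBools (npairs n)
    ... | bss = unfold-sum bss

  -- Bounded differences, stated bit by bit so that both restrictions of `f` inherit the property by
  -- projection.
  Lipschitz : (m : ℕ) → (List Bool → ℚ) → Set
  Lipschitz zero    f = ⊤
  Lipschitz (suc m) f =
    (∀ bs → length bs ≡ m → (f (true ∷ bs) ≤ f (false ∷ bs) + 1ℚ) × (f (false ∷ bs) ≤ f (true ∷ bs) + 1ℚ)) ×
    Lipschitz m (λ bs → f (true ∷ bs)) × Lipschitz m (λ bs → f (false ∷ bs))

  module _ (p : ℚ) (0≤p : 0ℚ ≤ p) (p≤1 : p ≤ 1ℚ) where

    -- Efron–Stein: conditioning on the first bit, the squared mean picks up p (1 - p) (μ₁ - μ₀)² ≤ p.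
    second-moment : ∀ m f → Lipschitz m f →
                    𝔼 p m (λ bs → f bs * f bs) ≤ 𝔼 p m f * 𝔼 p m f + ι m * p
    second-moment zero    f _ = ≤-reflexive (trans (lem (f []) p) (cong (λ z → f [] * f [] + z * p) (sym ι-0)))
      where
      lem : ∀ x p → x * x ≡ x * x + 0ℚ * p
      lem = solve-∀ ℚ-ring
    second-moment (suc m) f (flip , lip₁ , lip₀) = begin
        p * 𝔼 p m (λ bs → f₁ bs * f₁ bs) + (1ℚ - p) * 𝔼 p m (λ bs → f₀ bs * f₀ bs)
      ≤⟨ mix-mono p 0≤p p≤1 (second-moment m f₁ lip₁) (second-moment m f₀ lip₀) ⟩
        p * (x * x + ι m * p) + (1ℚ - p) * (y * y + ι m * p)
      -- The slack is p(1 - p)(1 - (x - y)²) + p², and |x - y| ≤ 1 because the two restrictions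
      -- differ by at most 1 pointwise.
      ≤⟨ ≤-by _ (0≤+ (0≤* (0≤* 0≤p (0≤gap p≤1)) (0≤* (0≤gap x≤y+1) (0≤gap y≤x+1))) (0≤* 0≤p 0≤p)) (lem x y p (ι m)) ⟩
        (p * x + (1ℚ - p) * y) * (p * x + (1ℚ - p) * y) + (1ℚ + ι m) * p
      ≡⟨ cong (λ k → (p * x + (1ℚ - p) * y) * (p * x + (1ℚ - p) * y) + k * p) (ι-suc m) ⟨
        (p * x + (1ℚ - p) * y) * (p * x + (1ℚ - p) * y) + ι (suc m) * p ∎
      where
      open ≤-Reasoning
      f₁ f₀ : List Bool → ℚ
      f₁ bs = f (true ∷ bs)
      f₀ bs = f (false ∷ bs)
      x y : ℚ
      x = 𝔼 p m f₁
      y = 𝔼 p m f₀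
      𝔼-shift : ∀ g → 𝔼 p m (λ bs → g bs + 1ℚ) ≡ 𝔼 p m g + 1ℚ
      𝔼-shift g = trans (𝔼-+ p m g (λ _ → 1ℚ)) (cong (𝔼 p m g +_) (𝔼-const p m 1ℚ))
      x≤y+1 : x ≤ y + 1ℚ
      x≤y+1 = subst (x ≤_) (𝔼-shift f₀) (𝔼-mono p 0≤p p≤1 m (λ bs eq → proj₁ (flip bs eq)))

      y≤x+1 : y ≤ x + 1ℚ
      y≤x+1 = subst (y ≤_) (𝔼-shift f₁) (𝔼-mono p 0≤p p≤1 m (λ bs eq → proj₂ (flip bs eq)))

      lem : ∀ x y p k → (p * x + (1ℚ - p) * y) * (p * x + (1ℚ - p) * y) + (1ℚ + k) * p ≡
            (p * (x * x + k * p) + (1ℚ - p) * (y * y + k * p)) + (p * (1ℚ - p) * ((y + 1ℚ - x) * (x + 1ℚ - y)) + p * p)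
      lem = solve-∀ ℚ-ring

    -- The scale w stands for 1 / z², where z is the allowed deviation.
    chebyshev : ∀ m f w (A : List Bool → Bool) → 0ℚ ≤ w → Lipschitz m f →
                (∀ bs → length bs ≡ m → A bs ≡ false → 1ℚ ≤ w * ((f bs - 𝔼 p m f) * (f bs - 𝔼 p m f))) →
                1ℚ - w * (ι m * p) ≤ 𝔼 p m (λ bs → indicator (A bs))
    -- The chain takes the mean of the pointwise bound 1 - w(f - μ)² ≤ 1_A, which `far` supplies
    -- where A fails; the square is expanded so that linearity applies to each term.
    chebyshev m f w A 0≤w lip far = begin
        1ℚ - w * (ι m * p)
      ≤⟨ ≤-by _ (0≤* 0≤w (0≤gap (second-moment m f lip))) (lem₁ w _ _ _) ⟩
        (1ℚ - w * (μ * μ)) + (w * (1ℚ + 1ℚ) * μ * μ + (- w) * 𝔼 p m (λ bs → f bs * f bs))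
      ≡⟨ cong₂ _+_ (𝔼-const p m _) (cong₂ _+_ (𝔼-* p m (w * (1ℚ + 1ℚ) * μ) f) (𝔼-* p m (- w) _)) ⟨
        𝔼 p m (λ _ → 1ℚ - w * (μ * μ)) + (𝔼 p m (λ bs → w * (1ℚ + 1ℚ) * μ * f bs) + 𝔼 p m (λ bs → (- w) * (f bs * f bs)))
      ≡⟨ trans (𝔼-+ p m _ _) (cong (𝔼 p m (λ _ → 1ℚ - w * (μ * μ)) +_) (𝔼-+ p m _ _)) ⟨
        𝔼 p m (λ bs → (1ℚ - w * (μ * μ)) + (w * (1ℚ + 1ℚ) * μ * f bs + (- w) * (f bs * f bs)))
      ≤⟨ 𝔼-mono p 0≤p p≤1 m pointwise ⟩
        𝔼 p m (λ bs → indicator (A bs)) ∎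
      where
      open ≤-Reasoning
      μ : ℚ
      μ = 𝔼 p m f
      lem₁ : ∀ w μ v s → (1ℚ - w * (μ * μ)) + (w * (1ℚ + 1ℚ) * μ * μ + (- w) * s) ≡ (1ℚ - w * v) + w * ((μ * μ + v) - s)
      lem₁ = solve-∀ ℚ-ring
      lem₂ : ∀ w μ x → (1ℚ - w * (μ * μ)) + (w * (1ℚ + 1ℚ) * μ * x + (- w) * (x * x)) ≡ 1ℚ - w * ((x - μ) * (x - μ))
      lem₂ = solve-∀ ℚ-ring
      lem₃ : ∀ a → 1ℚ ≡ (1ℚ - a) + a
      lem₃ = solve-∀ ℚ-ring
      lem₄ : ∀ a → 0ℚ ≡ (1ℚ - a) + (a - 1ℚ)
      lem₄ = solve-∀ ℚ-ring
      pointwise : ∀ bs → length bs ≡ m → (1ℚ - w * (μ * μ)) + (w * (1ℚ + 1ℚ) * μ * f bs + (- w) * (f bs * f bs)) ≤ indicator (A bs)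
      pointwise bs eq with A bs in Abs
      ... | true  = ≤-trans (≤-reflexive (lem₂ w μ (f bs))) (≤-by _ (0≤* 0≤w (0≤sq (f bs - μ))) (lem₃ (w * ((f bs - μ) * (f bs - μ)))))
      ... | false = ≤-trans (≤-reflexive (lem₂ w μ (f bs))) (≤-by _ (0≤gap (far bs eq Abs)) (lem₄ (w * ((f bs - μ) * (f bs - μ)))))

-- Random configurations on a set of keys: resampling, independence, sprinkling.

module Exposure {K : Set} (_≟_ : DecidableEquality K) where

  open Rationals
  open ListSums
  open Concentration
  open import Data.Bool using (Bool; true; false; _∧_; _∨_)
  open import Data.Nat as ℕ using (ℕ)
  open import Data.List using (List; []; _∷_; _++_; map; length)
  open import Data.List.Membership.Propositional using (_∈_; _∉_)
  open import Data.List.Relation.Unary.Any using (here; there)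
  import Data.List.Relation.Unary.All as All
  open import Data.List.Relation.Unary.AllPairs using ([]; _∷_)
  open import Data.List.Relation.Unary.Unique.Propositional using (Unique)
  open import Data.List.Relation.Binary.Permutation.Propositional using (_↭_; refl; prep; swap; trans)
  open import Data.Rational hiding (_≟_)
  open import Data.Rational.Properties hiding (_≟_)
  open import Data.Empty using (⊥-elim)
  open import Relation.Nullary using (Dec; yes; no)
  open import Relation.Binary.PropositionalEquality hiding (trans)
  import Relation.Binary.PropositionalEquality as ≡
  open import Tactic.RingSolver using (solve-∀)

  Config : Set
  Config = K → Bool

  _[_≔_] : Config → K → Bool → Config
  (ω [ e ≔ b ]) e′ with e′ ≟ e
  ... | yes _ = b
  ... | no  _ = ω e′

  write : Config → List K → List Bool → Config
  write ω (e ∷ L) (b ∷ bs) = write (ω [ e ≔ b ]) L bs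
  write ω _       _        = ω

  AgreeOff : List K → Config → Config → Set
  AgreeOff L ω ω′ = ∀ e → e ∉ L → ω′ e ≡ ω e

  -- Overwriting keys in different orders gives configurations that agree only pointwise, so
  -- functions averaged over reordered lists have to respect pointwise equality.
  Extensional : {A : Set} → (Config → A) → Set
  Extensional f = ∀ {ω ω′} → (∀ e → ω e ≡ ω′ e) → f ω ≡ f ω′

  ≔-same : ∀ ω e b → (ω [ e ≔ b ]) e ≡ b
  ≔-same ω e b with e ≟ e
  ... | yes _  = refl
  ... | no e≢e = ⊥-elim (e≢e refl)

  ≔-other : ∀ ω {e e′} b → e′ ≢ e → (ω [ e ≔ b ]) e′ ≡ ω e′
  ≔-other ω {e} {e′} b e′≢e with e′ ≟ e
  ... | yes e′≡e = ⊥-elim (e′≢e e′≡e)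
  ... | no _     = refl

  ≔-cong : ∀ {ω ω′} e b → (∀ x → ω x ≡ ω′ x) → ∀ x → (ω [ e ≔ b ]) x ≡ (ω′ [ e ≔ b ]) x
  ≔-cong e b h x with x ≟ e
  ... | yes _ = refl
  ... | no _  = h x

  write-agree : ∀ ω L bs → AgreeOff L ω (write ω L bs)
  write-agree ω []      bs       e e∉ = refl
  write-agree ω (k ∷ L) []       e e∉ = refl
  write-agree ω (k ∷ L) (b ∷ bs) e e∉ =
    ≡.trans (write-agree (ω [ k ≔ b ]) L bs e (λ e∈ → e∉ (there e∈))) (≔-other ω b (λ e≡k → e∉ (here e≡k)))

  read-write : ∀ ω {L} bs → Unique L → length bs ≡ length L → map (write ω L bs) L ≡ bs
  read-write ω {[]}    []       _         _  = refl
  read-write ω {e ∷ L} (b ∷ bs) (e∉ ∷ L!) eq =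
    cong₂ _∷_ (≡.trans (write-agree (ω [ e ≔ b ]) L bs e (λ e∈ → All.lookup e∉ e∈ refl)) (≔-same ω e b))
              (read-write (ω [ e ≔ b ]) bs L! (cong ℕ.pred eq))

  -- The conditional mean given ω off `L`: the values on `L` are resampled, all others are read from
  -- ω.
  𝔼ₖ : ℚ → List K → (Config → ℚ) → Config → ℚ
  𝔼ₖ p L f ω = 𝔼 p (length L) (λ bs → f (write ω L bs))

  𝔼ₖ-cong : ∀ p L {f g} ω → (∀ ω′ → AgreeOff L ω ω′ → f ω′ ≡ g ω′) → 𝔼ₖ p L f ω ≡ 𝔼ₖ p L g ω
  𝔼ₖ-cong p L ω h = 𝔼-cong p (length L) (λ bs → h (write ω L bs) (write-agree ω L bs))

  𝔼ₖ-const : ∀ p L {f} c ω → (∀ ω′ → AgreeOff L ω ω′ → f ω′ ≡ c) → 𝔼ₖ p L f ω ≡ c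
  𝔼ₖ-const p L c ω h = ≡.trans (𝔼ₖ-cong p L ω h) (𝔼-const p (length L) c)

  𝔼ₖ-+ : ∀ p L f g ω → 𝔼ₖ p L (λ ω → f ω + g ω) ω ≡ 𝔼ₖ p L f ω + 𝔼ₖ p L g ω
  𝔼ₖ-+ p L f g ω = 𝔼-+ p (length L) _ _

  𝔼ₖ-* : ∀ p L c f ω → 𝔼ₖ p L (λ ω → c * f ω) ω ≡ c * 𝔼ₖ p L f ω
  𝔼ₖ-* p L c f ω = 𝔼-* p (length L) c _

  -- The tower property. It lets the star of an explored vertex be revealed before the remaining
  -- pairs.
  𝔼ₖ-++ : ∀ p S L f ω → 𝔼ₖ p (S ++ L) f ω ≡ 𝔼ₖ p S (𝔼ₖ p L f) ω
  𝔼ₖ-++ p []      L f ω = refl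
  𝔼ₖ-++ p (e ∷ S) L f ω = cong₂ (λ x y → p * x + (1ℚ - p) * y) (𝔼ₖ-++ p S L f (ω [ e ≔ true ])) (𝔼ₖ-++ p S L f (ω [ e ≔ false ]))

  𝔼ₖ-start : ∀ p L {f} → Extensional f → Extensional (𝔼ₖ p L f)
  𝔼ₖ-start p []      f-ext h = f-ext h
  𝔼ₖ-start p (e ∷ L) f-ext h = cong₂ (λ x y → p * x + (1ℚ - p) * y) (𝔼ₖ-start p L f-ext (≔-cong e true h)) (𝔼ₖ-start p L f-ext (≔-cong e false h))

  ≔-swap : ∀ ω {e e′} b b′ → e ≢ e′ → ∀ x → (ω [ e ≔ b ] [ e′ ≔ b′ ]) x ≡ (ω [ e′ ≔ b′ ] [ e ≔ b ]) x
  ≔-swap ω {e} {e′} b b′ e≢e′ x = go (x ≟ e) (x ≟ e′)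
    where
    go : Dec (x ≡ e) → Dec (x ≡ e′) → (ω [ e ≔ b ] [ e′ ≔ b′ ]) x ≡ (ω [ e′ ≔ b′ ] [ e ≔ b ]) x
    go (yes refl) (yes refl) = ⊥-elim (e≢e′ refl)
    go (yes refl) (no x≢e′)  = ≡.trans (≔-other _ b′ x≢e′) (≡.trans (≔-same ω x b) (sym (≔-same _ x b)))
    go (no x≢e)   (yes refl) = ≡.trans (≔-same _ x b′) (sym (≡.trans (≔-other _ b x≢e) (≔-same ω x b′)))
    go (no x≢e)   (no x≢e′)  = ≡.trans (≔-other _ b′ x≢e′) (≡.trans (≔-other ω b x≢e) (sym (≡.trans (≔-other _ b x≢e) (≔-other ω b′ x≢e′))))

  -- Independence: adjacent keys can be resampled in either order. A repeated key is harmless, since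
  -- swapping it with itself changes nothing.
  𝔼ₖ-↭ : ∀ p {L L′ f} → Extensional f → L ↭ L′ → ∀ ω → 𝔼ₖ p L f ω ≡ 𝔼ₖ p L′ f ω
  𝔼ₖ-↭ p f-ext refl         ω = refl
  𝔼ₖ-↭ p f-ext (prep e π)   ω = cong₂ (λ x y → p * x + (1ℚ - p) * y) (𝔼ₖ-↭ p f-ext π _) (𝔼ₖ-↭ p f-ext π _)
  𝔼ₖ-↭ p f-ext (trans π π′) ω = ≡.trans (𝔼ₖ-↭ p f-ext π ω) (𝔼ₖ-↭ p f-ext π′ ω)
  𝔼ₖ-↭ p {e ∷ e′ ∷ L} {_ ∷ _ ∷ L′} {f} f-ext (swap e e′ π) ω with e ≟ e′
  ... | yes refl = cong₂ (λ x y → p * x + (1ℚ - p) * y)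
                     (cong₂ (λ x y → p * x + (1ℚ - p) * y) (𝔼ₖ-↭ p f-ext π _) (𝔼ₖ-↭ p f-ext π _))
                     (cong₂ (λ x y → p * x + (1ℚ - p) * y) (𝔼ₖ-↭ p f-ext π _) (𝔼ₖ-↭ p f-ext π _))
  ... | no e≢e′ = ≡.trans (cong₂ (λ x y → p * x + (1ℚ - p) * y)
                     (cong₂ (λ x y → p * x + (1ℚ - p) * y) (step true true) (step true false))
                     (cong₂ (λ x y → p * x + (1ℚ - p) * y) (step false true) (step false false)))
                   (lem p (F true true) (F true false) (F false true) (F false false))
    where
    F : Bool → Bool → ℚ
    F b b′ = 𝔼ₖ p L′ f (ω [ e′ ≔ b′ ] [ e ≔ b ])
    step : ∀ b b′ → 𝔼ₖ p L f (ω [ e ≔ b ] [ e′ ≔ b′ ]) ≡ F b b′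
    step b b′ = ≡.trans (𝔼ₖ-↭ p f-ext π _) (𝔼ₖ-start p L′ f-ext (≔-swap ω b b′ e≢e′))
    lem : ∀ p x y z w → p * (p * x + (1ℚ - p) * y) + (1ℚ - p) * (p * z + (1ℚ - p) * w)
                      ≡ p * (p * x + (1ℚ - p) * z) + (1ℚ - p) * (p * y + (1ℚ - p) * w)
    lem = solve-∀ ℚ-ring

  𝔼ₖ-edge : ∀ p {L e} ω → Unique L → e ∈ L → 𝔼ₖ p L (λ ω → ι (bit (ω e))) ω ≡ p
  𝔼ₖ-edge p {e ∷ L} ω (e∉ ∷ _) (here refl) =
    ≡.trans (cong₂ (λ x y → p * x + (1ℚ - p) * y) (≡.trans (value true) ι-1) (≡.trans (value false) ι-0)) (lem p)
    where
    value : ∀ b → 𝔼ₖ p L (λ ω → ι (bit (ω e))) (ω [ e ≔ b ]) ≡ ι (bit b)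
    value b = 𝔼ₖ-const p L _ (ω [ e ≔ b ]) λ ω′ off →
      cong (λ b → ι (bit b)) (≡.trans (off e (λ e∈ → All.lookup e∉ e∈ refl)) (≔-same ω e b))
    lem : ∀ p → p * 1ℚ + (1ℚ - p) * 0ℚ ≡ p
    lem = solve-∀ ℚ-ring
  𝔼ₖ-edge p {k ∷ L} {e} ω (_ ∷ L!) (there e∈) =
    ≡.trans (cong₂ (λ x y → p * x + (1ℚ - p) * y) (𝔼ₖ-edge p (ω [ k ≔ true ]) L! e∈) (𝔼ₖ-edge p (ω [ k ≔ false ]) L! e∈)) (lem p)
    where
    lem : ∀ p → p * p + (1ℚ - p) * p ≡ p
    lem = solve-∀ ℚ-ring

  -- By independence each key selected by `q` contributes a factor 1 - p + pθ. Small θ detects too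
  -- few edges, large θ too many.
  𝔼ₖ-generating : ∀ p θ (q : K → Bool) {L} ω → Unique L →
    𝔼ₖ p L (λ ω → pow θ (count (λ e → q e ∧ ω e) L)) ω ≡ pow (1ℚ - p + p * θ) (count q L)
  𝔼ₖ-generating p θ q {[]}    ω []        = refl
  𝔼ₖ-generating p θ q {e ∷ L} ω (e∉ ∷ L!) =
    ≡.trans (cong₂ (λ x y → p * x + (1ℚ - p) * y) (value true) (value false)) final
    where
    R : ℚ
    R = pow (1ℚ - p + p * θ) (count q L)
    G : Config → ℚ
    G ω = pow θ (count (λ e → q e ∧ ω e) L)
    value : ∀ b → 𝔼ₖ p L (λ ω → pow θ (count (λ e → q e ∧ ω e) (e ∷ L))) (ω [ e ≔ b ]) ≡ pow θ (bit (q e ∧ b)) * R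
    value b = ≡.trans (𝔼ₖ-cong p L {g = λ ω → pow θ (bit (q e ∧ b)) * G ω} (ω [ e ≔ b ]) λ ω′ off →
        ≡.trans (pow-+ θ (bit (q e ∧ ω′ e)) (count (λ e → q e ∧ ω′ e) L))
                (cong (λ b → pow θ (bit (q e ∧ b)) * G ω′)
                      (≡.trans (off e (λ e∈ → All.lookup e∉ e∈ refl)) (≔-same ω e b))))
      (≡.trans (𝔼ₖ-* p L (pow θ (bit (q e ∧ b))) G (ω [ e ≔ b ])) (cong (pow θ (bit (q e ∧ b)) *_) (𝔼ₖ-generating p θ q (ω [ e ≔ b ]) L!)))
    lem₁ : ∀ p θ r → p * (θ * 1ℚ * r) + (1ℚ - p) * (1ℚ * r) ≡ (1ℚ - p + p * θ) * r
    lem₁ = solve-∀ ℚ-ring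
    lem₂ : ∀ p r → p * (1ℚ * r) + (1ℚ - p) * (1ℚ * r) ≡ r
    lem₂ = solve-∀ ℚ-ring
    final : p * (pow θ (bit (q e ∧ true)) * R) + (1ℚ - p) * (pow θ (bit (q e ∧ false)) * R) ≡ pow (1ℚ - p + p * θ) (bit (q e) ℕ.+ count q L)
    final with q e
    ... | true  = lem₁ p θ R
    ... | false = lem₂ p R

  _∪_ : Config → Config → Config
  (ω ∪ ω′) e = ω e ∨ ω′ e

  ∪-≔ : ∀ ω ω′ e b b′ x → ((ω ∪ ω′) [ e ≔ b ∨ b′ ]) x ≡ ((ω [ e ≔ b ]) ∪ (ω′ [ e ≔ b′ ])) x
  ∪-≔ ω ω′ e b b′ x with x ≟ e
  ... | yes _ = refl
  ... | no _  = refl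

  -- Sprinkling: the union of independent p₁- and p₂-configurations is a (p₁ + p₂ - p₁ p₂)-configuration.
  𝔼ₖ-∪ : ∀ p₁ p₂ L {f} → Extensional f → ∀ ω ω′ →
    𝔼ₖ (p₁ + p₂ - p₁ * p₂) L f (ω ∪ ω′) ≡ 𝔼ₖ p₁ L (λ ω₁ → 𝔼ₖ p₂ L (λ ω₂ → f (ω₁ ∪ ω₂)) ω′) ω
  𝔼ₖ-∪ p₁ p₂ []      f-ext ω ω′ = refl
  𝔼ₖ-∪ p₁ p₂ (e ∷ L) {f} f-ext ω ω′ = ≡.trans
    (≡.trans (lem p₁ p₂ (X true) (X false))
             (cong₂ (λ x y → p₁ * x + (1ℚ - p₁) * y) (cong₂ (λ x y → p₂ * x + (1ℚ - p₂) * y) (step true true) (step true false))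
                                                    (cong₂ (λ x y → p₂ * x + (1ℚ - p₂) * y) (step false true) (step false false))))
    (sym (cong₂ (λ x y → p₁ * x + (1ℚ - p₁) * y) (split (ω [ e ≔ true ])) (split (ω [ e ≔ false ]))))
    where
    X : Bool → ℚ
    X b = 𝔼ₖ (p₁ + p₂ - p₁ * p₂) L f ((ω ∪ ω′) [ e ≔ b ])
    Z : Bool → Config → ℚ
    Z b′ ω₁ = 𝔼ₖ p₂ L (λ ω₂ → f (ω₁ ∪ ω₂)) (ω′ [ e ≔ b′ ])
    Y : Bool → Config → ℚ
    Y b′ = 𝔼ₖ p₁ L (Z b′)
    step : ∀ b b′ → X (b ∨ b′) ≡ Y b′ (ω [ e ≔ b ])
    step b b′ = ≡.trans (𝔼ₖ-start _ L f-ext (∪-≔ ω ω′ e b b′)) (𝔼ₖ-∪ p₁ p₂ L f-ext (ω [ e ≔ b ]) (ω′ [ e ≔ b′ ]))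
    -- Linearity moves the second configuration's bit at e in front of the mean over the rest of the
    -- first one.
    split : ∀ ω → 𝔼ₖ p₁ L (λ ω₁ → 𝔼ₖ p₂ (e ∷ L) (λ ω₂ → f (ω₁ ∪ ω₂)) ω′) ω ≡ p₂ * Y true ω + (1ℚ - p₂) * Y false ω
    split ω = ≡.trans (𝔼ₖ-+ p₁ L (λ ω₁ → p₂ * Z true ω₁) (λ ω₁ → (1ℚ - p₂) * Z false ω₁) ω)
                      (cong₂ _+_ (𝔼ₖ-* p₁ L p₂ (Z true) ω) (𝔼ₖ-* p₁ L (1ℚ - p₂) (Z false) ω))
    lem : ∀ p₁ p₂ t f → (p₁ + p₂ - p₁ * p₂) * t + (1ℚ - (p₁ + p₂ - p₁ * p₂)) * f
                      ≡ p₁ * (p₂ * t + (1ℚ - p₂) * t) + (1ℚ - p₁) * (p₂ * t + (1ℚ - p₂) * f)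
    lem = solve-∀ ℚ-ring

  module _ (p : ℚ) (0≤p : 0ℚ ≤ p) (p≤1 : p ≤ 1ℚ) where

    𝔼ₖ-mono : ∀ L {f g} ω → (∀ ω′ → AgreeOff L ω ω′ → f ω′ ≤ g ω′) → 𝔼ₖ p L f ω ≤ 𝔼ₖ p L g ω
    𝔼ₖ-mono L ω h = 𝔼-mono p 0≤p p≤1 (length L) (λ bs _ → h (write ω L bs) (write-agree ω L bs))

    -- Without repetitions in `L`, writing bits along `L` and reading them back is the identity.
    -- This turns means over outcomes into means over graphs.
    𝔼-𝔼ₖ : ∀ {L} f ω → Unique L → 𝔼 p (length L) f ≡ 𝔼ₖ p L (λ ω → f (map ω L)) ω
    𝔼-𝔼ₖ {L} f ω L! = ≤-antisym
      (𝔼-mono p 0≤p p≤1 (length L) (λ bs eq → ≤-reflexive (cong f (sym (read-write ω bs L! eq)))))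
      (𝔼-mono p 0≤p p≤1 (length L) (λ bs eq → ≤-reflexive (cong f (read-write ω bs L! eq))))

-- Exploring a random graph, with a potential that bounds the expected cost.

module Exploration where

  open Rationals
  open ListSums
  open VertexPairs
  open Concentration
  open import Data.Bool using (Bool; true; false; not; if_then_else_)
  open import Data.Nat as ℕ using (ℕ; zero; suc)
  import Data.Nat.Properties as ℕₚ
  open import Data.Fin using (Fin)
  import Data.Fin.Properties as Finₚ
  open import Data.List using (List; []; _∷_; _++_; map; length)
  open import Data.List.Properties using (length-map; length-++; map-++; map-∘; ++-assoc)
  open import Data.List.Membership.Propositional using (_∈_; _∉_)
  open import Data.List.Membership.Propositional.Properties using (∈-++⁺ˡ; ∈-map⁺)
  open import Data.List.Relation.Unary.Any using (here; there)
  open import Data.List.Relation.Unary.All using ([]; _∷_)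
  open import Data.List.Relation.Unary.AllPairs using ([]; _∷_)
  open import Data.List.Relation.Unary.Unique.Propositional using (Unique)
  import Data.List.Relation.Unary.Unique.Propositional.Properties as Uniqueₚ
  open import Data.List.Relation.Binary.Permutation.Propositional using (_↭_; refl; prep; swap; trans; ↭-sym; ↭-reflexive)
  import Data.List.Relation.Binary.Permutation.Propositional.Properties as Perm
  open import Data.Product using (_×_; _,_; proj₁)
  open import Data.Product.Properties using (≡-dec)
  open import Data.Rational
  open import Data.Rational.Properties hiding (_≟_)
  open import Relation.Binary.PropositionalEquality hiding (trans)
  import Relation.Binary.PropositionalEquality as ≡
  open import Tactic.RingSolver using (solve-∀)

  module Edges {n : ℕ} = Exposure (≡-dec (Finₚ._≟_ {n}) (Finₚ._≟_ {n}))
  open Edges public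

  Graph : ℕ → Set
  Graph n = Fin n × Fin n → Bool

  Unique-↭ : ∀ {A : Set} {xs ys : List A} → xs ↭ ys → Unique xs → Unique ys
  Unique-↭ refl         xs!                   = xs!
  Unique-↭ (prep x p)   (x∉ ∷ xs!)            = Perm.All-resp-↭ p x∉ ∷ Unique-↭ p xs!
  Unique-↭ (swap x y p) ((x≢y ∷ x∉) ∷ y∉ ∷ xs!) =
    ((λ y≡x → x≢y (sym y≡x)) ∷ Perm.All-resp-↭ p y∉) ∷ Perm.All-resp-↭ p x∉ ∷ Unique-↭ p xs!
  Unique-↭ (trans p q)  xs!                   = Unique-↭ q (Unique-↭ p xs!)

  keep : ∀ {A : Set} → (A → Bool) → List A → List A
  keep q []       = []
  keep q (x ∷ xs) = if q x then x ∷ keep q xs else keep q xs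

  nbrs rest : ∀ {n} → Graph n → Fin n → List (Fin n) → List (Fin n)
  nbrs ω v = keep (λ x → ω (key v x))
  rest ω v = keep (λ x → not (ω (key v x)))

  keep-cong : ∀ {A : Set} {q q′ : A → Bool} xs → (∀ x → x ∈ xs → q x ≡ q′ x) → keep q xs ≡ keep q′ xs
  keep-cong []       h = refl
  keep-cong (x ∷ xs) h = cong₂ (λ b ys → if b then x ∷ ys else ys) (h x (here refl)) (keep-cong xs (λ y y∈ → h y (there y∈)))

  length-keep : ∀ {A : Set} (q : A → Bool) xs → length (keep q xs) ≡ count q xs
  length-keep q []       = refl
  length-keep q (x ∷ xs) with q x
  ... | true  = cong suc (length-keep q xs)
  ... | false = length-keep q xs

  keep-↭ : ∀ {A : Set} (q : A → Bool) xs → keep q xs ++ keep (λ x → not (q x)) xs ↭ xs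
  keep-↭ q []       = refl
  keep-↭ q (x ∷ xs) with q x
  ... | true  = prep x (keep-↭ q xs)
  ... | false = trans (Perm.shift x (keep q xs) _) (prep x (keep-↭ q xs))

  trues : List Bool → ℕ
  trues = count (λ b → b)

  -- One search serves both bounds. With β = 1 and c = 0 it counts the edges that a greedy colouring
  -- may leave monochromatic; with β = 0 and c(u) the indicator of `u₀ ≤ u` it counts the trees
  -- started while many vertices are unexplored.
  module Search (β : ℕ) (c : ℕ → ℕ) where

    -- Cost of exploring the graph from the active vertices A into the unexplored vertices U, with fuel |A| + |U|:
    -- a new root costs c (number of vertices left), and exploring v costs β per edge from v to another active vertex.
    run : ∀ {n} → ℕ → Graph n → List (Fin n) → List (Fin n) → ℕ
    run zero    ω A       U       = 0
    run (suc k) ω []      []      = 0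
    run (suc k) ω []      (x ∷ U) = c (length U) ℕ.+ run k ω (nbrs ω x U) (rest ω x U)
    run (suc k) ω (v ∷ A) U       = β ℕ.* count (λ w → ω (key v w)) A ℕ.+ run k ω (A ++ nbrs ω v U) (rest ω v U)

    run-ext : ∀ {n} k {ω ω′ : Graph n} A U → (∀ e → ω e ≡ ω′ e) → run k ω A U ≡ run k ω′ A U
    run-ext zero    A       U       h = refl
    run-ext (suc k) []      []      h = refl
    run-ext (suc k) {ω} {ω′} []      (x ∷ U) h
      rewrite keep-cong {q = λ w → ω (key x w)} U (λ w _ → h (key x w))
            | keep-cong {q = λ w → not (ω (key x w))} U (λ w _ → cong not (h (key x w)))
      = cong (c (length U) ℕ.+_) (run-ext k _ _ h)
    run-ext (suc k) {ω} {ω′} (v ∷ A) U       h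
      rewrite keep-cong {q = λ w → ω (key v w)} U (λ w _ → h (key v w))
            | keep-cong {q = λ w → not (ω (key v w))} U (λ w _ → cong not (h (key v w)))
      = cong₂ ℕ._+_ (cong (β ℕ.*_) (sumOver-cong (λ w → cong bit (h (key v w))) A)) (run-ext k _ _ h)

    module _ (p : ℚ) (0≤p : 0ℚ ≤ p) (p≤1 : p ≤ 1ℚ) where

      private
        EK-mono = λ {n} → 𝔼ₖ-mono {n} p 0≤p p≤1

      𝔼ₖ-count : ∀ {n} (v : Fin n) S {L} ω → Unique L → (∀ {x} → x ∈ S → key v x ∈ L) →
                 𝔼ₖ p L (λ ω → ι (count (λ x → ω (key v x)) S)) ω ≡ ι (length S) * p
      𝔼ₖ-count v []      {L} ω L! sub = ≡.trans (≡.trans (𝔼-const p (length L) (ι 0)) ι-0) (≡.trans (sym (*-zeroˡ p)) (cong (_* p) (sym ι-0)))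
      𝔼ₖ-count v (x ∷ S) {L} ω L! sub = begin
          𝔼ₖ p L (λ ω → ι (bit (ω (key v x)) ℕ.+ count (λ x → ω (key v x)) S)) ω
        ≡⟨ 𝔼ₖ-cong p L ω (λ ω′ _ → ι-+ (bit (ω′ (key v x))) (count (λ x → ω′ (key v x)) S)) ⟩
          𝔼ₖ p L (λ ω → ι (bit (ω (key v x))) + ι (count (λ x → ω (key v x)) S)) ω
        ≡⟨ 𝔼ₖ-+ p L (λ ω → ι (bit (ω (key v x)))) (λ ω → ι (count (λ x → ω (key v x)) S)) ω ⟩
          𝔼ₖ p L (λ ω → ι (bit (ω (key v x)))) ω + 𝔼ₖ p L (λ ω → ι (count (λ x → ω (key v x)) S)) ω
        ≡⟨ cong₂ _+_ (𝔼ₖ-edge p ω L! (sub (here refl))) (𝔼ₖ-count v S ω L! (λ x∈ → sub (there x∈))) ⟩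
          p + ι (length S) * p
        ≡⟨ lem p (ι (length S)) ⟩
          (1ℚ + ι (length S)) * p
        ≡⟨ cong (_* p) (ι-suc (length S)) ⟨
          ι (suc (length S)) * p ∎
        where
        open ≡-Reasoning
        lem : ∀ p s → p + s * p ≡ (1ℚ + s) * p
        lem = solve-∀ ℚ-ring

      -- The number of neighbours of v in `U` is binomial: its law depends on `U` only through the
      -- length.
      𝔼ₖ-star : ∀ {n} (v : Fin n) {U} h ω → Unique U →
                𝔼ₖ p (map (key v) U) (λ ω → h (count (λ x → ω (key v x)) U)) ω ≡ 𝔼 p (length U) (λ bs → h (trues bs))
      𝔼ₖ-star v {U} h ω U! = begin
          𝔼ₖ p (map (key v) U) (λ ω → h (count (λ x → ω (key v x)) U)) ω
        ≡⟨ 𝔼ₖ-cong p (map (key v) U) ω (λ ω′ _ → cong h (≡.trans (sym (sumOver-map bit (λ x → ω′ (key v x)) U))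
                                                                  (cong (sumOver bit) (map-∘ {g = ω′} {f = key v} U)))) ⟩
          𝔼ₖ p (map (key v) U) (λ ω → h (trues (map ω (map (key v) U)))) ω
        ≡⟨ 𝔼-𝔼ₖ p 0≤p p≤1 {L = map (key v) U} (λ bs → h (trues bs)) ω (Uniqueₚ.map⁺ (key-injective v) U!) ⟨
          𝔼 p (length (map (key v) U)) (λ bs → h (trues bs))
        ≡⟨ cong (λ m → 𝔼 p m (λ bs → h (trues bs))) (length-map (key v) U) ⟩
          𝔼 p (length U) (λ bs → h (trues bs)) ∎
        where open ≡-Reasoning

      -- `Φ k a` bounds the expected cost still to come when k vertices remain, a of them active.
      -- One step reveals pairs at a single vertex, so the hypotheses `step` and `root` involve one
      -- binomial variable each.
      module _ (N : ℕ) (Φ : ℕ → ℕ → ℚ) (0≤Φ : ∀ k a → 0ℚ ≤ Φ k a)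
               (step : ∀ a u → suc (a ℕ.+ u) ℕ.≤ N →
                       ι β * (ι a * p) + 𝔼 p u (λ bs → Φ (a ℕ.+ u) (a ℕ.+ trues bs)) ≤ Φ (suc (a ℕ.+ u)) (suc a))
               (root : ∀ u → suc u ℕ.≤ N → ι (c u) + 𝔼 p u (λ bs → Φ u (trues bs)) ≤ Φ (suc u) 0) where

        Bounded : ℕ → Set
        Bounded k = ∀ {n} (ω : Graph n) A U → Unique (A ++ U) → length (A ++ U) ≡ k → k ℕ.≤ N →
                    𝔼ₖ p (pairsOf (A ++ U)) (λ ω → ι (run k ω A U)) ω ≤ Φ k (length A)

        -- Reveal the pairs at v first. None of them is a pair among the remaining vertices, so what
        -- follows is a fresh instance of the search with the new active and unexplored lists.
        explore-≤ : ∀ k → Bounded k → k ℕ.≤ N → ∀ {n} (ω : Graph n) v A U → Unique (v ∷ A ++ U) → length (A ++ U) ≡ k →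
          𝔼ₖ p (pairsOf (v ∷ A ++ U)) (λ ω → ι (run k ω (A ++ nbrs ω v U) (rest ω v U))) ω ≤
          𝔼 p (length U) (λ bs → Φ k (length A ℕ.+ trues bs))
        explore-≤ k IH k≤N ω v A U vAU!@(v∉ ∷ AU!) len = begin
            𝔼ₖ p (map (key v) (A ++ U) ++ P) r ω
          ≡⟨ 𝔼ₖ-++ p (map (key v) (A ++ U)) P r ω ⟩
            𝔼ₖ p (map (key v) (A ++ U)) (𝔼ₖ p P r) ω
          ≤⟨ EK-mono (map (key v) (A ++ U)) ω (λ ω₁ _ → inner ω₁) ⟩
            𝔼ₖ p (map (key v) (A ++ U)) g ω
          ≡⟨ cong (λ L → 𝔼ₖ p L g ω) (map-++ (key v) A U) ⟩
            𝔼ₖ p (map (key v) A ++ map (key v) U) g ω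
          ≡⟨ 𝔼ₖ-++ p (map (key v) A) (map (key v) U) g ω ⟩
            𝔼ₖ p (map (key v) A) (𝔼ₖ p (map (key v) U) g) ω
          -- The bound depends only on the pairs from v into `U`; those from v into `A` average out.
          ≡⟨ 𝔼ₖ-const p (map (key v) A) B ω (λ ω₁ _ → 𝔼ₖ-star v (λ x → Φ k (length A ℕ.+ x)) ω₁ U!) ⟩
            B ∎
          where
          open ≤-Reasoning
          P = pairsOf (A ++ U)
          r g : Graph _ → ℚ
          r ω = ι (run k ω (A ++ nbrs ω v U) (rest ω v U))
          g ω = Φ k (length A ℕ.+ count (λ x → ω (key v x)) U)
          B : ℚ
          B = 𝔼 p (length U) (λ bs → Φ k (length A ℕ.+ trues bs))
          U! : Unique U
          U! = Unique-++ʳ A AU!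
            where
            Unique-++ʳ : ∀ {A : Set} (xs : List A) {ys} → Unique (xs ++ ys) → Unique ys
            Unique-++ʳ []       ys!        = ys!
            Unique-++ʳ (x ∷ xs) (_ ∷ rest!) = Unique-++ʳ xs rest!
          fresh : ∀ x → key v x ∉ P
          fresh x k∈ = ∉-unique vAU! (proj₁ (key∈pairsOf⁻ {u = v} {x} k∈))
          inner : ∀ ω₁ → 𝔼ₖ p P r ω₁ ≤ g ω₁
          inner ω₁ = begin
              𝔼ₖ p P r ω₁
            ≡⟨ 𝔼ₖ-cong p P ω₁ (λ ω₂ off → cong₂ (λ A′ U′ → ι (run k ω₂ (A ++ A′) U′))
                 (keep-cong U (λ x _ → off (key v x) (fresh x)))
                 (keep-cong U (λ x _ → cong not (off (key v x) (fresh x))))) ⟩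
              𝔼ₖ p P (λ ω → ι (run k ω A₁ U₁)) ω₁
            ≡⟨ 𝔼ₖ-↭ p (λ h → cong ι (run-ext k A₁ U₁ h)) (pairsOf-↭ (↭-sym perm)) ω₁ ⟩
              𝔼ₖ p (pairsOf (A₁ ++ U₁)) (λ ω → ι (run k ω A₁ U₁)) ω₁
            ≤⟨ IH ω₁ A₁ U₁ (Unique-↭ (↭-sym perm) AU!) (≡.trans (Perm.↭-length perm) len) k≤N ⟩
              Φ k (length A₁)
            ≡⟨ cong (Φ k) (≡.trans (length-++ A) (cong (length A ℕ.+_) (length-keep (λ x → ω₁ (key v x)) U))) ⟩
              g ω₁ ∎
            where
            A₁ = A ++ nbrs ω₁ v U
            U₁ = rest ω₁ v U
            perm : A₁ ++ U₁ ↭ A ++ U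
            perm = trans (↭-reflexive (++-assoc A (nbrs ω₁ v U) U₁)) (Perm.++⁺ˡ A (keep-↭ (λ x → ω₁ (key v x)) U))

        run-≤ : ∀ k → Bounded k
        run-≤ zero    ω A       U       AU! len k≤N = ≤-trans (≤-reflexive (≡.trans (𝔼-const p (length (pairsOf (A ++ U))) (ι 0)) ι-0)) (0≤Φ 0 (length A))
        run-≤ (suc k) ω []      (x ∷ U) AU! len k≤N with ℕₚ.suc-injective len
        ... | refl = begin
            𝔼ₖ p L (λ ω → ι (c k ℕ.+ s ω)) ω
          ≡⟨ 𝔼ₖ-cong p L ω (λ ω′ _ → ι-+ (c k) (s ω′)) ⟩
            𝔼ₖ p L (λ ω → ι (c k) + ι (s ω)) ω
          ≡⟨ ≡.trans (𝔼ₖ-+ p L (λ _ → ι (c k)) (λ ω → ι (s ω)) ω) (cong (_+ 𝔼ₖ p L (λ ω → ι (s ω)) ω) (𝔼-const p (length L) (ι (c k)))) ⟩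
            ι (c k) + 𝔼ₖ p L (λ ω → ι (s ω)) ω
          ≤⟨ +-monoʳ-≤ (ι (c k)) (explore-≤ k (run-≤ k) (ℕₚ.<⇒≤ k≤N) ω x [] U AU! refl) ⟩
            ι (c k) + 𝔼 p k (λ bs → Φ k (trues bs))
          ≤⟨ root k k≤N ⟩
            Φ (suc k) 0 ∎
          where
          open ≤-Reasoning
          L = pairsOf (x ∷ U)
          s : Graph _ → ℕ
          s ω = run k ω (nbrs ω x U) (rest ω x U)
        run-≤ (suc k) ω (v ∷ A) U       AU! len k≤N with ℕₚ.suc-injective len
        ... | refl = begin
            𝔼ₖ p L (λ ω → ι (β ℕ.* d ω ℕ.+ s ω)) ω
          ≡⟨ 𝔼ₖ-cong p L ω (λ ω′ _ → ≡.trans (ι-+ (β ℕ.* d ω′) (s ω′)) (cong (_+ ι (s ω′)) (ι-* β (d ω′)))) ⟩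
            𝔼ₖ p L (λ ω → ι β * ι (d ω) + ι (s ω)) ω
          ≡⟨ ≡.trans (𝔼ₖ-+ p L (λ ω → ι β * ι (d ω)) (λ ω → ι (s ω)) ω)
                     (cong (_+ 𝔼ₖ p L (λ ω → ι (s ω)) ω) (≡.trans (𝔼ₖ-* p L (ι β) (λ ω → ι (d ω)) ω)
                        (cong (ι β *_) (𝔼ₖ-count v A ω (pairsOf-unique AU!) (λ x∈ → ∈-++⁺ˡ (∈-map⁺ (key v) (∈-++⁺ˡ x∈))))))) ⟩
            ι β * (ι (length A) * p) + 𝔼ₖ p L (λ ω → ι (s ω)) ω
          ≤⟨ +-monoʳ-≤ (ι β * (ι (length A) * p)) (explore-≤ k (run-≤ k) (ℕₚ.<⇒≤ k≤N) ω v A U AU! refl) ⟩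
            ι β * (ι (length A) * p) + 𝔼 p (length U) (λ bs → Φ k (length A ℕ.+ trues bs))
          ≤⟨ subst (λ k → suc k ℕ.≤ N → ι β * (ι (length A) * p) + 𝔼 p (length U) (λ bs → Φ k (length A ℕ.+ trues bs)) ≤ Φ (suc k) (suc (length A)))
                   (sym (length-++ A)) (step (length A) (length U)) k≤N ⟩
            Φ (suc k) (suc (length A)) ∎
          where
          open ≤-Reasoning
          L = pairsOf (v ∷ A ++ U)
          d s : Graph _ → ℕ
          d ω = count (λ w → ω (key v w)) A
          s ω = run k ω (A ++ nbrs ω v U) (rest ω v U)

-- The distance to 2-colourability in terms of back-edge graphs.

module Distance where

  open import Defs
  open Rationals using (ι; ι-mono; ι-+; ι-1)
  open ListSums
  open VertexPairs
  open Concentration using (Lipschitz)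
  open Exploration
  open import Data.Bool as Bool using (Bool; true; false; _∧_; _∨_; not; _xor_; if_then_else_)
  open import Data.Bool.ListAction using (any; all)
  open import Data.Nat
  open import Data.Nat.Properties
  open import Data.Fin using (Fin; toℕ)
  import Data.Fin.Properties as Finₚ
  open import Data.List using (List; []; _∷_; _++_; map; length; foldr; zipWith; allFin)
  open import Data.List.Properties using (length-map)
  open import Data.List.Membership.Propositional using (_∈_)
  open import Data.List.Membership.Propositional.Properties using (∈-map⁺; ∈-map⁻; ∈-++⁺ˡ; ∈-++⁺ʳ; ∈-++⁻; ∈-allFin)
  open import Data.List.Relation.Unary.Any using (here; there)
  open import Data.Vec using (Vec; lookup) renaming ([] to []ᵥ; _∷_ to _∷ᵥ_)
  open import Data.Product using (∃; _×_; _,_; proj₁; proj₂)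
  open import Data.Sum using (_⊎_; inj₁; inj₂)
  open import Data.Empty using (⊥; ⊥-elim)
  open import Data.Unit using (tt)
  import Data.Rational as ℚ
  open import Function using (_∘_)
  open import Relation.Nullary.Decidable using (⌊_⌋)
  open import Relation.Nullary using (yes; no)
  open import Relation.Binary.PropositionalEquality
  open import Data.Nat.Tactic.RingSolver using (solve-∀)

  _≈ᵇ_ : Bool → Bool → Bool
  true  ≈ᵇ b = b
  false ≈ᵇ b = not b

  ≈ᵇ⇒≡ : ∀ {x y} → (x ≈ᵇ y) ≡ true → x ≡ y
  ≈ᵇ⇒≡ {true}  {true}  _ = refl
  ≈ᵇ⇒≡ {false} {false} _ = refl

  bits : ∀ {n} → Graph n → List Bool
  bits {n} ω = map ω (pairs n)

  mono : ∀ {n} → (Fin n → Bool) → Graph n → ℕ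
  mono {n} σ ω = count (λ e → (σ (proj₁ e) ≈ᵇ σ (proj₂ e)) ∧ ω e) (pairs n)

  differ : ∀ {n} → Graph n → Graph n → Fin n × Fin n → Bool
  differ ω ω′ e = ω e xor ω′ e

  ∧-true : ∀ {x y} → (x ∧ y) ≡ true → (x ≡ true) × (y ≡ true)
  ∧-true {true} {true} _ = refl , refl

  private

    zipWith-map : ∀ {n} (ω : Graph n) L → zipWith orient L (map ω L) ≡ map (λ e → orient e (ω e)) L
    zipWith-map ω []      = refl
    zipWith-map ω (e ∷ L) = cong (_ ∷_) (zipWith-map ω L)

    any-true⁺ : ∀ {A : Set} (q : A → Bool) {x xs} → x ∈ xs → q x ≡ true → any q xs ≡ true
    any-true⁺ q (here refl) qx rewrite qx = refl
    any-true⁺ q {xs = y ∷ _} (there x∈) qx rewrite any-true⁺ q x∈ qx with q y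
    ... | true  = refl
    ... | false = refl

    any-true⁻ : ∀ {A : Set} (q : A → Bool) xs → any q xs ≡ true → ∃ λ x → (x ∈ xs) × (q x ≡ true)
    any-true⁻ q (x ∷ xs) h with q x in qx
    ... | true  = x , here refl , qx
    ... | false = let (y , y∈ , qy) = any-true⁻ q xs h in y , there y∈ , qy

    all-true⁺ : ∀ {A : Set} (q : A → Bool) xs → (∀ x → q x ≡ true) → all q xs ≡ true
    all-true⁺ q []       h = refl
    all-true⁺ q (x ∷ xs) h rewrite h x = all-true⁺ q xs h

    all-true⁻ : ∀ {A : Set} (q : A → Bool) {x xs} → all q xs ≡ true → x ∈ xs → q x ≡ true
    all-true⁻ q {xs = y ∷ _} h x∈ with q y in qy
    all-true⁻ q h (here refl) | true = qy
    all-true⁻ q h (there x∈)  | true = all-true⁻ q h x∈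

    isYes-≟ : ∀ {n} (u : Fin n) → ⌊ u Finₚ.≟ u ⌋ ≡ true
    isYes-≟ u with u Finₚ.≟ u
    ... | yes _  = refl
    ... | no u≢u = ⊥-elim (u≢u refl)

    isYes-≟⁻ : ∀ {n} {u v : Fin n} → ⌊ u Finₚ.≟ v ⌋ ≡ true → u ≡ v
    isYes-≟⁻ {u = u} {v} h with u Finₚ.≟ v
    ... | yes u≡v = u≡v

    isYes-Bool : ∀ c → ⌊ c Bool.≟ c ⌋ ≡ true
    isYes-Bool true  = refl
    isYes-Bool false = refl

    isYes-Bool⁻ : ∀ {b c} → ⌊ b Bool.≟ c ⌋ ≡ true → b ≡ c
    isYes-Bool⁻ {true}  {true}  _ = refl
    isYes-Bool⁻ {false} {false} _ = refl

  hasArc⁺ : ∀ {n} (ω : Graph n) {u v} e → e ∈ pairs n → orient e (ω e) ≡ (u , v) → hasArc (arcs n (bits ω)) u v ≡ true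
  hasArc⁺ {n} ω {u} {v} e e∈ eq = any-true⁺ _
    (subst₂ _∈_ eq (sym (zipWith-map ω (pairs n))) (∈-map⁺ (λ e → orient e (ω e)) e∈))
    (cong₂ _∧_ (isYes-≟ u) (isYes-≟ v))

  hasArc⁻ : ∀ {n} (ω : Graph n) {u v} → hasArc (arcs n (bits ω)) u v ≡ true → ∃ λ e → (e ∈ pairs n) × (orient e (ω e) ≡ (u , v))
  hasArc⁻ {n} ω {u} {v} h with any-true⁻ _ (arcs n (bits ω)) h
  ... | (a , b) , ab∈ , qab with ∈-map⁻ (λ e → orient e (ω e)) (subst ((a , b) ∈_) (zipWith-map ω (pairs n)) ab∈) | ∧-true qab
  ... | e , e∈ , eq | qa , qb = e , e∈ , trans (sym eq) (cong₂ _,_ (isYes-≟⁻ qa) (isYes-≟⁻ qb))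

  pair∈pairs : ∀ {n} {u v : Fin n} → toℕ u < toℕ v → (u , v) ∈ pairs n
  pair∈pairs {n} {u} {v} u<v = subst₂ _∈_ (key-< u<v) (sym (pairs-pairsOf n))
    (key∈pairsOf⁺ (∈-allFin u) (∈-allFin v) (λ u≡v → <⇒≢ u<v (cong toℕ u≡v)))

  forward-arc : ∀ {n} (ω : Graph n) {u v} → toℕ u < toℕ v → ω (u , v) ≡ false → hasArc (arcs n (bits ω)) u v ≡ true
  forward-arc ω u<v off = hasArc⁺ ω (_ , _) (pair∈pairs u<v) (cong (orient (_ , _)) off)

  arc-cases : ∀ {n} (ω : Graph n) {u v} → hasArc (arcs n (bits ω)) u v ≡ true →
              (toℕ u < toℕ v × ω (u , v) ≡ false) ⊎ (toℕ v < toℕ u × ω (v , u) ≡ true)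
  arc-cases {n} ω h with hasArc⁻ ω h
  ... | (i , j) , e∈ , eq with ω (i , j) in ωe
  arc-cases {n} ω h | (i , j) , e∈ , refl | true  = inj₂ (pairs-< n e∈ , ωe)
  arc-cases {n} ω h | (i , j) , e∈ , refl | false = inj₁ (pairs-< n e∈ , ωe)

  Transitive : ∀ {n} → Graph n → (Fin n → Bool) → Set
  Transitive {n} ω σ = ∀ a b d → σ a ≡ σ b → σ b ≡ σ d → let arc = hasArc (arcs n (bits ω)) in
                       arc a b ≡ true → arc b d ≡ true → arc a d ≡ true

  transitiveClass⁻ : ∀ {n} (as : List (Fin n × Fin n)) col c → transitiveClass as col c ≡ true →
                     ∀ a b d → lookup col a ≡ c → lookup col b ≡ c → lookup col d ≡ c →
                     hasArc as a b ≡ true → hasArc as b d ≡ true → hasArc as a d ≡ true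
  transitiveClass⁻ as col c h a b d refl b≡c d≡c ab bd
    with all-true⁻ _ (all-true⁻ _ (all-true⁻ _ h (∈-allFin a)) (∈-allFin b)) (∈-allFin d)
  ... | q rewrite b≡c | d≡c | isYes-Bool c | ab | bd = q

  transitiveClass⁺ : ∀ {n} (as : List (Fin n × Fin n)) col c →
                     (∀ a b d → lookup col a ≡ c → lookup col b ≡ c → lookup col d ≡ c →
                      hasArc as a b ≡ true → hasArc as b d ≡ true → hasArc as a d ≡ true) →
                     transitiveClass as col c ≡ true
  transitiveClass⁺ {n} as col c h = all-true⁺ _ (allFin n) λ a → all-true⁺ _ (allFin n) λ b → all-true⁺ _ (allFin n) λ d → pt a b d
    where
    import Data.Bool
    pt : ∀ a b d → (not (⌊ lookup col a Data.Bool.≟ c ⌋ ∧ ⌊ lookup col b Data.Bool.≟ c ⌋ ∧ ⌊ lookup col d Data.Bool.≟ c ⌋)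
                    ∨ not (hasArc as a b ∧ hasArc as b d) ∨ hasArc as a d) ≡ true
    pt a b d with ⌊ lookup col a Data.Bool.≟ c ⌋ in ca | ⌊ lookup col b Data.Bool.≟ c ⌋ in cb | ⌊ lookup col d Data.Bool.≟ c ⌋ in cd | hasArc as a b in ab | hasArc as b d in bd
    ... | false | _     | _     | _     | _     = refl
    ... | true  | false | _     | _     | _     = refl
    ... | true  | true  | false | _     | _     = refl
    ... | true  | true  | true  | false | _     = refl
    ... | true  | true  | true  | true  | false = refl
    ... | true  | true  | true  | true  | true  = h a b d (isYes-Bool⁻ ca) (isYes-Bool⁻ cb) (isYes-Bool⁻ cd) ab bd

  isBP⁻ : ∀ {n} (ω : Graph n) → isBP n (bits ω) ≡ true → ∃ λ (col : Vec Bool n) → Transitive ω (lookup col)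
  isBP⁻ {n} ω h with any-true⁻ _ (allColourings n) h
  ... | col , _ , q with ∧-true {transitiveClass (arcs n (bits ω)) col true} {transitiveClass (arcs n (bits ω)) col false} q
  ... | qt , qf = col , go
    where
    go : Transitive ω (lookup col)
    go a b d ab bd with lookup col b in cb
    ... | true  = transitiveClass⁻ (arcs n (bits ω)) col true  qt a b d ab cb (sym bd)
    ... | false = transitiveClass⁻ (arcs n (bits ω)) col false qf a b d ab cb (sym bd)

  allColourings-complete : ∀ {n} (col : Vec Bool n) → col ∈ allColourings n
  allColourings-complete []ᵥ            = here refl
  allColourings-complete (true  ∷ᵥ col) = ∈-++⁺ˡ (∈-map⁺ (true ∷ᵥ_) (allColourings-complete col))
  allColourings-complete (false ∷ᵥ col) = ∈-++⁺ʳ (map (true ∷ᵥ_) (allColourings _)) (∈-map⁺ (false ∷ᵥ_) (allColourings-complete col))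

  isBP⁺ : ∀ {n} (ω : Graph n) (col : Vec Bool n) → Transitive ω (lookup col) → isBP n (bits ω) ≡ true
  isBP⁺ ω col h = any-true⁺ _ (allColourings-complete col) (cong₂ _∧_ (class true) (class false))
    where
    class : ∀ c → transitiveClass (arcs _ (bits ω)) col c ≡ true
    class c = transitiveClass⁺ (arcs _ (bits ω)) col c λ a b d ca cb cd → h a b d (trans ca (sym cb)) (trans cb (sym cd))

  allBools-complete : ∀ bs → bs ∈ allBools (length bs)
  allBools-complete []           = here refl
  allBools-complete (true  ∷ bs) = ∈-++⁺ˡ (∈-map⁺ (true ∷_) (allBools-complete bs))
  allBools-complete (false ∷ bs) = ∈-++⁺ʳ (map (true ∷_) (allBools (length bs))) (∈-map⁺ (false ∷_) (allBools-complete bs))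

  allBools-length : ∀ m {bs} → bs ∈ allBools m → length bs ≡ m
  allBools-length zero    (here refl) = refl
  allBools-length (suc m) bs∈ with ∈-++⁻ (map (true ∷_) (allBools m)) bs∈
  ... | inj₁ h with ∈-map⁻ (true ∷_) h
  ...   | cs , cs∈ , refl = cong suc (allBools-length m cs∈)
  allBools-length (suc m) bs∈ | inj₂ h with ∈-map⁻ (false ∷_) h
  ...   | cs , cs∈ , refl = cong suc (allBools-length m cs∈)

  private
    cost : ∀ n → List Bool → List Bool → ℕ
    cost n bs bs′ = if isBP n bs′ then hamming bs bs′ else npairs n

    foldr-⊓-≤ : ∀ {A : Set} (f : A → ℕ) z {x xs} → x ∈ xs → foldr _⊓_ z (map f xs) ≤ f x
    foldr-⊓-≤ f z (here refl) = m⊓n≤m _ _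
    foldr-⊓-≤ f z {xs = y ∷ _} (there x∈) = ≤-trans (m⊓n≤n (f y) _) (foldr-⊓-≤ f z x∈)

    foldr-⊓-≥ : ∀ {A : Set} (f : A → ℕ) z {b} xs → b ≤ z → (∀ x → x ∈ xs → b ≤ f x) → b ≤ foldr _⊓_ z (map f xs)
    foldr-⊓-≥ f z []       b≤z h = b≤z
    foldr-⊓-≥ f z (x ∷ xs) b≤z h = ⊓-glb (h x (here refl)) (foldr-⊓-≥ f z xs b≤z (λ y y∈ → h y (there y∈)))

    foldr-⊓-lip : ∀ {A : Set} (f g : A → ℕ) z d xs → (∀ x → f x ≤ g x + d) → foldr _⊓_ z (map f xs) ≤ foldr _⊓_ z (map g xs) + d
    foldr-⊓-lip f g z d []       h = m≤m+n z d
    foldr-⊓-lip f g z d (x ∷ xs) h = ≤-trans (⊓-mono-≤ (h x) (foldr-⊓-lip f g z d xs h)) (≤-reflexive (sym (+-distribʳ-⊓ d (g x) _)))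

    hamming-map : ∀ {n} (ω ω′ : Graph n) L → hamming (map ω L) (map ω′ L) ≡ count (differ ω ω′) L
    hamming-map ω ω′ []      = refl
    hamming-map ω ω′ (e ∷ L) = cong₂ _+_ (lem (ω e) (ω′ e)) (hamming-map ω ω′ L)
      where
      lem : ∀ x y → (if ⌊ x Bool.≟ y ⌋ then 0 else 1) ≡ bit (x xor y)
      lem true  true  = refl
      lem true  false = refl
      lem false true  = refl
      lem false false = refl

    hamming-triangle : ∀ bs cs ds → length bs ≡ length cs → hamming bs ds ≤ hamming cs ds + hamming bs cs
    hamming-triangle []       []       ds       eq = z≤n
    hamming-triangle (b ∷ bs) (c ∷ cs) []       eq = z≤n
    hamming-triangle (b ∷ bs) (c ∷ cs) (d ∷ ds) eq =
      ≤-trans (+-mono-≤ (lem b c d) (hamming-triangle bs cs ds (suc-injective eq)))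
              (≤-reflexive (swap (h c d) (h b c) (hamming cs ds) (hamming bs cs)))
      where
      h : Bool → Bool → ℕ
      h x y = if ⌊ x Bool.≟ y ⌋ then 0 else 1
      lem : ∀ b c d → h b d ≤ h c d + h b c
      lem true  true  true  = z≤n
      lem true  true  false = s≤s z≤n
      lem true  false true  = z≤n
      lem true  false false = s≤s z≤n
      lem false true  true  = s≤s z≤n
      lem false true  false = z≤n
      lem false false true  = s≤s z≤n
      lem false false false = z≤n
      swap : ∀ x y z w → x + y + (z + w) ≡ x + z + (y + w)
      swap = solve-∀

  distance : ∀ {n} → Graph n → ℕ
  distance {n} ω = distBP n (bits ω)

  -- Once the monochromatic back edges are turned forward, every arc inside a class ascends, and
  -- such a class is transitive.
  distance-≤-mono : ∀ {n} (ω : Graph n) (col : Vec Bool n) → distance ω ≤ mono (lookup col) ω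
  distance-≤-mono {n} ω col = begin
      distance ω                           ≤⟨ foldr-⊓-≤ (cost n (bits ω)) (npairs n) (subst (λ m → bits ω′ ∈ allBools m) (length-map ω′ (pairs n)) (allBools-complete (bits ω′))) ⟩
      cost n (bits ω) (bits ω′)            ≡⟨ cong (λ b → if b then hamming (bits ω) (bits ω′) else npairs n) (isBP⁺ ω′ col trans′) ⟩
      hamming (bits ω) (bits ω′)           ≡⟨ hamming-map ω ω′ (pairs n) ⟩
      count (differ ω ω′) (pairs n)        ≡⟨ sumOver-cong (λ e → cong bit (lem (ω e) (σ (proj₁ e) ≈ᵇ σ (proj₂ e)))) (pairs n) ⟩
      mono σ ω                             ∎
    where
    open ≤-Reasoning
    σ : Fin n → Bool
    σ = lookup col
    ω′ : Graph n
    ω′ e = ω e ∧ not (σ (proj₁ e) ≈ᵇ σ (proj₂ e))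
    lem : ∀ x y → (x xor (x ∧ not y)) ≡ (y ∧ x)
    lem true  true  = refl
    lem true  false = refl
    lem false true  = refl
    lem false false = refl
    off : ∀ {u v} → σ u ≡ σ v → ω′ (u , v) ≡ false
    off {u} {v} eq rewrite eq = lem′ (ω (u , v)) (σ v)
      where
      lem′ : ∀ x y → (x ∧ not (y ≈ᵇ y)) ≡ false
      lem′ true  true  = refl
      lem′ true  false = refl
      lem′ false true  = refl
      lem′ false false = refl
    ascending : ∀ {u v} → σ u ≡ σ v → hasArc (arcs n (bits ω′)) u v ≡ true → toℕ u < toℕ v
    ascending eq arc with arc-cases ω′ arc
    ... | inj₁ (u<v , _) = u<v
    ... | inj₂ (_ , on)  = ⊥-elim (contra (trans (sym on) (off (sym eq))))
      where
      contra : true ≡ false → ⊥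
      contra ()
    trans′ : Transitive ω′ σ
    trans′ a b d ab bd arc₁ arc₂ = forward-arc ω′ (<-trans (ascending ab arc₁) (ascending bd arc₂)) (off (trans ab bd))

  -- The hypothesis `b ≤ npairs n` covers the default value that `distBP` assigns to candidates that
  -- are not 2-colourable.
  distance-≥ : ∀ {n} (ω : Graph n) {b} → b ≤ npairs n →
               (∀ ω′ (col : Vec Bool n) → Transitive ω′ (lookup col) → b ≤ count (differ ω ω′) (pairs n)) → b ≤ distance ω
  distance-≥ {n} ω {b} b≤N h = foldr-⊓-≥ (cost n (bits ω)) (npairs n) (allBools (npairs n)) b≤N at
    where
    at : ∀ bs → bs ∈ allBools (npairs n) → b ≤ cost n (bits ω) bs
    at bs bs∈ with isBP n bs in bp
    ... | false = b≤N
    ... | true  = subst (b ≤_) (trans (sym (hamming-map ω ω′ (pairs n))) (cong (hamming (bits ω)) read)) (h ω′ (proj₁ col) (proj₂ col))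
      where
      -- Every candidate outcome is the bit list of a graph, obtained by writing its bits along
      -- `pairs n`.
      ω′ : Graph n
      ω′ = write (λ _ → false) (pairs n) bs
      read : bits ω′ ≡ bs
      read = read-write (λ _ → false) bs (pairs-unique n) (allBools-length (npairs n) bs∈)
      col : ∃ λ (col : Vec Bool n) → Transitive ω′ (lookup col)
      col = isBP⁻ ω′ (trans (cong (isBP n) read) bp)

  -- The cost of each candidate changes by at most the Hamming distance, hence so does the minimum.
  distBP-hamming : ∀ n bs cs → length bs ≡ length cs → distBP n bs ≤ distBP n cs + hamming bs cs
  distBP-hamming n bs cs eq = foldr-⊓-lip (cost n bs) (cost n cs) (npairs n) (hamming bs cs) (allBools (npairs n)) at
    where
    at : ∀ ds → cost n bs ds ≤ cost n cs ds + hamming bs cs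
    at ds with isBP n ds
    ... | true  = hamming-triangle bs cs ds eq
    ... | false = m≤m+n (npairs n) _

  hamming-refl : ∀ bs → hamming bs bs ≡ 0
  hamming-refl []           = refl
  hamming-refl (true ∷ bs)  = hamming-refl bs
  hamming-refl (false ∷ bs) = hamming-refl bs

  hamming-Lipschitz : ∀ m (f : List Bool → ℕ) → (∀ bs cs → length bs ≡ length cs → f bs ≤ f cs + hamming bs cs) → Lipschitz m (λ bs → ι (f bs))
  hamming-Lipschitz zero    f h = tt
  hamming-Lipschitz (suc m) f h = (λ bs _ → flip (true ∷ bs) (false ∷ bs) refl (cong suc (hamming-refl bs)) , flip (false ∷ bs) (true ∷ bs) refl (cong suc (hamming-refl bs))) ,
    hamming-Lipschitz m (f ∘ (true ∷_)) (λ bs cs eq → h (true ∷ bs) (true ∷ cs) (cong suc eq)) ,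
    hamming-Lipschitz m (f ∘ (false ∷_)) (λ bs cs eq → h (false ∷ bs) (false ∷ cs) (cong suc eq))
    where
    flip : ∀ bs cs → length bs ≡ length cs → hamming bs cs ≡ 1 → ι (f bs) ℚ.≤ ι (f cs) ℚ.+ ℚ.1ℚ
    flip bs cs eq one = subst (ι (f bs) ℚ.≤_) (trans (ι-+ (f cs) 1) (cong (ι (f cs) ℚ.+_) ι-1)) (ι-mono (subst (λ d → f bs ≤ f cs + d) one (h bs cs eq)))

  distBP-Lipschitz : ∀ n m → Lipschitz m (λ bs → ι (distBP n bs))
  distBP-Lipschitz n m = hamming-Lipschitz m (distBP n) (distBP-hamming n)

-- From monochromatic back edges to reversals when classes are transitive in any order.

module Reordering where

  open import Defs
  open ListSums
  open VertexPairs
  open Exploration using (Graph)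
  open Distance
  open import Data.Bool using (Bool; true; false; _∧_; _xor_; if_then_else_)
  open import Data.Bool.Properties using (∧-zeroʳ)
  open import Data.Nat
  open import Data.Nat.Properties
  open import Data.Fin using (Fin; zero; suc; toℕ)
  import Data.Fin.Properties as Finₚ
  open import Data.List using (List; []; _∷_; _++_; map; length; allFin; concatMap)
  open import Data.List.Properties using (map-tabulate; length-tabulate)
  open import Data.List.Membership.Propositional using (_∈_)
  open import Data.List.Relation.Unary.Any using (here; there)
  import Data.List.Relation.Unary.All as All
  open import Data.List.Relation.Unary.AllPairs using ([]; _∷_)
  open import Data.List.Relation.Unary.Unique.Propositional using (Unique)
  open import Data.List.Relation.Unary.Unique.Propositional.Properties using (allFin⁺)
  open import Data.Vec using (lookup)
  open import Data.Product using (_×_; _,_; proj₁; proj₂)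
  open import Data.Sum using (inj₁; inj₂)
  open import Data.Empty using (⊥; ⊥-elim)
  open import Relation.Nullary using (yes; no)
  open import Relation.Nullary.Decidable using (⌊_⌋; isYes≗does)
  open import Relation.Binary.PropositionalEquality
  open import Data.Nat.Tactic.RingSolver using (solve-∀)

  -- The weight f as a symmetric matrix with zero diagonal.
  entry : ∀ {n} → (Fin n × Fin n → ℕ) → Fin n → Fin n → ℕ
  entry f u w with u Finₚ.≟ w
  ... | yes _ = 0
  ... | no  _ = f (key u w)

  rowSum : ∀ {n} → (Fin n × Fin n → ℕ) → Fin n → ℕ
  rowSum {n} f v = sumOver (entry f v) (allFin n)

  entry-diag : ∀ {n} (f : Fin n × Fin n → ℕ) v → entry f v v ≡ 0
  entry-diag f v with v Finₚ.≟ v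
  ... | yes _  = refl
  ... | no v≢v = ⊥-elim (v≢v refl)

  entry-off : ∀ {n} (f : Fin n × Fin n → ℕ) {u w} → u ≢ w → entry f u w ≡ f (key u w)
  entry-off f {u} {w} u≢w with u Finₚ.≟ w
  ... | yes u≡w = ⊥-elim (u≢w u≡w)
  ... | no _    = refl

  entry-comm : ∀ {n} (f : Fin n × Fin n → ℕ) u w → entry f u w ≡ entry f w u
  entry-comm f u w with u Finₚ.≟ w
  ... | yes refl = sym (entry-diag f u)
  ... | no u≢w   = trans (cong f (key-comm u w)) (sym (entry-off f (λ w≡u → u≢w (sym w≡u))))

  -- Every pair is seen from both of its ends. In the induction the star of v becomes the row of v
  -- together with one new entry in each other row.
  handshake : ∀ {n} (f : Fin n × Fin n → ℕ) (g : Fin n → ℕ) vs → Unique vs →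
    sumOver (λ e → f e * (g (proj₁ e) + g (proj₂ e))) (pairsOf vs) ≡ sumOver (λ v → g v * sumOver (entry f v) vs) vs
  handshake f g []       []              = refl
  handshake f g (v ∷ vs) vvs!@(v∉ ∷ vs!) = begin
      sumOver F (map (key v) vs ++ pairsOf vs)
    ≡⟨ sumOver-++ F (map (key v) vs) (pairsOf vs) ⟩
      sumOver F (map (key v) vs) + sumOver F (pairsOf vs)
    ≡⟨ cong₂ _+_ (trans (sumOver-map F (key v) vs) (star vs (λ w w∈ → All.lookup v∉ w∈))) (handshake f g vs vs!) ⟩
      g v * S + sumOver (λ w → g w * entry f w v) vs + sumOver (λ w → g w * sumOver (entry f w) vs) vs
    ≡⟨ trans (+-assoc (g v * S) _ _) (cong (g v * S +_) (sym (sumOver-+ (λ w → g w * entry f w v) _ vs))) ⟩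
      g v * S + sumOver (λ w → g w * entry f w v + g w * sumOver (entry f w) vs) vs
    ≡⟨ cong₂ _+_ (cong (λ d → g v * (d + S)) (sym (entry-diag f v))) (sumOver-cong (λ w → sym (*-distribˡ-+ (g w) (entry f w v) _)) vs) ⟩
      g v * (entry f v v + S) + sumOver (λ w → g w * (entry f w v + sumOver (entry f w) vs)) vs ∎
    where

    open ≡-Reasoning
    F : _ → ℕ
    F e = f e * (g (proj₁ e) + g (proj₂ e))
    S : ℕ
    S = sumOver (entry f v) vs
    ends : ∀ w → g (proj₁ (key v w)) + g (proj₂ (key v w)) ≡ g v + g w
    ends w with key-ends v w
    ... | inj₁ eq rewrite eq = refl
    ... | inj₂ eq rewrite eq = +-comm (g w) (g v)
    lem : ∀ a b c s t → a * (b + c) + (b * s + t) ≡ b * (a + s) + (c * a + t)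
    lem = solve-∀
    star : ∀ ws → (∀ w → w ∈ ws → v ≢ w) → sumOver (λ w → F (key v w)) ws ≡ g v * sumOver (entry f v) ws + sumOver (λ w → g w * entry f w v) ws
    star []       h = trans (sym (*-zeroʳ (g v))) (sym (+-identityʳ _))
    star (w ∷ ws) h = trans (cong₂ _+_ (cong₂ _*_ (sym (entry-off f (h w (here refl)))) (ends w)) (star ws (λ x x∈ → h x (there x∈))))
      (trans (lem (entry f v w) (g v) (g w) (sumOver (entry f v) ws) _)
             (cong (λ a → g v * (entry f v w + sumOver (entry f v) ws) + (g w * a + sumOver (λ w → g w * entry f w v) ws)) (entry-comm f v w)))

  pairs-handshake : ∀ {n} (f : Fin n × Fin n → ℕ) (g : Fin n → ℕ) →
    sumOver (λ e → f e * (g (proj₁ e) + g (proj₂ e))) (pairs n) ≡ sumOver (λ v → g v * rowSum f v) (allFin n)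
  pairs-handshake {n} f g = trans (cong (sumOver _) (pairs-pairsOf n)) (handshake f g (allFin n) (allFin⁺ n))

  entry-mono : ∀ {n} {f g : Fin n × Fin n → ℕ} → (∀ e → f e ≤ g e) → ∀ u w → entry f u w ≤ entry g u w
  entry-mono h u w with u Finₚ.≟ w
  ... | yes _ = z≤n
  ... | no  _ = h (key u w)

  entry-+ : ∀ {n} (f g : Fin n × Fin n → ℕ) u w → entry (λ e → f e + g e) u w ≡ entry f u w + entry g u w
  entry-+ f g u w with u Finₚ.≟ w
  ... | yes _ = refl
  ... | no  _ = refl

  inside : ∀ {n} → (Fin n → Bool) → Fin n → Fin n → Fin n → Bool
  inside σ i j k = (toℕ k <ᵇ toℕ j) ∧ ((toℕ i <ᵇ toℕ k) ∧ (σ i ≈ᵇ σ k))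

  between : ∀ {n} → (Fin n → Bool) → Fin n → Fin n → ℕ
  between {n} σ i j = count (inside σ i j) (allFin n)

  -- On these pairs a back edge may survive without forcing enough reversals at its ends.
  isShort : ∀ {n} → ℕ → (Fin n → Bool) → Fin n × Fin n → Bool
  isShort L σ (i , j) = (σ i ≈ᵇ σ j) ∧ (between σ i j <ᵇ L)

  short : ∀ {n} → ℕ → (Fin n → Bool) → Graph n → ℕ
  short {n} L σ ω = count (λ e → isShort L σ e ∧ ω e) (pairs n)

  degree : ∀ {n} → Graph n → Fin n → ℕ
  degree ω = rowSum (λ e → bit (ω e))

  private
    <-irr-Bool : true ≡ false → ⊥
    <-irr-Bool ()

  module _ {n : ℕ} (ω ω′ : Graph n) (σ : Fin n → Bool) (trans-ω′ : Transitive ω′ σ) where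

    -- A vertex k of the class between the ends of the back edge j → i would close a cyclic triangle
    -- unless one of i → k, k → j is also reversed.
    between-≤ : ∀ i j → toℕ i < toℕ j → ω′ (i , j) ≡ true → σ i ≡ σ j →
                between σ i j ≤ rowSum (λ e → bit (ω′ e)) i + rowSum (λ e → bit (ω′ e)) j
    between-≤ i j i<j on σi≡σj = ≤-trans (sumOver-mono (allFin n) (λ k _ → at k)) (≤-reflexive (sumOver-+ (entry f i) (entry f j) (allFin n)))
      where
      f : Fin n × Fin n → ℕ
      f e = bit (ω′ e)
      at : ∀ k → bit (inside σ i j k) ≤ entry f i k + entry f j k
      at k with inside σ i j k in eq
      ... | false = z≤n
      ... | true with ∧-true {toℕ k <ᵇ toℕ j} eq
      ... | k<ᵇj , r with ∧-true {toℕ i <ᵇ toℕ k} r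
      ... | i<ᵇk , s = subst (1 ≤_) (sym (cong₂ _+_ (trans (entry-off f i≢k) (cong f (key-< i<k))) (trans (entry-off f j≢k) (cong f (key-> k<j))))) some
        where
        k<j : toℕ k < toℕ j
        k<j = <ᵇ≡true⇒< _ _ k<ᵇj
        i<k : toℕ i < toℕ k
        i<k = <ᵇ≡true⇒< _ _ i<ᵇk
        i≢k : i ≢ k
        i≢k i≡k = <⇒≢ i<k (cong toℕ i≡k)
        j≢k : j ≢ k
        j≢k j≡k = <⇒≢ k<j (cong toℕ (sym j≡k))
        some : 1 ≤ f (i , k) + f (k , j)
        some with ω′ (i , k) in ik | ω′ (k , j) in kj
        ... | true  | _     = s≤s z≤n
        ... | false | true  = s≤s z≤n
        ... | false | false with arc-cases ω′ (trans-ω′ i k j (≈ᵇ⇒≡ s) (trans (sym (≈ᵇ⇒≡ s)) σi≡σj) (forward-arc ω′ i<k ik) (forward-arc ω′ k<j kj))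
        ...   | inj₁ (_ , off) = ⊥-elim (<-irr-Bool (trans (sym on) off))
        ...   | inj₂ (j<i , _) = ⊥-elim (<-asym i<j j<i)

    -- A monochromatic back edge is reversed, or short, or long and kept. In the last case the
    -- degrees of its ends in ω′ sum to at least L, while those in ω contribute at most L/4 each, so
    -- the ends carry at least L/2 reversals. Each edge is given weight L and charged accordingly.
    mono-≤-reversals : ∀ L → 1 ≤ L → (∀ v → 4 * degree ω v ≤ L) →
                       mono σ ω ≤ 2 * count (differ ω ω′) (pairs n) + short L σ ω
    mono-≤-reversals L@(suc _) _ deg≤ = *-cancelˡ-≤ L (begin
        L * mono σ ω
      ≡⟨ sumOver-* L _ (pairs n) ⟨
        sumOver (λ e → L * bit ((σ (proj₁ e) ≈ᵇ σ (proj₂ e)) ∧ ω e)) (pairs n)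
      ≤⟨ sumOver-mono (pairs n) (λ e e∈ → per-edge e (pairs-< n e∈)) ⟩
        sumOver (λ e → L * bit (differ ω ω′ e) + (L * bit (isShort L σ e ∧ ω e) + 2 * (bit (ω e) * (rev (proj₁ e) + rev (proj₂ e))))) (pairs n)
      ≡⟨ trans (sumOver-+ _ _ (pairs n)) (cong₂ _+_ (sumOver-* L _ (pairs n)) (trans (sumOver-+ _ _ (pairs n)) (cong₂ _+_ (sumOver-* L _ (pairs n)) (sumOver-* 2 _ (pairs n))))) ⟩
        L * D + (L * short L σ ω + 2 * sumOver (λ e → bit (ω e) * (rev (proj₁ e) + rev (proj₂ e))) (pairs n))
      ≤⟨ +-monoʳ-≤ (L * D) (+-monoʳ-≤ (L * short L σ ω) total) ⟩
        L * D + (L * short L σ ω + L * D)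
      ≡⟨ lem L D (short L σ ω) ⟩
        L * (2 * D + short L σ ω) ∎)
      where
      open ≤-Reasoning
      lem : ∀ L D s → L * D + (L * s + L * D) ≡ L * (2 * D + s)
      lem = solve-∀
      D : ℕ
      D = count (differ ω ω′) (pairs n)
      rev deg′ : Fin n → ℕ
      rev = rowSum (λ e → bit (differ ω ω′ e))
      deg′ = rowSum (λ e → bit (ω′ e))
      deg′≤ : ∀ v → deg′ v ≤ degree ω v + rev v
      deg′≤ v = ≤-trans (sumOver-mono (allFin n) (λ w _ → ≤-trans (entry-mono (λ e → bits≤ (ω e) (ω′ e)) v w) (≤-reflexive (entry-+ (λ e → bit (ω e)) (λ e → bit (differ ω ω′ e)) v w))))
                        (≤-reflexive (sumOver-+ (entry (λ e → bit (ω e)) v) _ (allFin n)))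
        where
        bits≤ : ∀ x y → bit y ≤ bit x + bit (x xor y)
        bits≤ true  true  = s≤s z≤n
        bits≤ true  false = z≤n
        bits≤ false true  = s≤s z≤n
        bits≤ false false = z≤n
      long-≤ : ∀ i j → L ≤ between σ i j → toℕ i < toℕ j → ω′ (i , j) ≡ true → σ i ≡ σ j → L ≤ 2 * (rev i + rev j)
      long-≤ i j L≤ i<j on eq = +-cancelˡ-≤ L L _ (begin
          L + L
        ≡⟨ cong (L +_) (+-identityʳ L) ⟨
          2 * L
        ≤⟨ *-monoʳ-≤ 2 (≤-trans L≤ (≤-trans (between-≤ i j i<j on eq) (+-mono-≤ (deg′≤ i) (deg′≤ j)))) ⟩
          2 * ((degree ω i + rev i) + (degree ω j + rev j))
        ≡⟨ lem₁ (degree ω i) (degree ω j) (rev i) (rev j) ⟩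
          2 * (degree ω i + degree ω j) + 2 * (rev i + rev j)
        ≤⟨ +-monoˡ-≤ (2 * (rev i + rev j)) degrees≤ ⟩
          L + 2 * (rev i + rev j) ∎)
        where
        degrees≤ : 2 * (degree ω i + degree ω j) ≤ L
        degrees≤ = *-cancelˡ-≤ 2 (≤-trans (≤-reflexive (lem₂ (degree ω i) (degree ω j))) (≤-trans (+-mono-≤ (deg≤ i) (deg≤ j)) (≤-reflexive (cong (L +_) (sym (+-identityʳ L))))))
          where
          lem₂ : ∀ a b → 2 * (2 * (a + b)) ≡ 4 * a + 4 * b
          lem₂ = solve-∀
        lem₁ : ∀ a b c d → 2 * ((a + c) + (b + d)) ≡ 2 * (a + b) + 2 * (c + d)
        lem₁ = solve-∀
      per-edge : ∀ e → toℕ (proj₁ e) < toℕ (proj₂ e) → L * bit ((σ (proj₁ e) ≈ᵇ σ (proj₂ e)) ∧ ω e) ≤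
                 L * bit (differ ω ω′ e) + (L * bit (isShort L σ e ∧ ω e) + 2 * (bit (ω e) * (rev (proj₁ e) + rev (proj₂ e))))
      per-edge (i , j) i<j with σ i ≈ᵇ σ j in same | ω (i , j) | ω′ (i , j) in on
      ... | false | _     | _     = ≤-trans (≤-reflexive (*-zeroʳ L)) z≤n
      ... | true  | false | _     = ≤-trans (≤-reflexive (*-zeroʳ L)) z≤n
      ... | true  | true  | false = m≤m+n (L * 1) _
      ... | true  | true  | true  with between σ i j <ᵇ L in sh
      ...   | true  = ≤-trans (m≤m+n (L * 1) _) (m≤n+m _ (L * 0))
      ...   | false = ≤-trans (≤-reflexive (*-identityʳ L)) (≤-trans (long-≤ i j (≮ᵇ⇒≥ (between σ i j) L sh) i<j on (≈ᵇ⇒≡ same))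
                        (≤-trans (≤-reflexive (cong (2 *_) (sym (+-identityʳ (rev i + rev j))))) (≤-trans (m≤n+m _ (L * 0)) (m≤n+m _ (L * 0)))))
      -- Double counting: the reversals at the ends of all back edges sum to degree times reversals
      -- over the vertices. Degrees are at most L/4, and every reversal has two ends.
      total : 2 * sumOver (λ e → bit (ω e) * (rev (proj₁ e) + rev (proj₂ e))) (pairs n) ≤ L * D
      total = *-cancelˡ-≤ 2 (begin
          2 * (2 * sumOver (λ e → bit (ω e) * (rev (proj₁ e) + rev (proj₂ e))) (pairs n))
        ≡⟨ trans (sym (*-assoc 2 2 (sumOver (λ e → bit (ω e) * (rev (proj₁ e) + rev (proj₂ e))) (pairs n)))) (cong (4 *_) (pairs-handshake (λ e → bit (ω e)) rev)) ⟩
          4 * sumOver (λ v → rev v * degree ω v) (allFin n)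
        ≡⟨ sumOver-* 4 _ (allFin n) ⟨
          sumOver (λ v → 4 * (rev v * degree ω v)) (allFin n)
        ≤⟨ sumOver-mono (allFin n) (λ v _ → ≤-trans (≤-reflexive (lem₃ (rev v) (degree ω v))) (*-monoˡ-≤ (rev v) (deg≤ v))) ⟩
          sumOver (λ v → L * rev v) (allFin n)
        ≡⟨ sumOver-* L rev (allFin n) ⟩
          L * sumOver rev (allFin n)
        ≡⟨ cong (L *_) (trans (sumOver-cong (λ v → sym (+-identityʳ (rev v))) (allFin n)) (sym (pairs-handshake (λ e → bit (differ ω ω′ e)) (λ _ → 1)))) ⟩
          L * sumOver (λ e → bit (differ ω ω′ e) * 2) (pairs n)
        ≡⟨ cong (L *_) (trans (sumOver-cong (λ e → *-comm (bit (differ ω ω′ e)) 2) (pairs n)) (sumOver-* 2 _ (pairs n))) ⟩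
          L * (2 * D)
        ≡⟨ lem₄ L D ⟩
          2 * (L * D) ∎)
        where
        lem₃ : ∀ r d → 4 * (r * d) ≡ 4 * d * r
        lem₃ = solve-∀
        lem₄ : ∀ L D → L * (2 * D) ≡ 2 * (L * D)
        lem₄ = solve-∀

  sumOver-allFin-suc : ∀ n (f : Fin (suc n) → ℕ) → sumOver f (allFin (suc n)) ≡ f zero + sumOver (λ i → f (suc i)) (allFin n)
  sumOver-allFin-suc n f = cong (f zero +_) (trans (cong (sumOver f) (sym (map-tabulate (λ i → i) Fin.suc))) (sumOver-map f suc (allFin n)))

  -- The counted j are the first L elements of `P`. The induction peels off vertex 0, which uses up
  -- one unit of L if it satisfies `P`.
  count-first : ∀ n (P : Fin n → Bool) L → count (λ j → P j ∧ (count (λ k → (toℕ k <ᵇ toℕ j) ∧ P k) (allFin n) <ᵇ L)) (allFin n) ≤ L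
  count-first zero    P L = z≤n
  count-first (suc n) P L = ≤-trans (≤-reflexive (trans (sumOver-allFin-suc n _) (cong₂ _+_ (head≡) (sumOver-cong tail≡ (allFin n))))) (go (P zero) L)
    where
    Q : Fin n → ℕ
    Q j = count (λ k → (toℕ k <ᵇ toℕ j) ∧ P (suc k)) (allFin n)
    head≡ : bit (P zero ∧ (count (λ k → (toℕ k <ᵇ 0) ∧ P k) (allFin (suc n)) <ᵇ L)) ≡ bit (P zero ∧ (0 <ᵇ L))
    head≡ = cong (λ c → bit (P zero ∧ (c <ᵇ L))) (zeros (allFin (suc n)))
      where
      zeros : ∀ ks → count {A = Fin (suc n)} (λ k → (toℕ k <ᵇ 0) ∧ P k) ks ≡ 0
      zeros []       = refl
      zeros (k ∷ ks) = zeros ks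
    tail≡ : ∀ j → bit (P (suc j) ∧ (count (λ k → (toℕ k <ᵇ suc (toℕ j)) ∧ P k) (allFin (suc n)) <ᵇ L)) ≡ bit (P (suc j) ∧ (bit (P zero) + Q j <ᵇ L))
    tail≡ j = cong (λ c → bit (P (suc j) ∧ (c <ᵇ L))) (sumOver-allFin-suc n _)
    go : ∀ b L → bit (b ∧ (0 <ᵇ L)) + sumOver (λ j → bit (P (suc j) ∧ (bit b + Q j <ᵇ L))) (allFin n) ≤ L
    go false L       = count-first n (λ k → P (suc k)) L
    go true  zero    = ≤-reflexive (zeros (allFin n))
      where
      zeros : ∀ ks → sumOver (λ j → bit (P (suc j) ∧ false)) ks ≡ 0
      zeros []       = refl
      zeros (k ∷ ks) = cong₂ _+_ (cong bit (∧-zeroʳ (P (suc k)))) (zeros ks)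
    go true  (suc L) = s≤s (count-first n (λ k → P (suc k)) L)

  sumOver-concatMap : ∀ {A B : Set} (f : B → ℕ) (h : A → List B) xs → sumOver f (concatMap h xs) ≡ sumOver (λ x → sumOver f (h x)) xs
  sumOver-concatMap f h []       = refl
  sumOver-concatMap f h (x ∷ xs) = trans (sumOver-++ f (h x) (concatMap h xs)) (cong (sumOver f (h x) +_) (sumOver-concatMap f h xs))

  -- For fixed i the partners j are among the first L vertices after i in the class of i.
  count-short : ∀ n L (σ : Fin n → Bool) → count (isShort L σ) (pairs n) ≤ n * L
  count-short n L σ = ≤-trans (≤-reflexive (sumOver-concatMap _ _ (allFin n)))
    (≤-trans (sumOver-≤-length L row≤ (allFin n)) (≤-reflexive (cong (_* L) {length (allFin n)} {n} (length-tabulate (λ i → i)))))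
    where
    open ≤-Reasoning
    row≤ : ∀ i → sumOver (λ e → bit (isShort L σ e)) (concatMap (λ j → if ⌊ toℕ i <? toℕ j ⌋ then (i , j) ∷ [] else []) (allFin n)) ≤ L
    row≤ i = begin
        _
      ≡⟨ sumOver-concatMap (λ e → bit (isShort L σ e)) _ (allFin n) ⟩
        sumOver (λ j → sumOver (λ e → bit (isShort L σ e)) (if ⌊ toℕ i <? toℕ j ⌋ then (i , j) ∷ [] else [])) (allFin n)
      ≡⟨ sumOver-cong at (allFin n) ⟩
        count (λ j → ((toℕ i <ᵇ toℕ j) ∧ (σ i ≈ᵇ σ j)) ∧ (between σ i j <ᵇ L)) (allFin n)
      ≤⟨ count-first n (λ j → (toℕ i <ᵇ toℕ j) ∧ (σ i ≈ᵇ σ j)) L ⟩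
        L ∎
      where
      at : ∀ j → sumOver (λ e → bit (isShort L σ e)) (if ⌊ toℕ i <? toℕ j ⌋ then (i , j) ∷ [] else []) ≡
                 bit (((toℕ i <ᵇ toℕ j) ∧ (σ i ≈ᵇ σ j)) ∧ (between σ i j <ᵇ L))
      at j rewrite isYes≗does (toℕ i <? toℕ j) with toℕ i <ᵇ toℕ j
      ... | true  = +-identityʳ _
      ... | false = refl

-- A colouring built along the exploration.

module GreedyColouring where

  open import Defs
  open ListSums
  open VertexPairs
  open Concentration
  open Exploration
  open Distance
  open import Data.Bool using (Bool; true; false; _∧_; not; if_then_else_)
  open import Data.Bool.Properties using (∧-zeroʳ)
  open import Data.Nat
  open import Data.Nat.Properties
  open import Data.Fin using (Fin)
  import Data.Fin.Properties as Finₚ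
  open import Data.List using (List; []; _∷_; _++_; map; length; allFin)
  open import Data.List.Properties using (++-assoc; length-tabulate)
  open import Data.List.Membership.Propositional using (_∈_; _∉_)
  open import Data.List.Membership.Propositional.Properties using (∈-++⁺ʳ)
  import Data.List.Membership.DecPropositional as DecMembership
  open import Data.List.Relation.Unary.Any using (here; there)
  open import Data.List.Relation.Unary.All using (All; []; _∷_)
  open import Data.List.Relation.Unary.AllPairs using ([]; _∷_)
  open import Data.List.Relation.Unary.Unique.Propositional using (Unique)
  open import Data.List.Relation.Unary.Unique.Propositional.Properties using (allFin⁺)
  open import Data.List.Relation.Binary.Permutation.Propositional using (_↭_; trans; ↭-sym; ↭-reflexive)
  import Data.List.Relation.Binary.Permutation.Propositional.Properties as Perm
  open import Data.Vec using (Vec; lookup; tabulate)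
  open import Data.Vec.Properties using (lookup∘tabulate)
  open import Data.Product using (∃; _×_; _,_; proj₁; proj₂)
  open import Data.Sum using (inj₁; inj₂)
  open import Data.Empty using (⊥-elim)
  open import Relation.Nullary using (yes; no)
  open import Relation.Nullary.Decidable using (⌊_⌋)
  open import Relation.Binary.PropositionalEquality hiding (trans)
  import Relation.Binary.PropositionalEquality as ≡

  ∈-keep⁻ : ∀ {A : Set} (q : A → Bool) xs {x} → x ∈ keep q xs → (x ∈ xs) × (q x ≡ true)
  ∈-keep⁻ q (y ∷ xs) x∈ with q y in qy
  ∈-keep⁻ q (y ∷ xs) (here refl) | true = here refl , qy
  ∈-keep⁻ q (y ∷ xs) (there x∈)  | true = let (a , b) = ∈-keep⁻ q xs x∈ in there a , b
  ... | false = let (a , b) = ∈-keep⁻ q xs x∈ in there a , b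

  monoIn : ∀ {n} → (Fin n → Bool) → Graph n → List (Fin n × Fin n) → ℕ
  monoIn σ ω = count (λ e → (σ (proj₁ e) ≈ᵇ σ (proj₂ e)) ∧ ω e)

  ≈ᵇ-comm : ∀ x y → (x ≈ᵇ y) ≡ (y ≈ᵇ x)
  ≈ᵇ-comm true  true  = refl
  ≈ᵇ-comm true  false = refl
  ≈ᵇ-comm false true  = refl
  ≈ᵇ-comm false false = refl

  monoIn-star : ∀ {n} (σ : Fin n → Bool) ω v ws → monoIn σ ω (map (key v) ws) ≡ count (λ w → (σ v ≈ᵇ σ w) ∧ ω (key v w)) ws
  monoIn-star σ ω v ws = ≡.trans (sumOver-map _ (key v) ws) (sumOver-cong (λ w → cong (λ b → bit (b ∧ ω (key v w))) (ends w)) ws)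
    where
    ends : ∀ w → (σ (proj₁ (key v w)) ≈ᵇ σ (proj₂ (key v w))) ≡ (σ v ≈ᵇ σ w)
    ends w with key-ends v w
    ... | inj₁ eq rewrite eq = refl
    ... | inj₂ eq rewrite eq = ≈ᵇ-comm (σ w) (σ v)

  bit-∧ʳ : ∀ x y → bit (x ∧ y) ≤ bit y
  bit-∧ʳ true  y = ≤-refl
  bit-∧ʳ false y = z≤n

  open Search 1 (λ _ → 0)

  -- Colours are prescribed by `σ₀` outside `U`: active vertices keep theirs, and only unexplored
  -- vertices may still change.
  Coloured : ∀ {n} → Graph n → (Fin n → Bool) → List (Fin n) → List (Fin n × Fin n) → ℕ → Set
  Coloured {n} ω σ₀ U L m = ∃ λ (σ : Fin n → Bool) → (∀ x → x ∉ U → σ x ≡ σ₀ x) × (monoIn σ ω L ≤ m)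

  private
    GoodFuel : ℕ → Set
    GoodFuel k = ∀ {n} (ω : Graph n) A U σ₀ → Unique (A ++ U) → length (A ++ U) ≡ k → Coloured ω σ₀ U (pairsOf (A ++ U)) (run k ω A U)

  -- Newly found neighbours of v get the colour opposite to v, so only edges from v to other active vertices can be monochromatic.
  colour-explore : ∀ k → GoodFuel k → ∀ {n} (ω : Graph n) v A U σ₀ → Unique (v ∷ A ++ U) → length (A ++ U) ≡ k →
    Coloured ω σ₀ U (pairsOf (v ∷ A ++ U)) (count (λ w → ω (key v w)) A + run k ω (A ++ nbrs ω v U) (rest ω v U))
  colour-explore k IH {n} ω v A U σ₀ vAU!@(v∉ ∷ AU!) len = σ , outside , bound
    where
    open DecMembership (Finₚ._≟_ {n}) using (_∈?_)
    A₁ U₁ : List (Fin n)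
    A₁ = A ++ nbrs ω v U
    U₁ = rest ω v U
    perm : A₁ ++ U₁ ↭ A ++ U
    perm = trans (↭-reflexive (++-assoc A (nbrs ω v U) U₁)) (Perm.++⁺ˡ A (keep-↭ (λ x → ω (key v x)) U))
    -- All of `U` gets the colour opposite to v. The recursive call may recolour only `U₁`, so
    -- exactly the neighbours of v are bound by this choice.
    σ₁ : Fin n → Bool
    σ₁ x = if ⌊ x ∈? U ⌋ then not (σ₀ v) else σ₀ x
    σ₁-in : ∀ {x} → x ∈ U → σ₁ x ≡ not (σ₀ v)
    σ₁-in {x} x∈ with x ∈? U
    ... | yes _ = refl
    ... | no x∉ = ⊥-elim (x∉ x∈)
    σ₁-out : ∀ {x} → x ∉ U → σ₁ x ≡ σ₀ x
    σ₁-out {x} x∉ with x ∈? U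
    ... | yes x∈ = ⊥-elim (x∉ x∈)
    ... | no _   = refl
    ih : Coloured ω σ₁ U₁ (pairsOf (A₁ ++ U₁)) (run k ω A₁ U₁)
    ih = IH ω A₁ U₁ σ₁ (Unique-↭ (↭-sym perm) AU!) (≡.trans (Perm.↭-length perm) len)
    σ : Fin n → Bool
    σ = proj₁ ih
    ∈U₁⇒ : ∀ {x} → x ∈ U₁ → (x ∈ U) × (not (ω (key v x)) ≡ true)
    ∈U₁⇒ = ∈-keep⁻ (λ x → not (ω (key v x))) U
    outside : ∀ x → x ∉ U → σ x ≡ σ₀ x
    outside x x∉ = ≡.trans (proj₁ (proj₂ ih) x (λ x∈ → x∉ (proj₁ (∈U₁⇒ x∈)))) (σ₁-out x∉)
    σv : σ v ≡ σ₀ v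
    σv = outside v (λ v∈ → ∉-unique vAU! (∈-++⁺ʳ A v∈))
    cross : ∀ w → w ∈ U → bit ((σ v ≈ᵇ σ w) ∧ ω (key v w)) ≤ 0
    cross w w∈ with ω (key v w) in vw
    ... | false = ≤-reflexive (cong bit (∧-zeroʳ (σ v ≈ᵇ σ w)))
    ... | true  = ≤-reflexive (cong (λ b → bit (b ∧ true)) (≡.trans (cong₂ _≈ᵇ_ σv (≡.trans (proj₁ (proj₂ ih) w w∉) (σ₁-in w∈))) (lem (σ₀ v))))
      where
      lem : ∀ b → (b ≈ᵇ not b) ≡ false
      lem true  = refl
      lem false = refl
      w∉ : w ∉ U₁
      w∉ w∈₁ with ≡.trans (sym (proj₂ (∈U₁⇒ w∈₁))) (cong not vw)
      ... | ()
    bound : monoIn σ ω (pairsOf (v ∷ A ++ U)) ≤ count (λ w → ω (key v w)) A + run k ω A₁ U₁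
    bound = begin
        monoIn σ ω (map (key v) (A ++ U) ++ pairsOf (A ++ U))
      ≡⟨ sumOver-++ _ (map (key v) (A ++ U)) (pairsOf (A ++ U)) ⟩
        monoIn σ ω (map (key v) (A ++ U)) + monoIn σ ω (pairsOf (A ++ U))
      ≡⟨ cong₂ _+_ (≡.trans (monoIn-star σ ω v (A ++ U)) (sumOver-++ _ A U)) (sumOver-↭ _ (pairsOf-↭ (↭-sym perm))) ⟩
        (count (λ w → (σ v ≈ᵇ σ w) ∧ ω (key v w)) A + count (λ w → (σ v ≈ᵇ σ w) ∧ ω (key v w)) U) + monoIn σ ω (pairsOf (A₁ ++ U₁))
      ≤⟨ +-mono-≤ (+-mono-≤ (sumOver-mono A (λ w _ → bit-∧ʳ (σ v ≈ᵇ σ w) (ω (key v w)))) (≤-trans (sumOver-mono U cross) (≤-reflexive (zeros U)))) (proj₂ (proj₂ ih)) ⟩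
        (count (λ w → ω (key v w)) A + 0) + run k ω A₁ U₁
      ≡⟨ cong (_+ run k ω A₁ U₁) (+-identityʳ _) ⟩
        count (λ w → ω (key v w)) A + run k ω A₁ U₁ ∎
      where
      open ≤-Reasoning
      zeros : ∀ (ws : List (Fin n)) → sumOver (λ _ → 0) ws ≡ 0
      zeros []       = refl
      zeros (_ ∷ ws) = zeros ws

  greedy : ∀ k → GoodFuel k
  greedy zero    ω []      []      σ₀ AU! len = σ₀ , (λ _ _ → refl) , z≤n
  greedy (suc k) ω []      (x ∷ U) σ₀ AU! len with colour-explore k (greedy k) ω x [] U σ₀ AU! (suc-injective len)
  ... | σ , out , b = σ , (λ y y∉ → out y (λ y∈ → y∉ (there y∈))) , b
  greedy (suc k) ω (v ∷ A) U       σ₀ AU! len with colour-explore k (greedy k) ω v A U σ₀ AU! (suc-injective len)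
  ... | σ , out , b = σ , out , ≤-trans b (≤-reflexive (cong (_+ run k ω (A ++ nbrs ω v U) (rest ω v U)) (sym (+-identityʳ _))))

  distance-≤-run : ∀ {n} (ω : Graph n) → distance ω ≤ run n ω [] (allFin n)
  distance-≤-run {n} ω with greedy n ω [] (allFin n) (λ _ → true) (allFin⁺ n) (length-tabulate (λ i → i))
  ... | σ , _ , b = begin
      distance ω                          ≤⟨ distance-≤-mono ω (tabulate σ) ⟩
      mono (lookup (tabulate σ)) ω        ≡⟨ sumOver-cong (λ e → cong₂ (λ x y → bit ((x ≈ᵇ y) ∧ ω e)) (lookup∘tabulate σ (proj₁ e)) (lookup∘tabulate σ (proj₂ e))) (pairs n) ⟩
      mono σ ω                            ≡⟨ cong (monoIn σ ω) (pairs-pairsOf n) ⟩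
      monoIn σ ω (pairsOf (allFin n))     ≤⟨ b ⟩
      run n ω [] (allFin n)               ∎
    where open ≤-Reasoning

-- Quadratic potential for the expected number of monochromatic edges.

module UpperBound where

  open import Defs using (pairs)
  open Rationals
  open VertexPairs
  open Concentration
  open Exploration
  open Distance using (distance)
  open GreedyColouring using (distance-≤-run)
  open import Data.Nat as ℕ using (ℕ; zero; suc; _∸_)
  import Data.Nat.Properties as ℕₚ
  open import Data.List using (List; []; allFin)
  open import Data.List.Properties using (length-tabulate)
  open import Data.List.Relation.Unary.Unique.Propositional.Properties using (allFin⁺)
  open import Data.Integer using (+_)
  open import Data.Rational
  open import Data.Rational.Properties
  open import Data.Sum using (inj₁; inj₂)
  open import Relation.Binary.PropositionalEquality
  open import Tactic.RingSolver using (solve-∀)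

  𝔼-square : ∀ p u x → 𝔼 p u (λ bs → (x + ι (trues bs)) * (x + ι (trues bs))) ≡ (x + ι u * p) * (x + ι u * p) + ι u * (p * (1ℚ - p))
  𝔼-square p zero x rewrite ι-0 = lem p x
    where
    lem : ∀ p x → (x + 0ℚ) * (x + 0ℚ) ≡ (x + 0ℚ * p) * (x + 0ℚ * p) + 0ℚ * (p * (1ℚ - p))
    lem = solve-∀ ℚ-ring
  𝔼-square p (suc u) x = begin
      p * 𝔼 p u (λ bs → (x + ι (suc (trues bs))) * (x + ι (suc (trues bs)))) + (1ℚ - p) * 𝔼 p u (λ bs → (x + ι (trues bs)) * (x + ι (trues bs)))
    ≡⟨ cong₂ (λ y z → p * y + (1ℚ - p) * z) (trans (𝔼-cong p u (λ bs → cong (λ y → y * y) (shift (trues bs)))) (𝔼-square p u (x + 1ℚ))) (𝔼-square p u x) ⟩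
      p * ((x + 1ℚ + ι u * p) * (x + 1ℚ + ι u * p) + ι u * (p * (1ℚ - p))) + (1ℚ - p) * ((x + ι u * p) * (x + ι u * p) + ι u * (p * (1ℚ - p)))
    ≡⟨ lem p x (ι u) ⟩
      (x + (1ℚ + ι u) * p) * (x + (1ℚ + ι u) * p) + (1ℚ + ι u) * (p * (1ℚ - p))
    ≡⟨ cong (λ v → (x + v * p) * (x + v * p) + v * (p * (1ℚ - p))) (ι-suc u) ⟨
      (x + ι (suc u) * p) * (x + ι (suc u) * p) + ι (suc u) * (p * (1ℚ - p)) ∎
    where
    open ≡-Reasoning
    assoc : ∀ x t → x + (1ℚ + t) ≡ x + 1ℚ + t
    assoc = solve-∀ ℚ-ring
    shift : ∀ t → x + ι (suc t) ≡ x + 1ℚ + ι t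
    shift t = trans (cong (λ y → x + y) (ι-suc t)) (assoc x (ι t))
    lem : ∀ p x u → p * ((x + 1ℚ + u * p) * (x + 1ℚ + u * p) + u * (p * (1ℚ - p))) + (1ℚ - p) * ((x + u * p) * (x + u * p) + u * (p * (1ℚ - p)))
                  ≡ (x + (1ℚ + u) * p) * (x + (1ℚ + u) * p) + (1ℚ + u) * (p * (1ℚ - p))
    lem = solve-∀ ℚ-ring

  -- With a active vertices and k vertices left, the potential is c₀(k) + c₂(k) a². Here ν = 1/n, e bounds the
  -- excess drift ε of the active set, f = 1/e, and w(k) counts the steps left until the drift is at most -e.
  module Potential
    (n L : ℕ) (p e f ν : ℚ) (0≤p : 0ℚ ≤ p) (p≤1 : p ≤ 1ℚ) (0≤e : 0ℚ ≤ e) (e≤1 : e ≤ 1ℚ) (0≤f : 0ℚ ≤ f) (ef : e * f ≡ 1ℚ)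
    (0≤ν : 0ℚ ≤ ν) (nν : ι n * ν ≡ 1ℚ) (fν≤1 : f * ν ≤ 1ℚ) (p≤ : p ≤ (1ℚ + e) * ν)
    (L≥ : lit 2 * e * ι n ≤ ι L) (L≤ : ι L ≤ lit 2 * e * ι n + 1ℚ) where

    k₀ : ℕ
    k₀ = n ∸ L

    w : ℕ → ℚ
    w k = ι (k ∸ k₀)

    -- The slope 24fν pays for a root: c₂ ≤ 4fν times the second moment of its number of neighbours,
    -- at most 6. While the drift may be positive, 25e² and the slope (fν)² of c₂ complete the
    -- square (5e - fνb)², where b is the number of active vertices before the step.
    c₀ c₂ : ℕ → ℚ
    c₀ k = lit 25 * (e * e) * w k + lit 24 * (f * ν) * ι k
    c₂ k = f * ν + (f * ν) * (f * ν) * w k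

    Φ : ℕ → ℕ → ℚ
    Φ k a = c₀ k + c₂ k * (ι a * ι a)

    private
      0≤fν : 0ℚ ≤ f * ν
      0≤fν = 0≤* 0≤f 0≤ν

      0≤c₂ : ∀ k → 0ℚ ≤ c₂ k
      0≤c₂ k = 0≤+ 0≤fν (0≤* (0≤* 0≤fν 0≤fν) (0≤ι (k ∸ k₀)))

      0≤Φ : ∀ k a → 0ℚ ≤ Φ k a
      0≤Φ k a = 0≤+ (0≤+ (0≤* (0≤* (0≤lit 25) (0≤* 0≤e 0≤e)) (0≤ι (k ∸ k₀))) (0≤* (0≤* (0≤lit 24) 0≤fν) (0≤ι k))) (0≤* (0≤c₂ k) (0≤* (0≤ι a) (0≤ι a)))

      w≤ : ∀ k → k ℕ.≤ n → w k ≤ ι L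
      w≤ k k≤n = ι-mono (ℕₚ.≤-trans (ℕₚ.∸-monoˡ-≤ k₀ k≤n) (ℕₚ.m≤n+o⇒m∸n≤o n k₀ (ℕₚ.≤-trans (ℕₚ.m≤n+m∸n n L) (ℕₚ.≤-reflexive (ℕₚ.+-comm L k₀)))))

      -- Since w is at most L, hence at most 2en + 1, the growth of c₂ is at most 2fν(ef)(nν) +
      -- (fν)², which is at most 3fν.
      c₂≤ : ∀ k → k ℕ.≤ n → c₂ k ≤ lit 4 * (f * ν)
      c₂≤ k k≤n = begin
          f * ν + (f * ν) * (f * ν) * w k
        ≤⟨ +-monoʳ-≤ (f * ν) (*-monoˡ (0≤* 0≤fν 0≤fν) (≤-trans (w≤ k k≤n) L≤)) ⟩
          f * ν + (f * ν) * (f * ν) * (lit 2 * e * ι n + 1ℚ)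
        ≡⟨ lem f ν e (ι n) ⟩
          f * ν + (lit 2 * (f * ν) * (e * f) * (ι n * ν) + (f * ν) * (f * ν))
        ≡⟨ cong₂ (λ x y → f * ν + (lit 2 * (f * ν) * x * y + (f * ν) * (f * ν))) ef nν ⟩
          f * ν + (lit 2 * (f * ν) * 1ℚ * 1ℚ + (f * ν) * (f * ν))
        ≤⟨ +-monoʳ-≤ (f * ν) (+-monoʳ-≤ (lit 2 * (f * ν) * 1ℚ * 1ℚ) (*-monoˡ 0≤fν fν≤1)) ⟩
          f * ν + (lit 2 * (f * ν) * 1ℚ * 1ℚ + (f * ν) * 1ℚ)
        ≡⟨ lem′ (f * ν) ⟩
          lit 4 * (f * ν) ∎
        where
        open ≤-Reasoning
        lem : ∀ f ν e n → f * ν + (f * ν) * (f * ν) * (lit 2 * e * n + 1ℚ) ≡ f * ν + (lit 2 * (f * ν) * (e * f) * (n * ν) + (f * ν) * (f * ν))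
        lem = solve-∀ ℚ-ring
        lem′ : ∀ x → x + (lit 2 * x * 1ℚ * 1ℚ + x * 1ℚ) ≡ lit 4 * x
        lem′ = solve-∀ ℚ-ring

      p≤2ν : p ≤ lit 2 * ν
      p≤2ν = ≤-trans p≤ (*-monoʳ 0≤ν (+-monoʳ-≤ 1ℚ e≤1))

      uν≤1 : ∀ {u} → u ℕ.≤ n → ι u * ν ≤ 1ℚ
      uν≤1 u≤n = subst (_ ≤_) nν (*-monoʳ 0≤ν (ι-mono u≤n))

      up≤ : ∀ {u} → u ℕ.≤ n → ι u * p ≤ e + ι u * ν
      up≤ {u} u≤n = begin
          ι u * p                     ≤⟨ *-monoˡ (0≤ι u) p≤ ⟩
          ι u * ((1ℚ + e) * ν)        ≡⟨ lem (ι u) e ν ⟩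
          e * (ι u * ν) + ι u * ν     ≤⟨ +-monoˡ-≤ (ι u * ν) (*-monoˡ 0≤e (uν≤1 u≤n)) ⟩
          e * 1ℚ + ι u * ν            ≡⟨ cong (_+ ι u * ν) (*-identityʳ e) ⟩
          e + ι u * ν                 ∎
        where
        open ≤-Reasoning
        lem : ∀ u e ν → u * ((1ℚ + e) * ν) ≡ e * (u * ν) + u * ν
        lem = solve-∀ ℚ-ring

      up≤2 : ∀ {u} → u ℕ.≤ n → ι u * p ≤ lit 2
      up≤2 u≤n = ≤-trans (up≤ u≤n) (+-mono-≤ e≤1 (uν≤1 u≤n))

      -- An upper bound for the mean change of the active set: the explored vertex leaves, and on
      -- average up ≤ e + uν vertices join.
      drift : ℕ → ℚ
      drift u = e - 1ℚ + ι u * ν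

      square≤ : ∀ x {y} → 0ℚ ≤ x → x ≤ y → x * x ≤ y * y
      square≤ x 0≤x x≤y = *-mono 0≤x (≤-trans 0≤x x≤y) x≤y x≤y

      drift²≤1 : ∀ {u} → u ℕ.≤ n → drift u * drift u ≤ 1ℚ
      drift²≤1 {u} u≤n = ≤-by _ (0≤* (0≤gap upper) (0≤gap lower)) (lem (drift u))
        where
        lem : ∀ d → 1ℚ ≡ d * d + (1ℚ - d) * (d - (- 1ℚ))
        lem = solve-∀ ℚ-ring
        upper : drift u ≤ 1ℚ
        upper = ≤-by _ (0≤+ (0≤gap e≤1) (0≤gap (uν≤1 u≤n))) (l e (ι u * ν))
          where
          l : ∀ e x → 1ℚ ≡ (e - 1ℚ + x) + ((1ℚ - e) + (1ℚ - x))
          l = solve-∀ ℚ-ring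
        lower : - 1ℚ ≤ drift u
        lower = ≤-by _ (0≤+ 0≤e (0≤* (0≤ι u) 0≤ν)) (l e (ι u * ν))
          where
          l : ∀ e x → e - 1ℚ + x ≡ - 1ℚ + (e + x)
          l = solve-∀ ℚ-ring

      second : ∀ a u → u ℕ.≤ n →
        𝔼 p u (λ bs → ι (a ℕ.+ trues bs) * ι (a ℕ.+ trues bs)) ≤ (1ℚ + ι a) * (1ℚ + ι a) + lit 2 * ((1ℚ + ι a) * drift u) + lit 3
      second a u u≤n = begin
          𝔼 p u (λ bs → ι (a ℕ.+ trues bs) * ι (a ℕ.+ trues bs))
        ≡⟨ trans (𝔼-cong p u (λ bs → cong (λ y → y * y) (ι-+ a (trues bs)))) (𝔼-square p u (ι a)) ⟩
          (ι a + ι u * p) * (ι a + ι u * p) + ι u * (p * (1ℚ - p))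
        ≤⟨ +-mono-≤ (square≤ _ (0≤+ (0≤ι a) 0≤up) (+-monoʳ-≤ (ι a) (up≤ u≤n))) var≤ ⟩
          (ι a + (e + ι u * ν)) * (ι a + (e + ι u * ν)) + lit 2
        ≡⟨ lem (ι a) e (ι u * ν) ⟩
          (b * b + lit 2 * (b * drift u) + lit 2) + drift u * drift u
        ≤⟨ +-monoʳ-≤ (b * b + lit 2 * (b * drift u) + lit 2) (drift²≤1 u≤n) ⟩
          (b * b + lit 2 * (b * drift u) + lit 2) + 1ℚ
        ≡⟨ lem′ (b * b + lit 2 * (b * drift u)) ⟩
          b * b + lit 2 * (b * drift u) + lit 3 ∎
        where
        open ≤-Reasoning
        b : ℚ
        b = 1ℚ + ι a
        0≤up : 0ℚ ≤ ι u * p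
        0≤up = 0≤* (0≤ι u) 0≤p
        var≤ : ι u * (p * (1ℚ - p)) ≤ lit 2
        var≤ = ≤-trans (≤-by _ (0≤* (0≤ι u) (0≤* 0≤p 0≤p)) (l (ι u) p)) (up≤2 u≤n)
          where
          l : ∀ u p → u * p ≡ u * (p * (1ℚ - p)) + u * (p * p)
          l = solve-∀ ℚ-ring
        lem : ∀ a e x → (a + (e + x)) * (a + (e + x)) + lit 2 ≡ ((1ℚ + a) * (1ℚ + a) + lit 2 * ((1ℚ + a) * (e - 1ℚ + x)) + lit 2) + (e - 1ℚ + x) * (e - 1ℚ + x)
        lem = solve-∀ ℚ-ring
        lem′ : ∀ x → x + lit 2 + 1ℚ ≡ x + lit 3
        lem′ = solve-∀ ℚ-ring

      𝔼Φ : ∀ k a u → 𝔼 p u (λ bs → Φ k (a ℕ.+ trues bs)) ≡ c₀ k + c₂ k * 𝔼 p u (λ bs → ι (a ℕ.+ trues bs) * ι (a ℕ.+ trues bs))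
      𝔼Φ k a u = trans (𝔼-+ p u (λ _ → c₀ k) (λ bs → c₂ k * (ι (a ℕ.+ trues bs) * ι (a ℕ.+ trues bs))))
                       (cong₂ _+_ (𝔼-const p u (c₀ k)) (𝔼-* p u (c₂ k) (λ bs → ι (a ℕ.+ trues bs) * ι (a ℕ.+ trues bs))))

      w-zero : ∀ {k} → k ℕ.≤ k₀ → w k ≡ 0ℚ
      w-zero k≤k₀ = trans (cong ι (ℕₚ.m≤n⇒m∸n≡0 k≤k₀)) ι-0

      w-suc : ∀ {k} → k₀ ℕ.≤ k → w (suc k) ≡ 1ℚ + w k
      w-suc {k} k₀≤k = trans (cong ι (ℕₚ.+-∸-assoc 1 k₀≤k)) (ι-suc (k ∸ k₀))

      drift≤e : ∀ {u} → u ℕ.≤ n → drift u ≤ e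
      drift≤e {u} u≤n = ≤-by _ (0≤gap (uν≤1 u≤n)) (l e (ι u * ν))
        where
        l : ∀ e x → e ≡ (e - 1ℚ + x) + (1ℚ - x)
        l = solve-∀ ℚ-ring

      -- Below `k₀` more than L ≥ 2en vertices are gone, which lowers uν by at least 2e.
      drift≤-e : ∀ {u} → u ℕ.< k₀ → drift u ≤ - e
      drift≤-e {u} u<k₀ = begin
          e - 1ℚ + ι u * ν
        ≤⟨ +-monoʳ-≤ (e - 1ℚ) (*-monoʳ 0≤ν u≤) ⟩
          e - 1ℚ + (ι n - lit 2 * e * ι n) * ν
        ≡⟨ l e (ι n) ν ⟩
          e - 1ℚ + (1ℚ - lit 2 * e) * (ι n * ν)
        ≡⟨ trans (cong (λ x → e - 1ℚ + (1ℚ - lit 2 * e) * x) nν) (l′ e) ⟩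
          - e ∎
        where
        open ≤-Reasoning
        l : ∀ e n ν → e - 1ℚ + (n - lit 2 * e * n) * ν ≡ e - 1ℚ + (1ℚ - lit 2 * e) * (n * ν)
        l = solve-∀ ℚ-ring
        l′ : ∀ e → e - 1ℚ + (1ℚ - lit 2 * e) * 1ℚ ≡ - e
        l′ = solve-∀ ℚ-ring
        l″ : ∀ u n L x → n - x ≡ u + ((n - (u + L)) + (L - x))
        l″ = solve-∀ ℚ-ring
        u+L≤n : ι u + ι L ≤ ι n
        u+L≤n = subst (_≤ ι n) (ι-+ u L) (ι-mono (ℕₚ.≤-trans (ℕₚ.+-monoˡ-≤ L (ℕₚ.<⇒≤ u<k₀)) (ℕₚ.≤-reflexive (ℕₚ.m∸n+n≡m L≤n))))
          where
          L≤n : L ℕ.≤ n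
          L≤n = ℕₚ.<⇒≤ (ℕₚ.≰⇒> λ n≤L → ℕₚ.n≮0 (subst (u ℕ.<_) (ℕₚ.m≤n⇒m∸n≡0 n≤L) u<k₀))
        u≤ : ι u ≤ ι n - lit 2 * e * ι n
        u≤ = ≤-by _ (0≤+ (0≤gap u+L≤n) (0≤gap L≥)) (l″ (ι u) (ι n) (ι L) (lit 2 * e * ι n))

      -- The factor ef = 1 is written out so that `l₁` and `l₂` below can be plain polynomial
      -- identities.
      a*p≤ : ∀ a → ι 1 * (ι a * p) ≤ lit 2 * ν * ((1ℚ + ι a) * (e * f) - 1ℚ)
      a*p≤ a = begin
          ι 1 * (ι a * p)
        ≡⟨ trans (cong (_* (ι a * p)) ι-1) (*-identityˡ _) ⟩
          ι a * p
        ≤⟨ *-monoˡ (0≤ι a) p≤2ν ⟩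
          ι a * (lit 2 * ν)
        ≡⟨ l (ι a) ν ⟩
          lit 2 * ν * ((1ℚ + ι a) * 1ℚ - 1ℚ)
        ≡⟨ cong (λ x → lit 2 * ν * ((1ℚ + ι a) * x - 1ℚ)) ef ⟨
          lit 2 * ν * ((1ℚ + ι a) * (e * f) - 1ℚ) ∎
        where
        open ≤-Reasoning
        l : ∀ a ν → a * (lit 2 * ν) ≡ lit 2 * ν * ((1ℚ + a) * 1ℚ - 1ℚ)
        l = solve-∀ ℚ-ring

      step : ∀ a u → suc (a ℕ.+ u) ℕ.≤ n → ι 1 * (ι a * p) + 𝔼 p u (λ bs → Φ (a ℕ.+ u) (a ℕ.+ trues bs)) ≤ Φ (suc (a ℕ.+ u)) (suc a)
      step a u k<n = begin
          ι 1 * (ι a * p) + 𝔼 p u (λ bs → Φ k (a ℕ.+ trues bs))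
        ≡⟨ cong (λ x → ι 1 * (ι a * p) + x) (𝔼Φ k a u) ⟩
          ι 1 * (ι a * p) + (c₀ k + c₂ k * 𝔼 p u (λ bs → ι (a ℕ.+ trues bs) * ι (a ℕ.+ trues bs)))
        ≤⟨ +-mono-≤ (a*p≤ a) (+-monoʳ-≤ (c₀ k) (*-monoˡ (0≤c₂ k) (second a u u≤n))) ⟩
          lit 2 * ν * (b * (e * f) - 1ℚ) + (c₀ k + c₂ k * (b * b + lit 2 * (b * drift u) + lit 3))
        ≤⟨ cases ⟩
          c₀ (suc k) + c₂ (suc k) * (b * b)
        ≡⟨ cong (λ x → c₀ (suc k) + c₂ (suc k) * (x * x)) (ι-suc a) ⟨
          Φ (suc k) (suc a) ∎
        where
        open ≤-Reasoning
        k : ℕ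
        k = a ℕ.+ u
        b : ℚ
        b = 1ℚ + ι a
        0≤b : 0ℚ ≤ b
        0≤b = 0≤+ 0≤1 (0≤ι a)
        u≤k : u ℕ.≤ k
        u≤k = ℕₚ.m≤n+m u a
        u≤n : u ℕ.≤ n
        u≤n = ℕₚ.≤-trans u≤k (ℕₚ.<⇒≤ k<n)
        l₁ : ∀ ν f e b d → lit 24 * (f * ν) + (f * ν) * (b * b) ≡
             (lit 2 * ν * (b * (e * f) - 1ℚ) + (f * ν) * (b * b + lit 2 * (b * d) + lit 3)) + ((f * ν) * lit 2 * (b * (- e - d)) + (lit 21 * (f * ν) + lit 2 * ν))
        l₁ = solve-∀ ℚ-ring
        l₂ : ∀ ν f e b d C → (lit 25 * (e * e) + lit 24 * (f * ν)) + (C + (f * ν) * (f * ν)) * (b * b) ≡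
             (lit 2 * ν * (b * (e * f) - 1ℚ) + C * (b * b + lit 2 * (b * d) + lit 3)) +
             ((C * (lit 2 * (b * (e - d))) + (lit 4 * (f * ν) - C) * (lit 2 * (b * e) + lit 3)) + ((lit 5 * e - (f * ν) * b) * (lit 5 * e - (f * ν) * b) + (lit 12 * (f * ν) + lit 2 * ν)))
        l₂ = solve-∀ ℚ-ring
        r₁ : ∀ X Y C Q → X + (Y + C * Q) ≡ Y + (X + C * Q)
        r₁ = solve-∀ ℚ-ring
        r₂ : ∀ e x k B → (lit 25 * (e * e) * 0ℚ + lit 24 * x * k) + (lit 24 * x + (x + x * x * 0ℚ) * B) ≡ (lit 25 * (e * e) * 0ℚ + lit 24 * x * (1ℚ + k)) + (x + x * x * 0ℚ) * B
        r₂ = solve-∀ ℚ-ring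
        r₃ : ∀ e x k w B → (lit 25 * (e * e) * w + lit 24 * x * k) + ((lit 25 * (e * e) + lit 24 * x) + ((x + x * x * w) + x * x) * B) ≡ (lit 25 * (e * e) * (1ℚ + w) + lit 24 * x * (1ℚ + k)) + (x + x * x * (1ℚ + w)) * B
        r₃ = solve-∀ ℚ-ring
        r₄ : ∀ x → x + x * x * 0ℚ ≡ x
        r₄ = solve-∀ ℚ-ring
        cases : lit 2 * ν * (b * (e * f) - 1ℚ) + (c₀ k + c₂ k * (b * b + lit 2 * (b * drift u) + lit 3)) ≤ c₀ (suc k) + c₂ (suc k) * (b * b)
        cases with ℕₚ.≤-<-connex (suc k) k₀
        -- Here the drift is at most -e, and the loss 2(fν)be = 2νb of the quadratic term pays for
        -- the expected cost of the step.
        ... | inj₁ k<k₀ = begin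
            lit 2 * ν * (b * (e * f) - 1ℚ) + (c₀ k + c₂ k * (b * b + lit 2 * (b * drift u) + lit 3))
          ≡⟨ r₁ (lit 2 * ν * (b * (e * f) - 1ℚ)) (c₀ k) (c₂ k) _ ⟩
            c₀ k + (lit 2 * ν * (b * (e * f) - 1ℚ) + c₂ k * (b * b + lit 2 * (b * drift u) + lit 3))
          ≡⟨ cong (λ C → c₀ k + (lit 2 * ν * (b * (e * f) - 1ℚ) + C * (b * b + lit 2 * (b * drift u) + lit 3))) c₂k ⟩
            c₀ k + (lit 2 * ν * (b * (e * f) - 1ℚ) + (f * ν) * (b * b + lit 2 * (b * drift u) + lit 3))
          ≤⟨ +-monoʳ-≤ (c₀ k) (≤-by _ (0≤+ (0≤* (0≤* 0≤fν (0≤lit 2)) (0≤* 0≤b (0≤gap (drift≤-e (ℕₚ.≤-<-trans u≤k k<k₀))))) (0≤+ (0≤* (0≤lit 21) 0≤fν) (0≤* (0≤lit 2) 0≤ν))) (l₁ ν f e b (drift u))) ⟩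
            c₀ k + (lit 24 * (f * ν) + (f * ν) * (b * b))
          ≡⟨ cong₂ (λ W C → (lit 25 * (e * e) * W + lit 24 * (f * ν) * ι k) + (lit 24 * (f * ν) + C * (b * b))) wk (sym (r₄ (f * ν))) ⟩
            (lit 25 * (e * e) * 0ℚ + lit 24 * (f * ν) * ι k) + (lit 24 * (f * ν) + (f * ν + (f * ν) * (f * ν) * 0ℚ) * (b * b))
          ≡⟨ r₂ e (f * ν) (ι k) (b * b) ⟩
            (lit 25 * (e * e) * 0ℚ + lit 24 * (f * ν) * (1ℚ + ι k)) + (f * ν + (f * ν) * (f * ν) * 0ℚ) * (b * b)
          ≡⟨ cong₂ (λ W K → (lit 25 * (e * e) * W + lit 24 * (f * ν) * K) + (f * ν + (f * ν) * (f * ν) * W) * (b * b)) (w-zero k<k₀) (ι-suc k) ⟨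
            c₀ (suc k) + c₂ (suc k) * (b * b) ∎
          where
          wk : w k ≡ 0ℚ
          wk = w-zero (ℕₚ.<⇒≤ k<k₀)
          c₂k : c₂ k ≡ f * ν
          c₂k = trans (cong (λ W → f * ν + (f * ν) * (f * ν) * W) wk) (r₄ (f * ν))
        -- Here the drift is at most e. Cost and growth amount to at most 2νb + 8νb = 10νb up to
        -- constants, and 10νb = 2(5e)(fνb) is at most 25e² + (fνb)².
        ... | inj₂ k₀≤k = begin
            lit 2 * ν * (b * (e * f) - 1ℚ) + (c₀ k + c₂ k * (b * b + lit 2 * (b * drift u) + lit 3))
          ≡⟨ r₁ (lit 2 * ν * (b * (e * f) - 1ℚ)) (c₀ k) (c₂ k) _ ⟩
            c₀ k + (lit 2 * ν * (b * (e * f) - 1ℚ) + c₂ k * (b * b + lit 2 * (b * drift u) + lit 3))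
          ≤⟨ +-monoʳ-≤ (c₀ k) (≤-by _ (0≤+ (0≤+ (0≤* (0≤c₂ k) (0≤* (0≤lit 2) (0≤* 0≤b (0≤gap (drift≤e u≤n)))))
                                                 (0≤* (0≤gap (c₂≤ k (ℕₚ.<⇒≤ k<n))) (0≤+ (0≤* (0≤lit 2) (0≤* 0≤b 0≤e)) (0≤lit 3))))
                                           (0≤+ (0≤sq (lit 5 * e - (f * ν) * b)) (0≤+ (0≤* (0≤lit 12) 0≤fν) (0≤* (0≤lit 2) 0≤ν))))
                                      (l₂ ν f e b (drift u) (c₂ k))) ⟩
            c₀ k + ((lit 25 * (e * e) + lit 24 * (f * ν)) + (c₂ k + (f * ν) * (f * ν)) * (b * b))
          ≡⟨ r₃ e (f * ν) (ι k) (w k) (b * b) ⟩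
            (lit 25 * (e * e) * (1ℚ + w k) + lit 24 * (f * ν) * (1ℚ + ι k)) + (f * ν + (f * ν) * (f * ν) * (1ℚ + w k)) * (b * b)
          ≡⟨ cong₂ (λ W K → (lit 25 * (e * e) * W + lit 24 * (f * ν) * K) + (f * ν + (f * ν) * (f * ν) * W) * (b * b)) (w-suc (ℕₚ.≤-pred k₀≤k)) (ι-suc k) ⟨
            c₀ (suc k) + c₂ (suc k) * (b * b) ∎

      root : ∀ u → suc u ℕ.≤ n → ι 0 + 𝔼 p u (λ bs → Φ u (trues bs)) ≤ Φ (suc u) 0
      root u u<n = begin
          ι 0 + 𝔼 p u (λ bs → Φ u (trues bs))
        ≡⟨ trans (cong (_+ 𝔼 p u (λ bs → Φ u (trues bs))) ι-0) (trans (+-identityˡ _) (𝔼Φ u 0 u)) ⟩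
          c₀ u + c₂ u * 𝔼 p u (λ bs → ι (trues bs) * ι (trues bs))
        ≤⟨ +-monoʳ-≤ (c₀ u) (*-mono (0≤c₂ u) (0≤lit 6) (c₂≤ u u≤n) 𝔼≤) ⟩
          c₀ u + lit 4 * (f * ν) * lit 6
        ≤⟨ ≤-by _ (0≤* (0≤* (0≤lit 25) (0≤* 0≤e 0≤e)) (0≤gap w≤w)) (l e (f * ν) (ι u) (w u) (w (suc u)) (c₂ (suc u))) ⟩
          (lit 25 * (e * e) * w (suc u) + lit 24 * (f * ν) * (1ℚ + ι u)) + c₂ (suc u) * (0ℚ * 0ℚ)
        ≡⟨ cong₂ (λ K z → (lit 25 * (e * e) * w (suc u) + lit 24 * (f * ν) * K) + c₂ (suc u) * (z * z)) (ι-suc u) ι-0 ⟨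
          Φ (suc u) 0 ∎
        where
        open ≤-Reasoning
        u≤n : u ℕ.≤ n
        u≤n = ℕₚ.<⇒≤ u<n
        w≤w : w u ≤ w (suc u)
        w≤w = ι-mono (ℕₚ.∸-monoˡ-≤ k₀ (ℕₚ.n≤1+n u))
        l : ∀ e x k w w′ C → (lit 25 * (e * e) * w′ + lit 24 * x * (1ℚ + k)) + C * (0ℚ * 0ℚ) ≡ ((lit 25 * (e * e) * w + lit 24 * x * k) + lit 4 * x * lit 6) + lit 25 * (e * e) * (w′ - w)
        l = solve-∀ ℚ-ring
        𝔼≤ : 𝔼 p u (λ bs → ι (trues bs) * ι (trues bs)) ≤ lit 6
        𝔼≤ = begin
            𝔼 p u (λ bs → ι (trues bs) * ι (trues bs))
          ≡⟨ trans (𝔼-cong p u (λ bs → cong (λ y → y * y) (sym (+-identityˡ (ι (trues bs)))))) (𝔼-square p u 0ℚ) ⟩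
            (0ℚ + ι u * p) * (0ℚ + ι u * p) + ι u * (p * (1ℚ - p))
          ≤⟨ ≤-by _ (0≤+ (0≤* (0≤gap (up≤2 u≤n)) (0≤+ (0≤lit 3) (0≤* (0≤ι u) 0≤p))) (0≤* (0≤ι u) (0≤* 0≤p 0≤p))) (l′ (ι u) p) ⟩
            lit 6 ∎
          where
          l′ : ∀ u p → lit 6 ≡ ((0ℚ + u * p) * (0ℚ + u * p) + u * (p * (1ℚ - p))) + ((lit 2 - u * p) * (lit 3 + u * p) + u * (p * p))
          l′ = solve-∀ ℚ-ring

    open Search 1 (λ _ → 0)

    -- With no active vertex the potential is c₀(n): about 2en steps of slope 25e² give 50e³n, and n
    -- steps of slope 24fν give 24f.
    𝔼-distance-≤ : ∀ ω → 𝔼ₖ p (pairs n) (λ ω → ι (distance ω)) ω ≤ lit 50 * (e * e * e) * ι n + lit 25 * (e * e) + lit 24 * f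
    𝔼-distance-≤ ω = begin
        𝔼ₖ p (pairs n) (λ ω → ι (distance ω)) ω
      ≤⟨ 𝔼ₖ-mono p 0≤p p≤1 (pairs n) ω (λ ω′ _ → ι-mono (distance-≤-run ω′)) ⟩
        𝔼ₖ p (pairs n) (λ ω → ι (run n ω [] (allFin n))) ω
      ≡⟨ cong (λ L → 𝔼ₖ p L (λ ω → ι (run n ω [] (allFin n))) ω) (pairs-pairsOf n) ⟩
        𝔼ₖ p (pairsOf (allFin n)) (λ ω → ι (run n ω [] (allFin n))) ω
      ≤⟨ run-≤ p 0≤p p≤1 n Φ 0≤Φ step root n ω [] (allFin n) (allFin⁺ n) (length-tabulate (λ i → i)) ℕₚ.≤-refl ⟩
        Φ n 0
      ≡⟨ cong (λ z → c₀ n + c₂ n * (z * z)) ι-0 ⟩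
        (lit 25 * (e * e) * w n + lit 24 * (f * ν) * ι n) + c₂ n * (0ℚ * 0ℚ)
      ≤⟨ +-monoˡ-≤ (c₂ n * (0ℚ * 0ℚ)) (+-monoˡ-≤ (lit 24 * (f * ν) * ι n) (*-monoˡ (0≤* (0≤lit 25) (0≤* 0≤e 0≤e)) (≤-trans (w≤ n ℕₚ.≤-refl) L≤))) ⟩
        (lit 25 * (e * e) * (lit 2 * e * ι n + 1ℚ) + lit 24 * (f * ν) * ι n) + c₂ n * (0ℚ * 0ℚ)
      ≡⟨ l e f ν (ι n) (c₂ n) ⟩
        lit 50 * (e * e * e) * ι n + lit 25 * (e * e) + lit 24 * f * (ι n * ν)
      ≡⟨ cong (λ x → lit 50 * (e * e * e) * ι n + lit 25 * (e * e) + x) (trans (cong (lit 24 * f *_) nν) (*-identityʳ _)) ⟩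
        lit 50 * (e * e * e) * ι n + lit 25 * (e * e) + lit 24 * f ∎
      where
      open ≤-Reasoning
      l : ∀ e f ν n C → (lit 25 * (e * e) * (lit 2 * e * n + 1ℚ) + lit 24 * (f * ν) * n) + C * (0ℚ * 0ℚ) ≡ lit 50 * (e * e * e) * n + lit 25 * (e * e) + lit 24 * f * (n * ν)
      l = solve-∀ ℚ-ring

-- Closed walks around the forest found by the exploration.

module Tours where

  open ListSums
  open VertexPairs
  open Exploration
  open Distance
  open GreedyColouring using (monoIn; monoIn-star; ∈-keep⁻; ≈ᵇ-comm)
  open import Data.Bool using (Bool; true; false; _∧_)
  open import Data.Nat
  open import Data.Nat.Properties
  open import Data.Fin using (Fin)
  open import Data.List using (List; []; _∷_; _++_; map; length; allFin)
  open import Data.List.Properties using (length-++; length-tabulate; ++-assoc)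
  open import Data.List.Membership.Propositional using (_∈_)
  open import Data.List.Membership.Propositional.Properties using (∈-∃++; ∈-++⁺ˡ; ∈-++⁺ʳ; ∈-++⁻)
  open import Data.List.Relation.Unary.Any using (here; there)
  open import Data.List.Relation.Unary.AllPairs using ([]; _∷_)
  open import Data.List.Relation.Unary.Unique.Propositional using (Unique)
  open import Data.List.Relation.Unary.Unique.Propositional.Properties using (allFin⁺)
  open import Data.List.Relation.Binary.Permutation.Propositional using (_↭_; refl; trans; ↭-sym; ↭-reflexive)
  import Data.List.Relation.Binary.Permutation.Propositional.Properties as Perm
  open import Data.Product using (∃; _×_; _,_; proj₂)
  open import Data.Sum using (inj₁; inj₂)
  open import Relation.Nullary using (yes; no)
  open import Relation.Binary.PropositionalEquality hiding (trans)
  import Relation.Binary.PropositionalEquality as ≡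
  open import Data.Nat.Tactic.RingSolver using (solve-∀)

  -- Tour ω R D W: the forest with R roots grown from the edges of ω has vertex list D, and W concatenates
  -- closed walks around its trees that run through every tree edge once in each direction.
  data Tour {n} (ω : Graph n) : ℕ → List (Fin n) → List (Fin n) → Set where
    empty : Tour ω 0 [] []
    root  : ∀ {R D W} x → Tour ω R D W → Tour ω (suc R) (x ∷ D) (x ∷ W)
    leaf  : ∀ {R D} W₁ v W₂ x → Tour ω R D (W₁ ++ v ∷ W₂) → ω (key v x) ≡ true → Tour ω R (x ∷ D) (W₁ ++ v ∷ x ∷ v ∷ W₂)

  monoSteps : ∀ {n} → (Fin n → Bool) → List (Fin n) → ℕ
  monoSteps σ []          = 0
  monoSteps σ (x ∷ [])    = 0
  monoSteps σ (x ∷ y ∷ W) = bit (σ x ≈ᵇ σ y) + monoSteps σ (y ∷ W)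

  monoSteps-∷ : ∀ {n} (σ : Fin n → Bool) x W → monoSteps σ (x ∷ W) ≤ 1 + monoSteps σ W
  monoSteps-∷ σ x []      = z≤n
  monoSteps-∷ σ x (y ∷ W) = +-monoˡ-≤ (monoSteps σ (y ∷ W)) (bit≤1 (σ x ≈ᵇ σ y))

  -- The detour v, x, v walks the new edge once in each direction, and both steps have the same
  -- status.
  monoSteps-insert : ∀ {n} (σ : Fin n → Bool) W₁ v W₂ x →
    monoSteps σ (W₁ ++ v ∷ x ∷ v ∷ W₂) ≡ 2 * bit (σ v ≈ᵇ σ x) + monoSteps σ (W₁ ++ v ∷ W₂)
  monoSteps-insert σ []            v W₂ x rewrite ≈ᵇ-comm (σ x) (σ v) = lem (bit (σ v ≈ᵇ σ x)) _
    where
    lem : ∀ a b → a + (a + b) ≡ 2 * a + b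
    lem = solve-∀
  monoSteps-insert σ (u ∷ [])      v W₂ x rewrite monoSteps-insert σ [] v W₂ x = lem (bit (σ u ≈ᵇ σ v)) (bit (σ v ≈ᵇ σ x)) _
    where
    lem : ∀ a b c → a + (2 * b + c) ≡ 2 * b + (a + c)
    lem = solve-∀
  monoSteps-insert σ (u ∷ u′ ∷ W₁) v W₂ x rewrite monoSteps-insert σ (u′ ∷ W₁) v W₂ x = lem (bit (σ u ≈ᵇ σ u′)) (bit (σ v ≈ᵇ σ x)) _
    where
    lem : ∀ a b c → a + (2 * b + c) ≡ 2 * b + (a + c)
    lem = solve-∀

  module _ {n : ℕ} {ω : Graph n} where

    tour-⊇ : ∀ {R D W} → Tour ω R D W → ∀ {x} → x ∈ D → x ∈ W
    tour-⊇ (root x t)            (here refl) = here refl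
    tour-⊇ (root x t)            (there x∈)  = there (tour-⊇ t x∈)
    tour-⊇ (leaf W₁ v W₂ x t vx) (here refl) = ∈-++⁺ʳ W₁ (there (here refl))
    tour-⊇ (leaf W₁ v W₂ x t vx) (there y∈)  with ∈-++⁻ W₁ (tour-⊇ t y∈)
    ... | inj₁ h          = ∈-++⁺ˡ h
    ... | inj₂ (here eq)  = ∈-++⁺ʳ W₁ (here eq)
    ... | inj₂ (there h)  = ∈-++⁺ʳ W₁ (there (there (there h)))

    tour-⊆ : ∀ {R D W} → Tour ω R D W → ∀ {x} → x ∈ W → x ∈ D
    tour-⊆ (root x t)            (here refl) = here refl
    tour-⊆ (root x t)            (there x∈)  = there (tour-⊆ t x∈)
    tour-⊆ (leaf W₁ v W₂ x t vx) y∈ with ∈-++⁻ W₁ y∈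
    ... | inj₁ h                     = there (tour-⊆ t (∈-++⁺ˡ h))
    ... | inj₂ (here refl)           = there (tour-⊆ t (∈-++⁺ʳ W₁ (here refl)))
    ... | inj₂ (there (here refl))   = here refl
    ... | inj₂ (there (there h))     = there (tour-⊆ t (∈-++⁺ʳ W₁ h))

    tour-length : ∀ {R D W} → Tour ω R D W → length W ≤ 2 * length D
    tour-length empty = z≤n
    tour-length (root {D = D} x t) = ≤-trans (s≤s (tour-length t)) (≤-trans (n≤1+n _) (≤-reflexive (lem (length D))))
      where
      lem : ∀ d → suc (suc (2 * d)) ≡ 2 * suc d
      lem = solve-∀
    tour-length (leaf {D = D} W₁ v W₂ x t vx) = begin
        length (W₁ ++ v ∷ x ∷ v ∷ W₂)     ≡⟨ length-++ W₁ ⟩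
        length W₁ + (3 + length W₂)       ≡⟨ lem (length W₁) (length W₂) ⟩
        2 + (length W₁ + (1 + length W₂)) ≡⟨ cong (2 +_) (length-++ W₁) ⟨
        2 + length (W₁ ++ v ∷ W₂)         ≤⟨ +-monoʳ-≤ 2 (tour-length t) ⟩
        2 + 2 * length D                  ≡⟨ lem′ (length D) ⟩
        2 * suc (length D)                ∎
      where
      open ≤-Reasoning
      lem : ∀ a b → a + (3 + b) ≡ 2 + (a + (1 + b))
      lem = solve-∀
      lem′ : ∀ d → 2 + 2 * d ≡ 2 * suc d
      lem′ = solve-∀

    -- Tree edges are walked twice and are edges of ω inside D. The passages between consecutive
    -- trees need not be edges; they cost at most one step per root.
    tour-monoSteps : ∀ (σ : Fin n → Bool) {R D W} → Tour ω R D W → monoSteps σ W ≤ R + 2 * monoIn σ ω (pairsOf D)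
    tour-monoSteps σ empty = z≤n
    tour-monoSteps σ (root {R} {D} {W} x t) = ≤-trans (monoSteps-∷ σ x W) (s≤s (≤-trans (tour-monoSteps σ t)
      (+-monoʳ-≤ R (*-monoʳ-≤ 2 (≤-trans (m≤n+m _ (monoIn σ ω (map (key x) D))) (≤-reflexive (sym (sumOver-++ _ (map (key x) D) (pairsOf D)))))))))
    tour-monoSteps σ (leaf {R} {D} W₁ v W₂ x t vx) = begin
        monoSteps σ (W₁ ++ v ∷ x ∷ v ∷ W₂)
      ≡⟨ monoSteps-insert σ W₁ v W₂ x ⟩
        2 * b + monoSteps σ (W₁ ++ v ∷ W₂)
      ≤⟨ +-monoʳ-≤ (2 * b) (tour-monoSteps σ t) ⟩
        2 * b + (R + 2 * m)
      ≡⟨ lem b R m ⟩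
        R + 2 * (b + m)
      ≤⟨ +-monoʳ-≤ R (*-monoʳ-≤ 2 (+-monoˡ-≤ m b≤)) ⟩
        R + 2 * (monoIn σ ω (map (key x) D) + m)
      ≡⟨ cong (λ y → R + 2 * y) (sumOver-++ _ (map (key x) D) (pairsOf D)) ⟨
        R + 2 * monoIn σ ω (pairsOf (x ∷ D)) ∎
      where
      open ≤-Reasoning
      b m : ℕ
      b = bit (σ v ≈ᵇ σ x)
      m = monoIn σ ω (pairsOf D)
      lem : ∀ b R m → 2 * b + (R + 2 * m) ≡ R + 2 * (b + m)
      lem = solve-∀
      v∈D : v ∈ D
      v∈D = tour-⊆ t (∈-++⁺ʳ W₁ (here refl))
      lem′ : ∀ y → bit y ≡ bit (y ∧ true)
      lem′ true  = refl
      lem′ false = refl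
      b≤ : b ≤ monoIn σ ω (map (key x) D)
      b≤ = begin
          bit (σ v ≈ᵇ σ x)                                ≡⟨ ≡.trans (cong bit (≈ᵇ-comm (σ v) (σ x))) (lem′ _) ⟩
          bit ((σ x ≈ᵇ σ v) ∧ true)                       ≡⟨ cong (λ y → bit ((σ x ≈ᵇ σ v) ∧ y)) (≡.trans (cong ω (key-comm x v)) vx) ⟨
          bit ((σ x ≈ᵇ σ v) ∧ ω (key x v))                ≤⟨ sumOver-∈ (λ w → bit ((σ x ≈ᵇ σ w) ∧ ω (key x w))) v∈D ⟩
          count (λ w → (σ x ≈ᵇ σ w) ∧ ω (key x w)) D      ≡⟨ monoIn-star σ ω x D ⟨
          monoIn σ ω (map (key x) D)                      ∎

    -- D lists the latest vertex first, so undoing the last insertions leaves a forest with its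
    -- walks.
    truncate : ∀ {R D W} → Tour ω R D W → Unique D → ∀ Y → Y ≤ length D →
               ∃ λ R′ → ∃ λ D′ → ∃ λ W′ → Tour ω R′ D′ W′ × R′ ≤ R × length D′ ≡ Y × Unique D′
    truncate empty D! zero Y≤ = 0 , [] , [] , empty , z≤n , refl , []
    truncate t@(root {R} {D} x t′) D! Y Y≤ with Y ≟ suc (length D)
    ... | yes refl = _ , _ , _ , t , ≤-refl , refl , D!
    truncate (root x t′) (_ ∷ D!) Y Y≤ | no Y≢ with truncate t′ D! Y (≤-pred (≤∧≢⇒< Y≤ Y≢))
    ... | R′ , D′ , W′ , t″ , R≤ , len , D′! = R′ , D′ , W′ , t″ , m≤n⇒m≤1+n R≤ , len , D′!
    truncate t@(leaf {R} {D} W₁ v W₂ x t′ vx) D! Y Y≤ with Y ≟ suc (length D)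
    ... | yes refl = _ , _ , _ , t , ≤-refl , refl , D!
    truncate (leaf W₁ v W₂ x t′ vx) (_ ∷ D!) Y Y≤ | no Y≢ = truncate t′ D! Y (≤-pred (≤∧≢⇒< Y≤ Y≢))

    add-leaves : ∀ {R D W v} N → v ∈ D → (∀ {x} → x ∈ N → ω (key v x) ≡ true) → Tour ω R D W →
                 ∃ λ D′ → ∃ λ W′ → Tour ω R D′ W′ × D′ ↭ N ++ D
    add-leaves []      v∈ adj t = _ , _ , t , refl
    add-leaves {R} {D} {W} {v} (x ∷ N) v∈ adj t with ∈-∃++ (tour-⊇ t v∈)
    ... | W₁ , W₂ , refl with add-leaves N (there v∈) (λ y∈ → adj (there y∈)) (leaf W₁ v W₂ x t (adj (here refl)))
    ...   | D′ , W′ , t′ , p = D′ , W′ , t′ , trans p (Perm.shift x N D)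

  module _ {n : ℕ} (ω : Graph n) (u₀ Y : ℕ) (Y+u₀≤n : Y + u₀ ≤ n) where

    open Search 0 (λ u → bit (u₀ ≤ᵇ u))

    Grown : ℕ → Set
    Grown R = ∃ λ R′ → ∃ λ D → ∃ λ W → Tour ω R′ D W × R′ ≤ R × length D ≡ Y × Unique D

    private
      -- With at most `u₀` vertices outside, the forest has at least n - u₀ ≥ Y vertices; the
      -- surplus is undone.
      stop : ∀ {R D W U} → Tour ω R D W → D ++ U ↭ allFin n → length U ≤ u₀ → Grown R
      stop {R} {D} {W} {U} t p U≤ with truncate t (Unique-++ˡ (Unique-↭ (↭-sym p) (allFin⁺ n))) Y Y≤
        where
        Unique-++ˡ : ∀ {xs ys : List (Fin n)} → Unique (xs ++ ys) → Unique xs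
        Unique-++ˡ {[]}     _          = []
        Unique-++ˡ {x ∷ xs} (x∉ ∷ xs!) = Allₚ.++⁻ˡ xs x∉ ∷ Unique-++ˡ xs!
          where import Data.List.Relation.Unary.All.Properties as Allₚ
        Y≤ : Y ≤ length D
        Y≤ = +-cancelʳ-≤ u₀ Y (length D) (≤-trans Y+u₀≤n (≤-trans
               (≤-reflexive (≡.trans (sym (length-tabulate (λ i → i))) (≡.trans (sym (Perm.↭-length p)) (length-++ D))))
               (+-monoʳ-≤ (length D) U≤)))
      ... | R′ , rest = R′ , rest

      Goal : ℕ → Set
      Goal k = ∀ A U {R D W} → Tour ω R D W → D ++ U ↭ allFin n → (∀ {x} → x ∈ A → x ∈ D) → length (A ++ U) ≡ k → Grown (R + run k ω A U)

      explore : ∀ k → Goal k → ∀ v A U {R D W} → Tour ω R D W → D ++ U ↭ allFin n → v ∈ D → (∀ {x} → x ∈ A → x ∈ D) →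
                length (A ++ U) ≡ k → Grown (R + run k ω (A ++ nbrs ω v U) (rest ω v U))
      explore k IH v A U {D = D} t p v∈ A⊆ len with add-leaves (nbrs ω v U) v∈ (λ x∈ → proj₂ (∈-keep⁻ _ U x∈)) t
      ... | D′ , W′ , t′ , p′ = IH (A ++ nbrs ω v U) (rest ω v U) t′ perm sub
              (≡.trans (Perm.↭-length (trans (↭-reflexive (++-assoc A (nbrs ω v U) (rest ω v U))) (Perm.++⁺ˡ A (keep-↭ (λ x → ω (key v x)) U)))) len)
        where
        perm : D′ ++ rest ω v U ↭ allFin n
        perm = trans (Perm.++⁺ʳ (rest ω v U) (trans p′ (Perm.++-comm (nbrs ω v U) D)))
               (trans (↭-reflexive (++-assoc D (nbrs ω v U) (rest ω v U))) (trans (Perm.++⁺ˡ D (keep-↭ (λ x → ω (key v x)) U)) p))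
        sub : ∀ {x} → x ∈ A ++ nbrs ω v U → x ∈ D′
        sub x∈ with ∈-++⁻ A x∈
        ... | inj₁ h = Perm.∈-resp-↭ (↭-sym p′) (∈-++⁺ʳ (nbrs ω v U) (A⊆ h))
        ... | inj₂ h = Perm.∈-resp-↭ (↭-sym p′) (∈-++⁺ˡ h)

      grow : ∀ k → Goal k
      grow zero    []      []      {R} t p A⊆ len = subst Grown (sym (+-identityʳ R)) (stop t p z≤n)
      grow (suc k) []      (x ∷ U) {R} {D} t p A⊆ len with u₀ ≤ᵇ length U in c
      ... | true  = subst Grown (sym (+-suc R _)) (explore k (grow k) x [] U (root x t) (trans (↭-sym (Perm.shift x D U)) p) (here refl) (λ ()) (suc-injective len))
      -- A root is charged only if at least `u₀` vertices remain after it. Otherwise growth stops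
      -- here, with at most `u₀` vertices outside, x included.
      ... | false with stop t p (<ᵇ⇒<′ c)
        where
        <ᵇ⇒<′ : (u₀ ≤ᵇ length U) ≡ false → suc (length U) ≤ u₀
        <ᵇ⇒<′ c = ≰⇒> λ u₀≤ → contra (≡.trans (sym (≤⇒≤ᵇ′ u₀≤)) c)
          where
          open import Data.Empty using (⊥)
          contra : true ≡ false → ⊥
          contra ()
          ≤⇒≤ᵇ′ : ∀ {a b} → a ≤ b → (a ≤ᵇ b) ≡ true
          ≤⇒≤ᵇ′ {zero}  _ = refl
          ≤⇒≤ᵇ′ {suc a} h = <⇒<ᵇ≡true h
      ...   | R′ , D′ , W′ , t′ , R≤ , rest′ = R′ , D′ , W′ , t′ , ≤-trans R≤ (m≤m+n R _) , rest′
      grow (suc k) (v ∷ A) U t p A⊆ len = explore k (grow k) v A U t p (A⊆ (here refl)) (λ x∈ → A⊆ (there x∈)) (suc-injective len)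

    tour-exists : Grown (run n ω [] (allFin n))
    tour-exists = grow n [] (allFin n) empty refl (λ ()) (length-tabulate (λ i → i))

-- Encoding a colouring by few bits along the walks.

module Blocks where

  open import Defs using (pairs)
  open ListSums
  open VertexPairs
  open Exploration using (keep)
  open Distance
  open GreedyColouring using (≈ᵇ-comm; ∈-keep⁻)
  open Tours using (monoSteps)
  open import Data.Bool using (Bool; true; false; _∧_; not; if_then_else_)
  open import Data.Nat
  open import Data.Nat.Properties
  open import Data.Fin using (Fin)
  import Data.Fin.Properties as Finₚ
  open import Data.List using (List; []; _∷_; _++_; map; length; take; drop; concatMap)
  open import Data.List.Properties using (length-take; length-drop; length-++; length-map; take++drop≡id)
  open import Data.List.Membership.Propositional using (_∈_; _∉_)
  open import Data.List.Membership.Propositional.Properties using (∈-++⁺ˡ; ∈-++⁺ʳ; ∈-++⁻; ∈-map⁺; ∈-allFin)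
  open import Data.List.Relation.Unary.Any using (here; there)
  open import Data.List.Relation.Unary.All using (All; []; _∷_)
  import Data.List.Relation.Unary.All as All
  open import Data.List.Relation.Unary.AllPairs using ([]; _∷_)
  open import Data.List.Relation.Unary.Unique.Propositional using (Unique)
  open import Data.Maybe using (Maybe; just; nothing; is-just)
  open import Data.Maybe.Properties using (just-injective)
  open import Data.Product using (∃; _×_; _,_; proj₁; proj₂)
  open import Data.Sum using (inj₁; inj₂)
  open import Data.Empty using (⊥-elim)
  open import Relation.Nullary using (yes; no)
  open import Relation.Binary.PropositionalEquality
  open import Data.Nat.Tactic.RingSolver using (solve-∀)

  blocks : ∀ {A : Set} → ℕ → ℕ → List A → List (List A)
  blocks K zero    W = []
  blocks K (suc r) W = take K W ∷ blocks K r (drop K W)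

  -- A code gives the colour of the first vertex of each block along which the colours alternate, and
  -- nothing for the other blocks.
  Code : Set
  Code = List (Maybe Bool)

  allCodes : ℕ → List Code
  allCodes zero    = [] ∷ []
  allCodes (suc r) = map (just true ∷_) (allCodes r) ++ map (just false ∷_) (allCodes r) ++ map (nothing ∷_) (allCodes r)

  -- There are 3^r codes; counting them as 4^r keeps all bounds in powers of 2.
  length-allCodes : ∀ r → length (allCodes r) ≤ 2 ^ (2 * r)
  length-allCodes zero    = s≤s z≤n
  length-allCodes (suc r) = begin
      length (map (just true ∷_) (allCodes r) ++ map (just false ∷_) (allCodes r) ++ map (nothing ∷_) (allCodes r))
    ≡⟨ trans (length-++ (map (just true ∷_) (allCodes r))) (cong₂ _+_ (length-map _ (allCodes r)) (trans (length-++ (map (just false ∷_) (allCodes r))) (cong₂ _+_ (length-map _ (allCodes r)) (length-map _ (allCodes r))))) ⟩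
      l + (l + l)
    ≤⟨ m≤m+n (l + (l + l)) l ⟩
      l + (l + l) + l
    ≡⟨ lem l ⟩
      2 * (2 * l)
    ≤⟨ *-monoʳ-≤ 2 (*-monoʳ-≤ 2 (length-allCodes r)) ⟩
      2 * (2 * 2 ^ (2 * r))
    ≡⟨ cong (2 ^_) (lem′ r) ⟩
      2 ^ (2 * suc r) ∎
    where
    open ≤-Reasoning
    l : ℕ
    l = length (allCodes r)
    lem : ∀ l → l + (l + l) + l ≡ 2 * (2 * l)
    lem = solve-∀
    lem′ : ∀ r → suc (suc (2 * r)) ≡ 2 * suc r
    lem′ = solve-∀

  module _ {n : ℕ} where

    colourIn : Bool → List (Fin n) → Fin n → Maybe Bool
    colourIn c []      v = nothing
    colourIn c (x ∷ B) v with v Finₚ.≟ x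
    ... | yes _ = just c
    ... | no  _ = colourIn (not c) B v

    -- Decoding has no access to the colouring, as the union bound over codes requires. A vertex
    -- visited several times takes its colour from the first coded block that contains it.
    paint : List (List (Fin n)) → Code → Fin n → Maybe Bool
    paint (B ∷ Bs) (just c ∷ cs)  v with colourIn c B v
    ... | just b  = just b
    ... | nothing = paint Bs cs v
    paint (B ∷ Bs) (nothing ∷ cs) v = paint Bs cs v
    paint _        _              v = nothing

    blockCode : (Fin n → Bool) → List (Fin n) → Maybe Bool
    blockCode σ []      = just true
    blockCode σ (x ∷ B) = if monoSteps σ (x ∷ B) ≡ᵇ 0 then just (σ x) else nothing

    codeOf : (Fin n → Bool) → List (List (Fin n)) → Code
    codeOf σ = map (blockCode σ)

    colourIn-sound : ∀ σ x B v → monoSteps σ (x ∷ B) ≡ 0 → ∀ {b} → colourIn (σ x) (x ∷ B) v ≡ just b → σ v ≡ b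
    colourIn-sound σ x B       v alt eq with v Finₚ.≟ x
    colourIn-sound σ x B       v alt eq | yes refl = just-injective eq
    colourIn-sound σ x (y ∷ B) v alt eq | no _ = colourIn-sound σ y B v (m+n≡0⇒n≡0 (bit (σ x ≈ᵇ σ y)) alt)
        (trans (cong (λ c → colourIn c (y ∷ B) v) (opposite (σ x) (σ y) (m+n≡0⇒m≡0 (bit (σ x ≈ᵇ σ y)) alt))) eq)
      where
      opposite : ∀ x y → bit (x ≈ᵇ y) ≡ 0 → y ≡ not x
      opposite true  false _ = refl
      opposite false true  _ = refl

    blockCode-sound : ∀ σ B v {c b} → blockCode σ B ≡ just c → colourIn c B v ≡ just b → σ v ≡ b
    blockCode-sound σ (x ∷ B) v eq col with monoSteps σ (x ∷ B) ≡ᵇ 0 in z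
    blockCode-sound σ (x ∷ B) v refl col | true = colourIn-sound σ x B v (≡ᵇ⇒≡′ (monoSteps σ (x ∷ B)) z) col
      where
      ≡ᵇ⇒≡′ : ∀ m → (m ≡ᵇ 0) ≡ true → m ≡ 0
      ≡ᵇ⇒≡′ zero _ = refl

    -- In a coded block the colours alternate from the recorded one, so decoding may miss a vertex
    -- but never contradicts σ.
    paint-sound : ∀ σ Bs v {b} → paint Bs (codeOf σ Bs) v ≡ just b → σ v ≡ b
    paint-sound σ (B ∷ Bs) v eq with blockCode σ B in bc
    ... | nothing = paint-sound σ Bs v eq
    ... | just c with colourIn c B v in col
    ...   | nothing = paint-sound σ Bs v eq
    ...   | just b′ = trans (blockCode-sound σ B v bc col) (just-injective eq)

    colourIn-∈ : ∀ c B {v} → v ∈ B → is-just (colourIn c B v) ≡ true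
    colourIn-∈ c (x ∷ B) {v} v∈ with v Finₚ.≟ x
    ... | yes _ = refl
    colourIn-∈ c (x ∷ B) (here eq)  | no v≢x = ⊥-elim (v≢x eq)
    colourIn-∈ c (x ∷ B) (there v∈) | no _   = colourIn-∈ (not c) B v∈

    broken : (Fin n → Bool) → List (Fin n) → List (Fin n)
    broken σ B with blockCode σ B
    ... | just _  = []
    ... | nothing = B

    unpainted : ∀ σ Bs {v} B → B ∈ Bs → v ∈ B → is-just (paint Bs (codeOf σ Bs) v) ≡ false → v ∈ concatMap (broken σ) Bs
    unpainted σ (B′ ∷ Bs) {v} B B∈ v∈ np with blockCode σ B′
    unpainted σ (B′ ∷ Bs) B (here refl) v∈ np | nothing = ∈-++⁺ˡ v∈
    unpainted σ (B′ ∷ Bs) B (there B∈)  v∈ np | nothing = ∈-++⁺ʳ B′ (unpainted σ Bs B B∈ v∈ np)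
    unpainted σ (B′ ∷ Bs) {v} B B∈ v∈ np | just c with colourIn c B′ v in col
    unpainted σ (B′ ∷ Bs) B (there B∈)  v∈ np | just c | nothing = unpainted σ Bs B B∈ v∈ np
    unpainted σ (B′ ∷ Bs) {v} B (here refl) v∈ np | just c | nothing with trans (sym (colourIn-∈ c B v∈)) (cong is-just col)
    ... | ()

    broken-length : ∀ σ B K → length B ≤ K → length (broken σ B) ≤ K * monoSteps σ B
    broken-length σ []      K B≤ = z≤n
    broken-length σ (x ∷ B) K B≤ with monoSteps σ (x ∷ B)
    ... | zero  = z≤n
    ... | suc m = ≤-trans B≤ (m≤m*n K (suc m))

    monoSteps-take-drop : ∀ (σ : Fin n → Bool) K W → monoSteps σ (take K W) + monoSteps σ (drop K W) ≤ monoSteps σ W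
    monoSteps-take-drop σ zero          W           = ≤-refl
    monoSteps-take-drop σ (suc K)       []          = ≤-refl
    monoSteps-take-drop σ (suc zero)    (x ∷ [])    = ≤-refl
    monoSteps-take-drop σ (suc zero)    (x ∷ y ∷ W) = m≤n+m _ (bit (σ x ≈ᵇ σ y))
    monoSteps-take-drop σ (suc (suc K)) (x ∷ [])    = ≤-refl
    monoSteps-take-drop σ (suc (suc K)) (x ∷ y ∷ W) = ≤-trans (≤-reflexive (+-assoc (bit (σ x ≈ᵇ σ y)) _ _))
      (+-monoʳ-≤ (bit (σ x ≈ᵇ σ y)) (monoSteps-take-drop σ (suc K) (y ∷ W)))

    -- A broken block contains a monochromatic step and has at most K entries, and different blocks
    -- share no step.
    broken-total : ∀ σ K r W → length (concatMap (broken σ) (blocks K r W)) ≤ K * monoSteps σ W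
    broken-total σ K zero    W = z≤n
    broken-total σ K (suc r) W = begin
        length (broken σ (take K W) ++ concatMap (broken σ) (blocks K r (drop K W)))
      ≡⟨ length-++ (broken σ (take K W)) ⟩
        length (broken σ (take K W)) + length (concatMap (broken σ) (blocks K r (drop K W)))
      ≤⟨ +-mono-≤ (broken-length σ (take K W) K (≤-trans (≤-reflexive (length-take K W)) (m⊓n≤m K _))) (broken-total σ K r (drop K W)) ⟩
        K * monoSteps σ (take K W) + K * monoSteps σ (drop K W)
      ≡⟨ *-distribˡ-+ K (monoSteps σ (take K W)) _ ⟨
        K * (monoSteps σ (take K W) + monoSteps σ (drop K W))
      ≤⟨ *-monoʳ-≤ K (monoSteps-take-drop σ K W) ⟩
        K * monoSteps σ W ∎
      where open ≤-Reasoning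

    blocks-cover : ∀ K r (W : List (Fin n)) → length W ≤ r * K → ∀ {v} → v ∈ W → ∃ λ B → (B ∈ blocks K r W) × (v ∈ B)
    blocks-cover K zero    []  W≤ ()
    blocks-cover K (suc r) W   W≤ {v} v∈ with ∈-++⁻ (take K W) (subst (v ∈_) (sym (take++drop≡id K W)) v∈)
    ... | inj₁ h = take K W , here refl , h
    ... | inj₂ h with blocks-cover K r (drop K W) (≤-trans (≤-reflexive (length-drop K W)) (≤-trans (∸-monoˡ-≤ K W≤) (≤-reflexive (m+n∸m≡n K (r * K))))) h
    ...   | B , B∈ , v∈B = B , there B∈ , v∈B

    keep-unique : ∀ (q : Fin n → Bool) {xs} → Unique xs → Unique (keep q xs)
    keep-unique q {[]}     []        = []
    keep-unique q {x ∷ xs} (x∉ ∷ xs!) with q x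
    ... | true  = All.tabulate (λ y∈ → All.lookup x∉ (proj₁ (∈-keep⁻ q xs y∈))) ∷ keep-unique q xs!
    ... | false = keep-unique q xs!

    unique-⊆-length : ∀ {xs ys : List (Fin n)} → Unique xs → (∀ {x} → x ∈ xs → x ∈ ys) → length xs ≤ length ys
    unique-⊆-length {xs} {ys} xs! sub = subst₂ _≤_ (ones xs) (ones ys) (sumOver-⊆ (λ _ → 1) xs! sub)
      where
      ones : ∀ (zs : List (Fin n)) → sumOver (λ _ → 1) zs ≡ length zs
      ones []       = refl
      ones (z ∷ zs) = cong suc (ones zs)

    keep-split : ∀ (q : Fin n → Bool) xs → length xs ≡ length (keep q xs) + length (keep (λ x → not (q x)) xs)
    keep-split q []       = refl
    keep-split q (x ∷ xs) with q x
    ... | true  = cong suc (keep-split q xs)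
    ... | false = trans (cong suc (keep-split q xs)) (sym (+-suc _ _))

    -- Vertices of D that decoding misses lie in broken blocks.
    painted-length : ∀ σ K r W D → Unique D → (∀ {x} → x ∈ D → x ∈ W) → length W ≤ r * K →
      length D ≤ length (keep (λ v → is-just (paint (blocks K r W) (codeOf σ (blocks K r W)) v)) D) + K * monoSteps σ W
    painted-length σ K r W D D! sub W≤ = ≤-trans (≤-reflexive (keep-split q D)) (+-monoʳ-≤ (length (keep q D))
        (≤-trans (unique-⊆-length (keep-unique (λ v → not (q v)) D!) unp) (broken-total σ K r W)))
      where
      Bs : List (List (Fin n))
      Bs = blocks K r W
      q : Fin n → Bool
      q v = is-just (paint Bs (codeOf σ Bs) v)
      not-true : ∀ {b} → not b ≡ true → b ≡ false
      not-true {false} _ = refl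
      unp : ∀ {x} → x ∈ keep (λ v → not (q v)) D → x ∈ concatMap (broken σ) Bs
      unp x∈ with ∈-keep⁻ (λ v → not (q v)) D x∈
      ... | x∈D , nq with blocks-cover K r W W≤ (sub x∈D)
      ...   | B , B∈ , x∈B = unpainted σ Bs B B∈ x∈B (not-true nq)

    agrees : (Fin n → Maybe Bool) → Fin n × Fin n → Bool
    agrees χ (i , j) with χ i | χ j
    ... | just a  | just b  = a ≈ᵇ b
    ... | just _  | nothing = false
    ... | nothing | _       = false

    agrees-ends : ∀ χ v w → agrees χ (key v w) ≡ agrees χ (v , w)
    agrees-ends χ v w with key-ends v w
    ... | inj₁ eq = cong (agrees χ) eq
    ... | inj₂ eq = trans (cong (agrees χ) eq) (comm (χ v) (χ w) refl refl)
      where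
      comm : ∀ a b → χ v ≡ a → χ w ≡ b → agrees χ (w , v) ≡ agrees χ (v , w)
      comm a b va wb rewrite va | wb with a | b
      ... | just x  | just y  = ≈ᵇ-comm y x
      ... | just _  | nothing = refl
      ... | nothing | just _  = refl
      ... | nothing | nothing = refl

    -- With t and f vertices of the two colours, twice the number of agreeing pairs is t² + f² - (t
    -- + f), and t² + f² is at least (t + f)²/2.
    count-agrees : ∀ χ D → (∀ {x} → x ∈ D → is-just (χ x) ≡ true) →
      length D * length D ≤ 4 * count (agrees χ) (pairsOf D) + 2 * length D
    count-agrees χ D h with exact D h
      where
      isTrue isFalse : Maybe Bool → Bool
      isTrue (just true)   = true
      isTrue _             = false
      isFalse (just false) = true
      isFalse _            = false
      T F : List (Fin n) → ℕ
      T = count (λ x → isTrue (χ x))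
      F = count (λ x → isFalse (χ x))
      star-true : ∀ v ws → χ v ≡ just true → (∀ {x} → x ∈ ws → is-just (χ x) ≡ true) → count (agrees χ) (map (key v) ws) ≡ T ws
      star-true v []       vt h = refl
      star-true v (w ∷ ws) vt h = cong₂ _+_ (cong bit (trans (agrees-ends χ v w) at)) (star-true v ws vt (λ x∈ → h (there x∈)))
        where
        at : agrees χ (v , w) ≡ isTrue (χ w)
        at rewrite vt with χ w
        ... | just true  = refl
        ... | just false = refl
        ... | nothing    = refl
      star-false : ∀ v ws → χ v ≡ just false → (∀ {x} → x ∈ ws → is-just (χ x) ≡ true) → count (agrees χ) (map (key v) ws) ≡ F ws
      star-false v []       vf h = refl
      star-false v (w ∷ ws) vf h = cong₂ _+_ (cong bit (trans (agrees-ends χ v w) at)) (star-false v ws vf (λ x∈ → h (there x∈)))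
        where
        at : agrees χ (v , w) ≡ isFalse (χ w)
        at rewrite vf with χ w
        ... | just true  = refl
        ... | just false = refl
        ... | nothing    = refl
      exact : ∀ D → (∀ {x} → x ∈ D → is-just (χ x) ≡ true) →
              ∃ λ t → ∃ λ f → (t ≡ T D) × (f ≡ F D) × (length D ≡ t + f) × (2 * count (agrees χ) (pairsOf D) + length D ≡ t * t + f * f)
      exact []      h = 0 , 0 , refl , refl , refl , refl
      exact (v ∷ D) h with exact D (λ x∈ → h (there x∈)) | χ v in cv | h {v} (here refl)
      ... | t , f , t≡ , f≡ , len , sq | just true  | _ = suc t , f , cong suc t≡ , f≡ , cong suc len ,
            trans (cong (λ c → 2 * c + suc (length D)) (trans (sumOver-++ _ (map (key v) D) (pairsOf D)) (cong (_+ count (agrees χ) (pairsOf D)) (trans (star-true v D cv (λ x∈ → h (there x∈))) (sym t≡)))))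
                  (trans (lem t _ (length D)) (trans (cong (suc (2 * t) +_) sq) (lem′ t f)))
        where
        lem : ∀ t c l → 2 * (t + c) + suc l ≡ suc (2 * t) + (2 * c + l)
        lem = solve-∀
        lem′ : ∀ t f → suc (2 * t) + (t * t + f * f) ≡ suc t * suc t + f * f
        lem′ = solve-∀
      ... | t , f , t≡ , f≡ , len , sq | just false | _ = t , suc f , t≡ , cong suc f≡ , trans (cong suc len) (sym (+-suc t f)) ,
            trans (cong (λ c → 2 * c + suc (length D)) (trans (sumOver-++ _ (map (key v) D) (pairsOf D)) (cong (_+ count (agrees χ) (pairsOf D)) (trans (star-false v D cv (λ x∈ → h (there x∈))) (sym f≡)))))
                  (trans (lem f _ (length D)) (trans (cong (suc (2 * f) +_) sq) (lem′ t f)))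
        where
        lem : ∀ t c l → 2 * (t + c) + suc l ≡ suc (2 * t) + (2 * c + l)
        lem = solve-∀
        lem′ : ∀ t f → suc (2 * f) + (t * t + f * f) ≡ t * t + suc f * suc f
        lem′ = solve-∀
    ... | t , f , _ , _ , len , sq = begin
        length D * length D
      ≡⟨ cong₂ _*_ len len ⟩
        (t + f) * (t + f)
      ≤⟨ square-sum t f ⟩
        2 * (t * t + f * f)
      ≡⟨ cong (2 *_) sq ⟨
        2 * (2 * count (agrees χ) (pairsOf D) + length D)
      ≡⟨ lem (count (agrees χ) (pairsOf D)) (length D) ⟩
        4 * count (agrees χ) (pairsOf D) + 2 * length D ∎
      where
      open ≤-Reasoning
      lem : ∀ c l → 2 * (2 * c + l) ≡ 4 * c + 2 * l
      lem = solve-∀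
      ordered : ∀ t d → (t + (t + d)) * (t + (t + d)) + d * d ≡ 2 * (t * t + (t + d) * (t + d))
      ordered = solve-∀
      square-sum : ∀ t f → (t + f) * (t + f) ≤ 2 * (t * t + f * f)
      square-sum t f with ≤-total t f
      ... | inj₁ t≤f with m≤n⇒∃[o]m+o≡n t≤f
      ...   | d , refl = ≤-trans (m≤m+n _ (d * d)) (≤-reflexive (ordered t d))
      square-sum t f | inj₂ f≤t with m≤n⇒∃[o]m+o≡n f≤t
      ...   | d , refl = ≤-trans (≤-reflexive (cong₂ _*_ (+-comm (f + d) f) (+-comm (f + d) f))) (≤-trans (m≤m+n _ (d * d)) (≤-trans (≤-reflexive (ordered f d)) (≤-reflexive (cong (2 *_) (+-comm (f * f) _)))))

    codeOf-∈ : ∀ σ K r (W : List (Fin n)) → codeOf σ (blocks K r W) ∈ allCodes r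
    codeOf-∈ σ K zero    W = here refl
    codeOf-∈ σ K (suc r) W with blockCode σ (take K W)
    ... | just true  = ∈-++⁺ˡ (∈-map⁺ _ (codeOf-∈ σ K r (drop K W)))
    ... | just false = ∈-++⁺ʳ (map (just true ∷_) (allCodes r)) (∈-++⁺ˡ (∈-map⁺ _ (codeOf-∈ σ K r (drop K W))))
    ... | nothing    = ∈-++⁺ʳ (map (just true ∷_) (allCodes r)) (∈-++⁺ʳ (map (just false ∷_) (allCodes r)) (∈-map⁺ _ (codeOf-∈ σ K r (drop K W))))

    module _ (σ : Fin n → Bool) (K r : ℕ) (W D : List (Fin n)) (D! : Unique D) (D⊆W : ∀ {x} → x ∈ D → x ∈ W) (W≤ : length W ≤ r * K) where

      private
        Bs : List (List (Fin n))
        Bs = blocks K r W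
        χ : Fin n → Maybe Bool
        χ = paint Bs (codeOf σ Bs)

      agrees-mono : ∀ ω → count (λ e → agrees χ e ∧ ω e) (pairs n) ≤ mono σ ω
      agrees-mono ω = sumOver-mono (pairs n) λ e _ → at e
        where
        at : ∀ e → bit (agrees χ e ∧ ω e) ≤ bit ((σ (proj₁ e) ≈ᵇ σ (proj₂ e)) ∧ ω e)
        at (i , j) with χ i in ci | χ j in cj
        ... | just a  | just b  = ≤-reflexive (cong₂ (λ x y → bit ((x ≈ᵇ y) ∧ ω (i , j))) (sym (paint-sound σ Bs i ci)) (sym (paint-sound σ Bs j cj)))
        ... | just _  | nothing = z≤n
        ... | nothing | _       = z≤n

      -- At least H vertices are painted. As H ≥ 4, the linear term in `count-agrees` is absorbed by
      -- half of the square, whence the factor 8.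
      agrees-many : ∀ H → 4 ≤ H → H + K * monoSteps σ W ≤ length D → H * H ≤ 8 * count (agrees χ) (pairs n)
      agrees-many H 4≤H H≤ = begin
          H * H
        ≤⟨ *-mono-≤ H≤l H≤l ⟩
          l * l
        ≤⟨ +-cancelʳ-≤ (l * l) (l * l) _ doubled ⟩
          8 * c
        ≤⟨ *-monoʳ-≤ 8 (sumOver-⊆ _ (pairsOf-unique (keep-unique q D!)) (λ e∈ → subst (_ ∈_) (sym (pairs-pairsOf n)) (pairsOf-⊆ (keep-unique q D!) (λ {x} _ → ∈-allFin x) e∈))) ⟩
          8 * count (agrees χ) (pairs n) ∎
        where
        open ≤-Reasoning
        q : Fin n → Bool
        q v = is-just (χ v)
        D′ : List (Fin n)
        D′ = keep q D
        l c : ℕ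
        l = length D′
        c = count (agrees χ) (pairsOf D′)
        H≤l : H ≤ l
        H≤l = +-cancelʳ-≤ (K * monoSteps σ W) H l (≤-trans H≤ (painted-length σ K r W D D! D⊆W W≤))
        lem : ∀ c l → 2 * (4 * c + 2 * l) ≡ 8 * c + 4 * l
        lem = solve-∀
        doubled : l * l + l * l ≤ 8 * c + l * l
        doubled = begin
            l * l + l * l          ≡⟨ cong (l * l +_) (+-identityʳ (l * l)) ⟨
            2 * (l * l)            ≤⟨ *-monoʳ-≤ 2 (count-agrees χ D′ (λ x∈ → proj₂ (∈-keep⁻ q D x∈))) ⟩
            2 * (4 * c + 2 * l)    ≡⟨ lem c l ⟩
            8 * c + 4 * l          ≤⟨ +-monoʳ-≤ (8 * c) (*-monoˡ-≤ l (≤-trans 4≤H H≤l)) ⟩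
            8 * c + l * l          ∎

-- Powers in place of exponentials.

module Powers where

  open Rationals
  open import Data.Nat as ℕ using (ℕ; zero; suc; z≤n; s≤s)
  import Data.Nat.Properties as ℕₚ
  open import Data.Rational
  open import Data.Rational.Properties
  open import Relation.Binary.PropositionalEquality
  open import Tactic.RingSolver using (solve-∀)

  0≤½ : 0ℚ ≤ ½
  0≤½ = nonNegative⁻¹ ½

  0≤pow : ∀ {x} k → 0ℚ ≤ x → 0ℚ ≤ pow x k
  0≤pow zero    0≤x = 0≤1
  0≤pow (suc k) 0≤x = 0≤* 0≤x (0≤pow k 0≤x)

  pow-mono-base : ∀ {x y} k → 0ℚ ≤ x → x ≤ y → pow x k ≤ pow y k
  pow-mono-base zero    0≤x x≤y = ≤-refl
  pow-mono-base (suc k) 0≤x x≤y = *-mono 0≤x (0≤pow k (≤-trans 0≤x x≤y)) x≤y (pow-mono-base k 0≤x x≤y)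

  1≤pow : ∀ {x} k → 1ℚ ≤ x → 1ℚ ≤ pow x k
  1≤pow zero    1≤x = ≤-refl
  1≤pow {x} (suc k) 1≤x = subst (_≤ x * pow x k) (*-identityˡ 1ℚ) (*-mono 0≤1 (0≤pow k (≤-trans 0≤1 1≤x)) 1≤x (1≤pow k 1≤x))

  pow≤1 : ∀ {x} k → 0ℚ ≤ x → x ≤ 1ℚ → pow x k ≤ 1ℚ
  pow≤1 zero    0≤x x≤1 = ≤-refl
  pow≤1 {x} (suc k) 0≤x x≤1 = subst (x * pow x k ≤_) (*-identityˡ 1ℚ) (*-mono 0≤x 0≤1 x≤1 (pow≤1 k 0≤x x≤1))

  pow-antitone : ∀ {x k l} → 0ℚ ≤ x → x ≤ 1ℚ → k ℕ.≤ l → pow x l ≤ pow x k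
  pow-antitone {l = l} 0≤x x≤1 z≤n       = pow≤1 l 0≤x x≤1
  pow-antitone         0≤x x≤1 (s≤s k≤l) = *-monoˡ 0≤x (pow-antitone 0≤x x≤1 k≤l)

  pow-monotone : ∀ {x k l} → 1ℚ ≤ x → k ℕ.≤ l → pow x k ≤ pow x l
  pow-monotone {l = l} 1≤x z≤n       = 1≤pow l 1≤x
  pow-monotone         1≤x (s≤s k≤l) = *-monoˡ (≤-trans 0≤1 1≤x) (pow-monotone 1≤x k≤l)

  pow-*-base : ∀ x y k → pow (x * y) k ≡ pow x k * pow y k
  pow-*-base x y zero    = refl
  pow-*-base x y (suc k) = trans (cong (x * y *_) (pow-*-base x y k)) (lem x y (pow x k) (pow y k))
    where
    lem : ∀ x y a b → x * y * (a * b) ≡ x * a * (y * b)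
    lem = solve-∀ ℚ-ring

  pow-1 : ∀ k → pow 1ℚ k ≡ 1ℚ
  pow-1 zero    = refl
  pow-1 (suc k) = trans (*-identityˡ _) (pow-1 k)

  pow-* : ∀ x k l → pow x (k ℕ.* l) ≡ pow (pow x k) l
  pow-* x zero    l = sym (pow-1 l)
  pow-* x (suc k) l = trans (pow-+ x l (k ℕ.* l)) (trans (cong (pow x l *_) (pow-* x k l)) (sym (pow-*-base x (pow x k) l)))

  ι-^ : ∀ a k → ι (a ℕ.^ k) ≡ pow (ι a) k
  ι-^ a zero    = ι-1
  ι-^ a (suc k) = trans (ι-* a (a ℕ.^ k)) (cong (ι a *_) (ι-^ a k))

  bernoulli : ∀ x k → 0ℚ ≤ x → 1ℚ + ι k * x ≤ pow (1ℚ + x) k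
  bernoulli x zero    0≤x = ≤-reflexive (trans (cong (λ z → 1ℚ + z * x) ι-0) (trans (cong (1ℚ +_) (*-zeroˡ x)) (+-identityʳ 1ℚ)))
  bernoulli x (suc k) 0≤x = begin
      1ℚ + ι (suc k) * x
    ≡⟨ cong (λ z → 1ℚ + z * x) (ι-suc k) ⟩
      1ℚ + (1ℚ + ι k) * x
    ≤⟨ ≤-by _ (0≤* (0≤ι k) (0≤* 0≤x 0≤x)) (lem x (ι k)) ⟩
      (1ℚ + x) * (1ℚ + ι k * x)
    ≤⟨ *-monoˡ (0≤+ 0≤1 0≤x) (bernoulli x k 0≤x) ⟩
      (1ℚ + x) * pow (1ℚ + x) k ∎
    where
    open ≤-Reasoning
    lem : ∀ x k → (1ℚ + x) * (1ℚ + k * x) ≡ (1ℚ + (1ℚ + k) * x) + k * (x * x)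
    lem = solve-∀ ℚ-ring

  bernoulli⁻ : ∀ x k → 0ℚ ≤ x → x ≤ 1ℚ → 1ℚ - ι k * x ≤ pow (1ℚ - x) k
  bernoulli⁻ x zero    0≤x x≤1 = ≤-reflexive (trans (cong (λ z → 1ℚ - z * x) ι-0) (lem x))
    where
    lem : ∀ x → 1ℚ - 0ℚ * x ≡ 1ℚ
    lem = solve-∀ ℚ-ring
  bernoulli⁻ x (suc k) 0≤x x≤1 = begin
      1ℚ - ι (suc k) * x
    ≡⟨ cong (λ z → 1ℚ - z * x) (ι-suc k) ⟩
      1ℚ - (1ℚ + ι k) * x
    ≤⟨ ≤-by _ (0≤* (0≤ι k) (0≤* 0≤x 0≤x)) (lem x (ι k)) ⟩
      (1ℚ - x) * (1ℚ - ι k * x)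
    ≤⟨ *-monoˡ (0≤gap x≤1) (bernoulli⁻ x k 0≤x x≤1) ⟩
      (1ℚ - x) * pow (1ℚ - x) k ∎
    where
    open ≤-Reasoning
    lem : ∀ x k → (1ℚ - x) * (1ℚ - k * x) ≡ (1ℚ - (1ℚ + k) * x) + k * (x * x)
    lem = solve-∀ ℚ-ring

  pow-conjugate : ∀ x k → 0ℚ ≤ x → x ≤ 1ℚ → pow (1ℚ - x) k * pow (1ℚ + x) k ≤ 1ℚ
  pow-conjugate x k 0≤x x≤1 = subst (_≤ 1ℚ) (trans (cong (λ z → pow z k) (sym (lem x))) (pow-*-base (1ℚ - x) (1ℚ + x) k))
    (pow≤1 k (subst (0ℚ ≤_) (lem x) (0≤* (0≤gap x≤1) (0≤+ 0≤1 0≤x))) (≤-by (x * x) (0≤* 0≤x 0≤x) (lem′ x)))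
    where
    lem : ∀ x → (1ℚ - x) * (1ℚ + x) ≡ 1ℚ - x * x
    lem = solve-∀ ℚ-ring
    lem′ : ∀ x → 1ℚ ≡ (1ℚ - x * x) + x * x
    lem′ = solve-∀ ℚ-ring

  -- The substitute for the decay of e^(-kx): Bernoulli bounds the second factor by (1 + x)^k, and
  -- (1 - x)(1 + x) ≤ 1.
  pow-decay : ∀ x k → 0ℚ ≤ x → x ≤ 1ℚ → pow (1ℚ - x) k * (1ℚ + ι k * x) ≤ 1ℚ
  pow-decay x k 0≤x x≤1 = ≤-trans (*-monoˡ (0≤pow k (0≤gap x≤1)) (bernoulli x k 0≤x)) (pow-conjugate x k 0≤x x≤1)

  pow-halves : ∀ x k → 0ℚ ≤ x → x ≤ 1ℚ → 1ℚ ≤ ι k * x → pow (1ℚ - x) k ≤ ½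
  pow-halves x k 0≤x x≤1 1≤kx = begin
      P                           ≡⟨ lem P ⟩
      ½ * (P * (1ℚ + 1ℚ))         ≤⟨ *-monoˡ 0≤½ (*-monoˡ (0≤pow k (0≤gap x≤1)) (+-monoʳ-≤ 1ℚ 1≤kx)) ⟩
      ½ * (P * (1ℚ + ι k * x))    ≤⟨ *-monoˡ 0≤½ (pow-decay x k 0≤x x≤1) ⟩
      ½ * 1ℚ                      ≡⟨ *-identityʳ ½ ⟩
      ½                           ∎
    where
    open ≤-Reasoning
    P : ℚ
    P = pow (1ℚ - x) k
    lem : ∀ P → P ≡ ½ * (P * (1ℚ + 1ℚ))
    lem = solve-∀ ℚ-ring

  -- (1 + x)^k is at most the inverse of (1 - x)^k, and the latter is at least 1 - kx ≥ ½.
  pow-doubles : ∀ x k → 0ℚ ≤ x → ι k * x ≤ ½ → x ≤ 1ℚ → pow (1ℚ + x) k ≤ lit 2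
  pow-doubles x k 0≤x kx≤½ x≤1 = begin
      P                              ≡⟨ lem P ⟩
      lit 2 * (½ * P)                ≤⟨ *-monoˡ (0≤lit 2) (*-monoʳ (0≤pow k (0≤+ 0≤1 0≤x)) half≤) ⟩
      lit 2 * (pow (1ℚ - x) k * P)   ≤⟨ *-monoˡ (0≤lit 2) (pow-conjugate x k 0≤x x≤1) ⟩
      lit 2 * 1ℚ                     ≡⟨ *-identityʳ (lit 2) ⟩
      lit 2                          ∎
    where
    open ≤-Reasoning
    P : ℚ
    P = pow (1ℚ + x) k
    lem : ∀ P → P ≡ lit 2 * (½ * P)
    lem = solve-∀ ℚ-ring
    half≤ : ½ ≤ pow (1ℚ - x) k
    half≤ = ≤-trans (≤-by (½ - ι k * x) (0≤gap kx≤½) (lem′ (ι k * x))) (bernoulli⁻ x k 0≤x x≤1)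
      where
      lem′ : ∀ y → 1ℚ - y ≡ ½ + (½ - y)
      lem′ = solve-∀ ℚ-ring

  pow-½-2 : ∀ k → pow ½ k * pow (lit 2) k ≡ 1ℚ
  pow-½-2 k = trans (sym (pow-*-base ½ (lit 2) k)) (pow-1 k)

-- The expected number of trees in the supercritical exploration.

module RootCount where

  open Rationals
  open Powers
  open ListSums
  open VertexPairs
  open Concentration
  open Exploration
  open import Defs using (pairs)
  open import Data.Bool using (Bool; true; false; if_then_else_)
  open import Data.Nat as ℕ using (ℕ; zero; suc; _∸_; _≤ᵇ_)
  import Data.Nat.Properties as ℕₚ
  open import Data.List using (List; []; allFin)
  open import Data.List.Properties using (length-tabulate)
  open import Data.List.Relation.Unary.Unique.Propositional.Properties using (allFin⁺)
  open import Data.Rational hiding (_≤ᵇ_)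
  open import Data.Rational.Properties
  open import Data.Empty using (⊥-elim)
  open import Data.Unit using (tt)
  open import Data.Bool using (T)
  open import Relation.Binary.PropositionalEquality
  open import Tactic.RingSolver using (solve-∀)

  𝔼-pow : ∀ p u y → 𝔼 p u (λ bs → pow y (trues bs)) ≡ pow (1ℚ - p + p * y) u
  𝔼-pow p zero    y = refl
  𝔼-pow p (suc u) y = trans (cong₂ (λ a b → p * a + (1ℚ - p) * b) (trans (𝔼-* p u y _) (cong (y *_) (𝔼-pow p u y))) (𝔼-pow p u y)) (lem p y _)
    where
    lem : ∀ p y P → p * (y * P) + (1ℚ - p) * P ≡ (1ℚ - p + p * y) * P
    lem = solve-∀ ℚ-ring

  -- While at least u₀ vertices are unexplored, (1 - z)^a is a supermartingale for the number a of active
  -- vertices, and every new root lowers its expected value by z.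
  module Roots (n u₀ : ℕ) (p z N : ℚ) (0≤p : 0ℚ ≤ p) (p≤1 : p ≤ 1ℚ) (0≤z : 0ℚ ≤ z) (z≤1 : z ≤ 1ℚ) (0≤N : 0ℚ ≤ N) (Nz : N * z ≡ 1ℚ)
               (drift : 1ℚ ≤ ι u₀ * p * (1ℚ - z)) where

    Ψ : ℕ → ℚ
    Ψ a = N * pow (1ℚ - z) a

    -- The difference `k ∸ a` is the number of unexplored vertices. Once it is below `u₀`, no root
    -- is charged any more and the potential may drop to 0.
    Φ : ℕ → ℕ → ℚ
    Φ k a = if u₀ ≤ᵇ (k ∸ a) then Ψ a else 0ℚ

    private
      0≤1-z : 0ℚ ≤ 1ℚ - z
      0≤1-z = 0≤gap z≤1

      0≤Ψ : ∀ a → 0ℚ ≤ Ψ a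
      0≤Ψ a = 0≤* 0≤N (0≤pow a 0≤1-z)

      0≤Φ : ∀ k a → 0ℚ ≤ Φ k a
      0≤Φ k a with u₀ ≤ᵇ (k ∸ a)
      ... | true  = 0≤Ψ a
      ... | false = ≤-refl

      Φ≤Ψ : ∀ k a → Φ k a ≤ Ψ a
      Φ≤Ψ k a with u₀ ≤ᵇ (k ∸ a)
      ... | true  = ≤-refl
      ... | false = 0≤Ψ a

      Φ-late : ∀ k a → k ∸ a ℕ.< u₀ → Φ k a ≡ 0ℚ
      Φ-late k a k∸a< with u₀ ≤ᵇ (k ∸ a) in eq
      ... | true  = ⊥-elim (ℕₚ.<⇒≱ k∸a< (ℕₚ.≤ᵇ⇒≤ u₀ (k ∸ a) (subst T (sym eq) tt)))
      ... | false = refl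

      -- The power is (1 - pz)^u, at most 1/(1 + upz) by `pow-decay`. Since up(1 - z) ≥ 1, the
      -- product (1 + upz)(1 - z) is at least 1.
      shrink : ∀ u → u₀ ℕ.≤ u → pow (1ℚ - p + p * (1ℚ - z)) u ≤ 1ℚ - z
      shrink u u₀≤u = begin
          pow (1ℚ - p + p * (1ℚ - z)) u
        ≡⟨ cong (λ y → pow y u) (l p z) ⟩
          P
        ≤⟨ ≤-by _ (0≤* 0≤P (0≤* 0≤z (0≤gap drift′))) (l′ P z p (ι u)) ⟩
          P * (1ℚ + ι u * (p * z)) * (1ℚ - z)
        ≤⟨ *-monoʳ 0≤1-z (pow-decay (p * z) u (0≤* 0≤p 0≤z) pz≤1) ⟩
          1ℚ * (1ℚ - z)
        ≡⟨ *-identityˡ (1ℚ - z) ⟩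
          1ℚ - z ∎
        where
        open ≤-Reasoning
        pz≤1 : p * z ≤ 1ℚ
        pz≤1 = subst (p * z ≤_) (*-identityˡ 1ℚ) (*-mono 0≤p 0≤1 p≤1 z≤1)
        P : ℚ
        P = pow (1ℚ - p * z) u
        0≤P : 0ℚ ≤ P
        0≤P = 0≤pow u (0≤gap pz≤1)
        drift′ : 1ℚ ≤ ι u * p * (1ℚ - z)
        drift′ = ≤-trans drift (*-monoʳ 0≤1-z (*-monoʳ 0≤p (ι-mono u₀≤u)))
        l : ∀ p z → 1ℚ - p + p * (1ℚ - z) ≡ 1ℚ - p * z
        l = solve-∀ ℚ-ring
        l′ : ∀ P z p u → P * (1ℚ + u * (p * z)) * (1ℚ - z) ≡ P + P * (z * (u * p * (1ℚ - z) - 1ℚ))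
        l′ = solve-∀ ℚ-ring

      advance : ∀ a u → u₀ ℕ.≤ u → 𝔼 p u (λ bs → Φ (a ℕ.+ u) (a ℕ.+ trues bs)) ≤ Ψ (suc a)
      advance a u u₀≤u = begin
          𝔼 p u (λ bs → Φ (a ℕ.+ u) (a ℕ.+ trues bs))
        ≤⟨ 𝔼-mono p 0≤p p≤1 u (λ bs _ → ≤-trans (Φ≤Ψ (a ℕ.+ u) (a ℕ.+ trues bs)) (≤-reflexive (trans (cong (N *_) (pow-+ (1ℚ - z) a (trues bs))) (sym (*-assoc N _ _))))) ⟩
          𝔼 p u (λ bs → N * pow (1ℚ - z) a * pow (1ℚ - z) (trues bs))
        ≡⟨ trans (𝔼-* p u (N * pow (1ℚ - z) a) _) (cong (N * pow (1ℚ - z) a *_) (𝔼-pow p u (1ℚ - z))) ⟩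
          N * pow (1ℚ - z) a * pow (1ℚ - p + p * (1ℚ - z)) u
        ≤⟨ *-monoˡ (0≤Ψ a) (shrink u u₀≤u) ⟩
          N * pow (1ℚ - z) a * (1ℚ - z)
        ≡⟨ l N (pow (1ℚ - z) a) (1ℚ - z) ⟩
          Ψ (suc a) ∎
        where
        open ≤-Reasoning
        l : ∀ N P y → N * P * y ≡ N * (y * P)
        l = solve-∀ ℚ-ring

      late : ∀ a u → u ℕ.< u₀ → 𝔼 p u (λ bs → Φ (a ℕ.+ u) (a ℕ.+ trues bs)) ≡ 0ℚ
      late a u u<u₀ = trans (𝔼-cong p u (λ bs → Φ-late (a ℕ.+ u) (a ℕ.+ trues bs)
          (ℕₚ.≤-<-trans (ℕₚ.≤-reflexive (ℕₚ.[m+n]∸[m+o]≡n∸o a u (trues bs))) (ℕₚ.≤-<-trans (ℕₚ.m∸n≤m u (trues bs)) u<u₀)))) (𝔼-const p u 0ℚ)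

      ≤ᵇ-true : ∀ {a b} → (a ≤ᵇ b) ≡ true → a ℕ.≤ b
      ≤ᵇ-true {a} {b} eq = ℕₚ.≤ᵇ⇒≤ a b (subst T (sym eq) tt)

      ≤ᵇ-false : ∀ {a b} → (a ≤ᵇ b) ≡ false → b ℕ.< a
      ≤ᵇ-false {a} {b} eq = ℕₚ.≰⇒> λ a≤b → subst T eq (ℕₚ.≤⇒≤ᵇ a≤b)

      step : ∀ a u → suc (a ℕ.+ u) ℕ.≤ n → ι 0 * (ι a * p) + 𝔼 p u (λ bs → Φ (a ℕ.+ u) (a ℕ.+ trues bs)) ≤ Φ (suc (a ℕ.+ u)) (suc a)
      step a u _ = ≤-trans (≤-reflexive (trans (cong (λ y → y * (ι a * p) + E) ι-0) (l (ι a * p) E))) (subst (λ v → E ≤ (if u₀ ≤ᵇ v then Ψ (suc a) else 0ℚ)) (sym (ℕₚ.m+n∸m≡n a u)) bound)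
        where
        E : ℚ
        E = 𝔼 p u (λ bs → Φ (a ℕ.+ u) (a ℕ.+ trues bs))
        l : ∀ y E → 0ℚ * y + E ≡ E
        l = solve-∀ ℚ-ring
        bound : E ≤ (if u₀ ≤ᵇ u then Ψ (suc a) else 0ℚ)
        bound with u₀ ≤ᵇ u in eq
        ... | true  = advance a u (≤ᵇ-true eq)
        ... | false = ≤-reflexive (late a u (≤ᵇ-false eq))

      root : ∀ u → suc u ℕ.≤ n → ι (bit (u₀ ≤ᵇ u)) + 𝔼 p u (λ bs → Φ u (trues bs)) ≤ Φ (suc u) 0
      root u _ with u₀ ≤ᵇ u in eq
      ... | true  = begin
          ι 1 + 𝔼 p u (λ bs → Φ u (trues bs))
        ≤⟨ +-mono-≤ (≤-reflexive ι-1) (advance 0 u (≤ᵇ-true eq)) ⟩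
          1ℚ + N * ((1ℚ - z) * 1ℚ)
        ≡⟨ cong (_+ N * ((1ℚ - z) * 1ℚ)) Nz ⟨
          N * z + N * ((1ℚ - z) * 1ℚ)
        ≡⟨ l N z ⟩
          Ψ 0
        ≡⟨ cong (λ b → if b then Ψ 0 else 0ℚ) (≤⇒≤ᵇ-true (ℕₚ.m≤n⇒m≤1+n (≤ᵇ-true {u₀} eq))) ⟨
          Φ (suc u) 0 ∎
        where
        open ≤-Reasoning
        l : ∀ N z → N * z + N * ((1ℚ - z) * 1ℚ) ≡ N * 1ℚ
        l = solve-∀ ℚ-ring
        ≤⇒≤ᵇ-true : ∀ {a b} → a ℕ.≤ b → (a ≤ᵇ b) ≡ true
        ≤⇒≤ᵇ-true {a} {b} a≤b with a ≤ᵇ b in ab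
        ... | true  = refl
        ... | false = ⊥-elim (ℕₚ.<⇒≱ (≤ᵇ-false {a} ab) a≤b)
      ... | false = ≤-trans (≤-reflexive (trans (cong₂ _+_ ι-0 (late 0 u (≤ᵇ-false eq))) (+-identityʳ 0ℚ))) (0≤Φ (suc u) 0)

    open Search 0 (λ u → bit (u₀ ≤ᵇ u))

    𝔼-roots-≤ : ∀ ω → 𝔼ₖ p (pairs n) (λ ω → ι (run n ω [] (allFin n))) ω ≤ N
    𝔼-roots-≤ ω = begin
        𝔼ₖ p (pairs n) (λ ω → ι (run n ω [] (allFin n))) ω
      ≡⟨ cong (λ L → 𝔼ₖ p L (λ ω → ι (run n ω [] (allFin n))) ω) (pairs-pairsOf n) ⟩
        𝔼ₖ p (pairsOf (allFin n)) (λ ω → ι (run n ω [] (allFin n))) ω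
      ≤⟨ run-≤ p 0≤p p≤1 n Φ 0≤Φ step root n ω [] (allFin n) (allFin⁺ n) (length-tabulate (λ i → i)) ℕₚ.≤-refl ⟩
        Φ n 0
      ≤⟨ Φ≤Ψ n 0 ⟩
        N * 1ℚ
      ≡⟨ *-identityʳ N ⟩
        N ∎
      where open ≤-Reasoning

-- Exponential moments and union bounds.

module Tails where

  open import Defs using (pairs; allColourings)
  open Rationals
  open Powers
  open ListSums
  open VertexPairs
  open Concentration
  open Exploration
  open Reordering
  open import Data.Bool using (Bool; true; _∧_; _∨_)
  open import Data.Nat as ℕ using (ℕ; zero; suc)
  import Data.Nat.Properties as ℕₚ
  open import Data.Fin using (Fin; toℕ)
  import Data.Fin.Properties as Finₚ
  open import Data.List using (List; []; _∷_; _++_; map; length; allFin)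
  open import Data.List.Properties using (length-++; length-map; length-tabulate)
  open import Data.List.Membership.Propositional using (_∈_)
  open import Data.List.Membership.Propositional.Properties using (∈-allFin)
  open import Data.List.Relation.Unary.Any using (here; there)
  import Data.List.Relation.Unary.All as All
  open import Data.List.Relation.Unary.AllPairs using ([]; _∷_)
  open import Data.List.Relation.Unary.Unique.Propositional using (Unique)
  open import Data.List.Relation.Unary.Unique.Propositional.Properties using (allFin⁺)
  open import Data.Product using (_×_; _,_; proj₁; proj₂)
  open import Data.Empty using (⊥-elim)
  open import Data.Rational hiding (floor)
  open import Data.Rational.Properties hiding (_≟_)
  open import Relation.Nullary using (yes; no)
  open import Relation.Nullary.Decidable using (⌊_⌋)
  open import Relation.Binary.PropositionalEquality
  open import Tactic.RingSolver using (solve-∀)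
  import Data.Nat.Tactic.RingSolver as ℕ-Solver

  sumℚ : ∀ {A : Set} → (A → ℚ) → List A → ℚ
  sumℚ f []       = 0ℚ
  sumℚ f (x ∷ xs) = f x + sumℚ f xs

  0≤sumℚ : ∀ {A : Set} {f : A → ℚ} → (∀ x → 0ℚ ≤ f x) → ∀ xs → 0ℚ ≤ sumℚ f xs
  0≤sumℚ h []       = ≤-refl
  0≤sumℚ h (x ∷ xs) = 0≤+ (h x) (0≤sumℚ h xs)

  sumℚ-∈ : ∀ {A : Set} {f : A → ℚ} → (∀ x → 0ℚ ≤ f x) → ∀ {x xs} → x ∈ xs → f x ≤ sumℚ f xs
  sumℚ-∈ {f = f} h {x} {_ ∷ xs} (here refl) = subst (_≤ f x + sumℚ f xs) (+-identityʳ (f x)) (+-monoʳ-≤ (f x) (0≤sumℚ h xs))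
  sumℚ-∈ {f = f} h {x} {y ∷ xs} (there x∈)  = subst (_≤ f y + sumℚ f xs) (+-identityˡ (f x)) (+-mono-≤ (h y) (sumℚ-∈ h x∈))

  sumℚ-cong : ∀ {A : Set} {f g : A → ℚ} → (∀ x → f x ≡ g x) → ∀ xs → sumℚ f xs ≡ sumℚ g xs
  sumℚ-cong h []       = refl
  sumℚ-cong h (x ∷ xs) = cong₂ _+_ (h x) (sumℚ-cong h xs)

  -- Markov's inequality and the union bound in one variable: a single test with an extreme count
  -- already makes the sum large, and the mean of the sum is computed test by test.
  tests : ∀ {n} {A : Set} → ℚ → (A → Fin n × Fin n → Bool) → List A → Graph n → ℚ
  tests {n} θ q ts ω = sumℚ (λ t → pow θ (count (λ e → q t e ∧ ω e) (pairs n))) ts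

  tests-ext : ∀ {n} {A : Set} θ (q : A → Fin n × Fin n → Bool) ts → Extensional (tests θ q ts)
  tests-ext {n} θ q ts h = sumℚ-cong (λ t → cong (pow θ) (sumOver-cong (λ e → cong (λ b → bit (q t e ∧ b)) (h e)) (pairs n))) ts

  𝔼ₖ-tests : ∀ {n} {A : Set} p θ (q : A → Fin n × Fin n → Bool) B ts →
    (∀ t → t ∈ ts → pow (1ℚ - p + p * θ) (count (q t) (pairs n)) ≤ B) → ∀ ω → 𝔼ₖ p (pairs n) (tests θ q ts) ω ≤ ι (length ts) * B
  𝔼ₖ-tests {n} p θ q B []       h ω = ≤-reflexive (trans (𝔼-const p (length (pairs n)) 0ℚ) (trans (sym (*-zeroˡ B)) (cong (_* B) (sym ι-0))))
  𝔼ₖ-tests {n} p θ q B (t ∷ ts) h ω = begin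
      𝔼ₖ p (pairs n) (λ ω → f ω + tests θ q ts ω) ω
    ≡⟨ 𝔼ₖ-+ p (pairs n) f (tests θ q ts) ω ⟩
      𝔼ₖ p (pairs n) f ω + 𝔼ₖ p (pairs n) (tests θ q ts) ω
    ≤⟨ +-mono-≤ (≤-trans (≤-reflexive (𝔼ₖ-generating p θ (q t) ω (pairs-unique n))) (h t (here refl))) (𝔼ₖ-tests p θ q B ts (λ t′ t′∈ → h t′ (there t′∈)) ω) ⟩
      B + ι (length ts) * B
    ≡⟨ trans (lem B (ι (length ts))) (cong (_* B) (sym (ι-suc (length ts)))) ⟩
      ι (suc (length ts)) * B ∎
    where
    open ≤-Reasoning
    f : Graph n → ℚ
    f ω = pow θ (count (λ e → q t e ∧ ω e) (pairs n))
    lem : ∀ B l → B + l * B ≡ (1ℚ + l) * B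
    lem = solve-∀ ℚ-ring

  eighth : ℚ
  eighth = ½ * (½ * ½)

  2-powers-cancel : ∀ {a b} → a ℕ.+ 3 ℕ.≤ b → pow (lit 2) a * pow ½ b ≤ eighth
  2-powers-cancel {a} {b} a+3≤b = begin
      pow (lit 2) a * pow ½ b               ≤⟨ *-monoˡ (0≤pow a (0≤lit 2)) (pow-antitone {½} {a ℕ.+ 3} 0≤½ ½≤1 a+3≤b) ⟩
      pow (lit 2) a * pow ½ (a ℕ.+ 3)       ≡⟨ cong (pow (lit 2) a *_) (pow-+ ½ a 3) ⟩
      pow (lit 2) a * (pow ½ a * pow ½ 3)   ≡⟨ lem (pow (lit 2) a) (pow ½ a) (pow ½ 3) ⟩
      pow ½ a * pow (lit 2) a * pow ½ 3     ≡⟨ cong (_* pow ½ 3) (pow-½-2 a) ⟩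
      1ℚ * pow ½ 3                          ≡⟨⟩
      eighth                                ∎
    where
    open ≤-Reasoning
    lem : ∀ x y z → x * (y * z) ≡ y * x * z
    lem = solve-∀ ℚ-ring
    ½≤1 : ½ ≤ 1ℚ
    ½≤1 = ≤-by ½ 0≤½ refl

  ι-2^ : ∀ k → ι (2 ℕ.^ k) ≡ pow (lit 2) k
  ι-2^ k = trans (ι-^ 2 k) (cong (λ z → pow z k) (ι≡ℕtoℚ 2))

  -- With y = 1 + ν/2 the base is at most 1 + 2θν ≤ y^(4θ), and y^n ≤ 2. So nℓ pairs contribute at
  -- most 2^(4θℓ), independently of n.
  sparse-pow : ∀ n ν p → 0ℚ ≤ p → p ≤ 1ℚ → 0ℚ ≤ ν → ν ≤ 1ℚ → ι n * ν ≡ 1ℚ → p ≤ lit 2 * ν → ∀ θ ℓ c → c ℕ.≤ n ℕ.* ℓ →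
    pow (1ℚ - p + p * ι θ) c ≤ pow (lit 2) (4 ℕ.* (θ ℕ.* ℓ))
  sparse-pow n ν p 0≤p p≤1 0≤ν ν≤1 nν p≤ θ ℓ c c≤ = begin
      pow (1ℚ - p + p * ι θ) c
    ≤⟨ pow-mono-base c (0≤+ (0≤gap p≤1) (0≤* 0≤p (0≤ι θ))) base≤ ⟩
      pow (pow y (4 ℕ.* θ)) c
    ≤⟨ pow-monotone (1≤pow (4 ℕ.* θ) 1≤y) c≤ ⟩
      pow (pow y (4 ℕ.* θ)) (n ℕ.* ℓ)
    ≡⟨ pow-* y (4 ℕ.* θ) (n ℕ.* ℓ) ⟨
      pow y (4 ℕ.* θ ℕ.* (n ℕ.* ℓ))
    ≡⟨ cong (pow y) (l n θ ℓ) ⟩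
      pow y (n ℕ.* (4 ℕ.* (θ ℕ.* ℓ)))
    ≡⟨ pow-* y n (4 ℕ.* (θ ℕ.* ℓ)) ⟩
      pow (pow y n) (4 ℕ.* (θ ℕ.* ℓ))
    ≤⟨ pow-mono-base (4 ℕ.* (θ ℕ.* ℓ)) (0≤pow n (≤-trans 0≤1 1≤y)) (pow-doubles (½ * ν) n 0≤½ν ½nν ½ν≤1) ⟩
      pow (lit 2) (4 ℕ.* (θ ℕ.* ℓ)) ∎
    where
    open ≤-Reasoning
    l : ∀ n θ ℓ → 4 ℕ.* θ ℕ.* (n ℕ.* ℓ) ≡ n ℕ.* (4 ℕ.* (θ ℕ.* ℓ))
    l = ℕ-Solver.solve-∀
    0≤½ν : 0ℚ ≤ ½ * ν
    0≤½ν = 0≤* 0≤½ 0≤ν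
    ½ν≤1 : ½ * ν ≤ 1ℚ
    ½ν≤1 = ≤-by _ (0≤+ (0≤* 0≤½ (0≤gap ν≤1)) 0≤½) (l′ ν)
      where
      l′ : ∀ ν → 1ℚ ≡ ½ * ν + (½ * (1ℚ - ν) + ½)
      l′ = solve-∀ ℚ-ring
    ½nν : ι n * (½ * ν) ≤ ½
    ½nν = ≤-reflexive (trans (l′ (ι n) ν) (trans (cong (½ *_) nν) (*-identityʳ ½)))
      where
      l′ : ∀ n ν → n * (½ * ν) ≡ ½ * (n * ν)
      l′ = solve-∀ ℚ-ring
    y : ℚ
    y = 1ℚ + ½ * ν
    1≤y : 1ℚ ≤ y
    1≤y = ≤-by _ 0≤½ν refl
    base≤ : 1ℚ - p + p * ι θ ≤ pow y (4 ℕ.* θ)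
    base≤ = begin
        1ℚ - p + p * ι θ
      ≤⟨ ≤-by _ (0≤+ 0≤p (0≤* (0≤gap p≤) (0≤ι θ))) (l′ p ν (ι θ)) ⟩
        1ℚ + lit 4 * ι θ * (½ * ν)
      ≡⟨ cong (λ a → 1ℚ + a * (½ * ν)) (trans (ι-* 4 θ) (cong (_* ι θ) (ι≡ℕtoℚ 4))) ⟨
        1ℚ + ι (4 ℕ.* θ) * (½ * ν)
      ≤⟨ bernoulli (½ * ν) (4 ℕ.* θ) 0≤½ν ⟩
        pow y (4 ℕ.* θ) ∎
      where
      l′ : ∀ p ν θ → 1ℚ + lit 4 * θ * (½ * ν) ≡ (1ℚ - p + p * θ) + (p + (lit 2 * ν - p) * θ)
      l′ = solve-∀ ℚ-ring

  length-allColourings : ∀ n → length (allColourings n) ≡ 2 ℕ.^ n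
  length-allColourings zero    = refl
  length-allColourings (suc n) = trans (length-++ (map (true Data.Vec.∷_) (allColourings n)))
    (cong₂ ℕ._+_ (trans (length-map _ (allColourings n)) (length-allColourings n))
                 (trans (trans (length-map _ (allColourings n)) (length-allColourings n)) (sym (ℕₚ.+-identityʳ _))))
    where import Data.Vec

  n≤2^n : ∀ n → n ℕ.≤ 2 ℕ.^ n
  n≤2^n zero    = ℕ.z≤n
  n≤2^n (suc n) = ℕₚ.≤-trans (ℕ.s≤s (n≤2^n n)) (ℕₚ.≤-trans (ℕₚ.+-monoˡ-≤ (2 ℕ.^ n) (1≤2^ n)) (ℕₚ.≤-reflexive (cong (2 ℕ.^ n ℕ.+_) (sym (ℕₚ.+-identityʳ _)))))
    where
    1≤2^ : ∀ n → 1 ℕ.≤ 2 ℕ.^ n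
    1≤2^ n = ℕₚ.m^n>0 2 n

  -- Degrees are treated as one more family of edge tests, one for each vertex.
  star : ∀ {n} → Fin n → Fin n × Fin n → Bool
  star v e = ⌊ proj₁ e Finₚ.≟ v ⌋ ∨ ⌊ proj₂ e Finₚ.≟ v ⌋

  private
    δ : ∀ {n} → Fin n → Fin n → ℕ
    δ v u = bit ⌊ u Finₚ.≟ v ⌋

    δ-sum : ∀ {n} (v : Fin n) (f : Fin n → ℕ) us → Unique us → sumOver (λ u → δ v u ℕ.* f u) us ℕ.≤ f v
    δ-sum v f []       []        = ℕ.z≤n
    δ-sum v f (u ∷ us) (u∉ ∷ us!) with u Finₚ.≟ v
    ... | no _     = δ-sum v f us us!
    ... | yes refl = ℕₚ.≤-reflexive (trans (cong₂ ℕ._+_ (ℕₚ.+-identityʳ (f u)) (zeros us (λ w∈ w≡u → All.lookup u∉ w∈ (sym w≡u)))) (ℕₚ.+-identityʳ (f u)))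
      where
      zeros : ∀ ws → (∀ {w} → w ∈ ws → w ≢ u) → sumOver (λ w → δ u w ℕ.* f w) ws ≡ 0
      zeros []       h = refl
      zeros (w ∷ ws) h with w Finₚ.≟ u
      ... | yes w≡u = ⊥-elim (h (here refl) w≡u)
      ... | no _    = zeros ws (λ w∈ → h (there w∈))

    δ-self : ∀ {n} (v : Fin n) → δ v v ≡ 1
    δ-self v with v Finₚ.≟ v
    ... | yes _  = refl
    ... | no v≢v = ⊥-elim (v≢v refl)

    count-star : ∀ {n} (ω : Graph n) v → count (λ e → star v e ∧ ω e) (pairs n) ≡ sumOver (λ u → δ v u ℕ.* degree ω u) (allFin n)
    count-star {n} ω v = trans (sumOver-cong-∈ (pairs n) (λ e e∈ → at e (pairs-< n e∈))) (pairs-handshake (λ e → bit (ω e)) (δ v))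
      where
      sumOver-cong-∈ : ∀ {f g : Fin n × Fin n → ℕ} es → (∀ e → e ∈ es → f e ≡ g e) → sumOver f es ≡ sumOver g es
      sumOver-cong-∈ []       h = refl
      sumOver-cong-∈ (e ∷ es) h = cong₂ ℕ._+_ (h e (here refl)) (sumOver-cong-∈ es (λ e′ e′∈ → h e′ (there e′∈)))
      at : ∀ e → toℕ (proj₁ e) ℕ.< toℕ (proj₂ e) → bit (star v e ∧ ω e) ≡ bit (ω e) ℕ.* (δ v (proj₁ e) ℕ.+ δ v (proj₂ e))
      at (i , j) i<j with i Finₚ.≟ v | j Finₚ.≟ v
      ... | yes refl | yes refl = ⊥-elim (ℕₚ.<-irrefl refl i<j)
      ... | yes _    | no _     = sym (ℕₚ.*-identityʳ _)
      ... | no _     | yes _    = sym (ℕₚ.*-identityʳ _)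
      ... | no _     | no _     = sym (ℕₚ.*-zeroʳ (bit (ω (i , j))))

  degree-≤-star : ∀ {n} (ω : Graph n) v → degree ω v ℕ.≤ count (λ e → star v e ∧ ω e) (pairs n)
  degree-≤-star {n} ω v = ℕₚ.≤-trans (ℕₚ.≤-reflexive (trans (sym (ℕₚ.+-identityʳ _)) (cong (ℕ._* degree ω v) (sym (δ-self v)))))
    (ℕₚ.≤-trans (sumOver-∈ (λ u → δ v u ℕ.* degree ω u) (∈-allFin v)) (ℕₚ.≤-reflexive (sym (count-star ω v))))

  star-size : ∀ n (v : Fin n) → count (star v) (pairs n) ℕ.≤ n ℕ.* 1
  star-size n v = begin
      count (star v) (pairs n)                                  ≡⟨ sumOver-cong (λ e → cong bit (sym (∧-identityʳ (star v e)))) (pairs n) ⟩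
      count (λ e → star v e ∧ true) (pairs n)                   ≡⟨ count-star (λ _ → true) v ⟩
      sumOver (λ u → δ v u ℕ.* degree (λ _ → true) u) (allFin n) ≤⟨ δ-sum v (degree (λ _ → true)) (allFin n) (allFin⁺ n) ⟩
      degree (λ _ → true) v                                     ≤⟨ sumOver-≤-length 1 (entry≤1 v) (allFin n) ⟩
      length (allFin n) ℕ.* 1                                   ≡⟨ cong (ℕ._* 1) {length (allFin n)} {n} (length-tabulate (λ i → i)) ⟩
      n ℕ.* 1                                                   ∎
    where
    open ℕₚ.≤-Reasoning
    open import Data.Bool.Properties using (∧-identityʳ)
    entry≤1 : ∀ v w → entry {n} (λ _ → 1) v w ℕ.≤ 1
    entry≤1 v w with v Finₚ.≟ w
    ... | yes _ = ℕ.z≤n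
    ... | no _  = ℕₚ.≤-refl

-- The expected distance from below, by sprinkling.

module LowerBound where

  open import Defs using (pairs; npairs; allColourings; distBP)
  open Rationals
  open Powers
  open ListSums
  open VertexPairs
  open Concentration
  open Exploration
  open Distance
  open Reordering
  open GreedyColouring using (∈-keep⁻)
  open Tours
  open Blocks
  open RootCount
  open Tails
  open import Data.Bool using (Bool; true; false; _∧_; _∨_; T)
  open import Data.Nat as ℕ using (ℕ; _≤ᵇ_)
  import Data.Nat.Properties as ℕₚ
  open import Data.Fin using (Fin)
  open import Data.List using (List; []; _∷_; length; allFin)
  open import Data.List.Properties using (length-tabulate; map-cong)
  open import Data.List.Membership.Propositional using (_∈_)
  open import Data.List.Membership.Propositional.Properties using (∈-allFin)
  open import Data.List.Relation.Unary.Any using (here; there)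
  open import Data.List.Relation.Unary.Unique.Propositional using (Unique)
  open import Data.Vec using (Vec; lookup)
  open import Data.Product using (_×_; _,_; proj₁; proj₂)
  open import Data.Sum using (_⊎_; inj₁; inj₂)
  open import Data.Rational hiding (floor; _≤ᵇ_)
  open import Data.Rational.Properties
  open import Relation.Nullary using (¬_; yes; no)
  open import Relation.Binary.PropositionalEquality
  open import Tactic.RingSolver using (solve-∀)
  import Data.Nat.Tactic.RingSolver as ℕ-Solver

  <-≤-connex : ∀ a b → a < b ⊎ b ≤ a
  <-≤-connex a b with a <? b
  ... | yes a<b = inj₁ a<b
  ... | no a≮b  = inj₂ (≮⇒≥ a≮b)

  <⇒≱ : ∀ {a b} → a < b → ¬ b ≤ a
  <⇒≱ a<b b≤a = <-irrefl refl (<-≤-trans a<b b≤a)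

  mono-∪ : ∀ {n} (σ : Fin n → Bool) (ω ω′ : Graph n) → (mono σ ω ℕ.≤ mono σ (ω ∪ ω′)) × (mono σ ω′ ℕ.≤ mono σ (ω ∪ ω′))
  mono-∪ {n} σ ω ω′ = sumOver-mono (pairs n) (λ e _ → left (σ (proj₁ e) ≈ᵇ σ (proj₂ e)) (ω e) (ω′ e)) ,
                      sumOver-mono (pairs n) (λ e _ → right (σ (proj₁ e) ≈ᵇ σ (proj₂ e)) (ω e) (ω′ e))
    where
    left : ∀ a b c → bit (a ∧ b) ℕ.≤ bit (a ∧ (b ∨ c))
    left false _     _ = ℕ.z≤n
    left true  true  _ = ℕₚ.≤-refl
    left true  false _ = ℕ.z≤n
    right : ∀ a b c → bit (a ∧ c) ℕ.≤ bit (a ∧ (b ∨ c))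
    right false _     _ = ℕ.z≤n
    right true  true  c = bit≤1 c
    right true  false _ = ℕₚ.≤-refl

  distance-ext : ∀ {n} {ω ω′ : Graph n} → (∀ e → ω e ≡ ω′ e) → distance ω ≡ distance ω′
  distance-ext {n} h = cong (distBP n) (map-cong h (pairs n))

  tests-exceed : ∀ {n} {A : Set} {θ c} (q : A → Fin n × Fin n → Bool) {t ts} (ω : Graph n) k → 0ℚ ≤ θ → 0ℚ ≤ c → 1ℚ ≤ c * pow θ k → t ∈ ts →
                 pow θ k ≤ pow θ (count (λ e → q t e ∧ ω e) (pairs n)) → 1ℚ ≤ c * tests θ q ts ω
  tests-exceed {n} q ω k 0≤θ 0≤c 1≤ t∈ k≤ = ≤-trans 1≤ (*-monoˡ 0≤c (≤-trans k≤ (sumℚ-∈ (λ t → 0≤pow (count (λ e → q t e ∧ ω e) (pairs n)) 0≤θ) t∈)))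

  0≤tests : ∀ {n} {A : Set} {θ} (q : A → Fin n × Fin n → Bool) ts (ω : Graph n) → 0ℚ ≤ θ → 0ℚ ≤ tests θ q ts ω
  0≤tests {n} q ts ω 0≤θ = 0≤sumℚ (λ t → 0≤pow (count (λ e → q t e ∧ ω e) (pairs n)) 0≤θ) ts

  2-powers-exceed : ∀ {a b} → a ℕ.≤ b → 1ℚ ≤ pow ½ a * pow (lit 2) b
  2-powers-exceed {a} {b} a≤b = subst (_≤ pow ½ a * pow (lit 2) b) (pow-½-2 a) (*-monoˡ (0≤pow a 0≤½) (pow-monotone 1≤2 a≤b))
    where
    1≤2 : 1ℚ ≤ lit 2
    1≤2 = ≤-by 1ℚ 0≤1 refl

  -- ω₁ ∪ ω₂ is sampled with densities p₁ and p₂. The parameter x is the claimed order of the distance, Y the size of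
  -- the forest found in ω₁, cut into r blocks of K vertices, and 4Δ the length below which a back edge counts as short.
  module Sprinkling
    (n x K r H Y u₀ R₀ j Δ i i′ : ℕ) (p₁ p₂ ν z N w : ℚ)
    (0≤p₁ : 0ℚ ≤ p₁) (p₁≤1 : p₁ ≤ 1ℚ) (0≤p₂ : 0ℚ ≤ p₂) (p₂≤1 : p₂ ≤ 1ℚ)
    (0≤p : 0ℚ ≤ p₁ + p₂ - p₁ * p₂) (p≤1 : p₁ + p₂ - p₁ * p₂ ≤ 1ℚ)
    (0≤ν : 0ℚ ≤ ν) (ν≤1 : ν ≤ 1ℚ) (nν : ι n * ν ≡ 1ℚ) (p≤2ν : p₁ + p₂ - p₁ * p₂ ≤ lit 2 * ν)
    (0≤z : 0ℚ ≤ z) (z≤1 : z ≤ 1ℚ) (0≤N : 0ℚ ≤ N) (Nz : N * z ≡ 1ℚ) (drift : 1ℚ ≤ ι u₀ * p₁ * (1ℚ - z))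
    (0≤w : 0ℚ ≤ w) (wR₀ : w * ι R₀ ≡ 1ℚ) (wN : w * N ≤ eighth)
    (Y+u₀≤n : Y ℕ.+ u₀ ℕ.≤ n) (2Y≤rK : 2 ℕ.* Y ℕ.≤ r ℕ.* K) (4≤H : 4 ℕ.≤ H) (room : H ℕ.+ K ℕ.* (R₀ ℕ.+ 2 ℕ.* (4 ℕ.* x)) ℕ.≤ Y)
    (sprinkle : ∀ c → H ℕ.* H ℕ.≤ 8 ℕ.* c → pow (1ℚ - p₂ + p₂ * ½) c ≤ pow ½ j) (codes≤j : 4 ℕ.* x ℕ.+ 2 ℕ.* r ℕ.+ 3 ℕ.≤ j)
    (1≤Δ : 1 ℕ.≤ Δ) (x≤npairs : x ℕ.≤ npairs n)
    (n≤ix : n ℕ.≤ i ℕ.* x) (tail≤ : 4 ℕ.* (2 ℕ.^ i ℕ.* (4 ℕ.* Δ)) ℕ.+ 3 ℕ.≤ n)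
    (2n≤i′Δ : 2 ℕ.* n ℕ.≤ i′ ℕ.* Δ) (tail′≤ : 4 ℕ.* (2 ℕ.^ i′ ℕ.* 1) ℕ.+ 3 ℕ.≤ n) where

    open Search 0 (λ u → bit (u₀ ≤ᵇ u))

    private
      p X : ℚ
      p = p₁ + p₂ - p₁ * p₂
      X = ι x

      L θ θ′ : ℕ
      L = 4 ℕ.* Δ
      θ = 2 ℕ.^ i
      θ′ = 2 ℕ.^ i′

      none : Graph n
      none _ = false

      shortTest : Vec Bool n → Fin n × Fin n → Bool
      shortTest col = isShort L (lookup col)

      roots : Graph n → ℕ
      roots ω = run n ω [] (allFin n)

      -- Zˢ is at least 1 if some colouring has too many short edges, Zᵈ if some degree is too large (and Z² below if
      -- some code has too few edges of ω₂ between vertices of equal colour); each has mean at most 1/8.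
      F Zˢ Zᵈ F′ : Graph n → ℚ
      F ω = ι (distance ω)
      Zˢ ω = pow ½ (2 ℕ.* n) * tests (ι θ) shortTest (allColourings n) ω
      Zᵈ ω = pow ½ (2 ℕ.* n) * tests (ι θ′) star (allFin n) ω
      F′ ω = F ω + X * (Zˢ ω + Zᵈ ω)

      0≤X : 0ℚ ≤ X
      0≤X = 0≤ι x

      0≤c : 0ℚ ≤ pow ½ (2 ℕ.* n)
      0≤c = 0≤pow (2 ℕ.* n) 0≤½

      0≤Zˢ : ∀ ω → 0ℚ ≤ Zˢ ω
      0≤Zˢ ω = 0≤* 0≤c (0≤tests shortTest (allColourings n) ω (0≤ι θ))

      0≤Zᵈ : ∀ ω → 0ℚ ≤ Zᵈ ω
      0≤Zᵈ ω = 0≤* 0≤c (0≤tests star (allFin n) ω (0≤ι θ′))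

      0≤F′ : ∀ ω → 0ℚ ≤ F′ ω
      0≤F′ ω = 0≤+ (0≤ι (distance ω)) (0≤* 0≤X (0≤+ (0≤Zˢ ω) (0≤Zᵈ ω)))

      F′-ext : Extensional F′
      F′-ext h = cong₂ (λ d s → ι d + X * s) (distance-ext h)
        (cong₂ (λ a b → pow ½ (2 ℕ.* n) * a + pow ½ (2 ℕ.* n) * b) (tests-ext (ι θ) shortTest (allColourings n) h) (tests-ext (ι θ′) star (allFin n) h))

      -- At most 2ⁿ tests with moment at most 2^(4tℓ) each: the factor 2^(-2n) leaves 2^(4tℓ - n),
      -- and `fits` provides the spare 3 in the exponent.
      𝔼-tail : ∀ {A : Set} t (q : A → Fin n × Fin n → Bool) ts ℓ → (∀ a → count (q a) (pairs n) ℕ.≤ n ℕ.* ℓ) → length ts ℕ.≤ 2 ℕ.^ n →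
               4 ℕ.* (t ℕ.* ℓ) ℕ.+ 3 ℕ.≤ n → 𝔼ₖ p (pairs n) (λ ω → pow ½ (2 ℕ.* n) * tests (ι t) q ts ω) none ≤ eighth
      𝔼-tail t q ts ℓ small ts≤ fits = begin
          𝔼ₖ p (pairs n) (λ ω → c * tests (ι t) q ts ω) none
        ≡⟨ 𝔼ₖ-* p (pairs n) c (tests (ι t) q ts) none ⟩
          c * 𝔼ₖ p (pairs n) (tests (ι t) q ts) none
        ≤⟨ *-monoˡ 0≤c (𝔼ₖ-tests p (ι t) q B ts (λ a _ → sparse-pow n ν p 0≤p p≤1 0≤ν ν≤1 nν p≤2ν t ℓ (count (q a) (pairs n)) (small a)) none) ⟩
          c * (ι (length ts) * B)
        ≤⟨ *-monoˡ 0≤c (*-monoʳ (0≤pow (4 ℕ.* (t ℕ.* ℓ)) (0≤lit 2)) (≤-trans (ι-mono ts≤) (≤-reflexive (ι-2^ n)))) ⟩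
          c * (pow (lit 2) n * B)
        ≡⟨ trans (*-comm c _) (cong (_* c) (sym (pow-+ (lit 2) n (4 ℕ.* (t ℕ.* ℓ))))) ⟩
          pow (lit 2) (n ℕ.+ 4 ℕ.* (t ℕ.* ℓ)) * c
        ≤⟨ 2-powers-cancel {n ℕ.+ 4 ℕ.* (t ℕ.* ℓ)} {2 ℕ.* n} (ℕₚ.≤-trans (ℕₚ.≤-reflexive (ℕₚ.+-assoc n _ 3)) (ℕₚ.≤-trans (ℕₚ.+-monoʳ-≤ n fits) (ℕₚ.≤-reflexive (cong (n ℕ.+_) (sym (ℕₚ.+-identityʳ n)))))) ⟩
          eighth ∎
        where
        open ≤-Reasoning
        c B : ℚ
        c = pow ½ (2 ℕ.* n)
        B = pow (lit 2) (4 ℕ.* (t ℕ.* ℓ))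

      𝔼Zˢ : 𝔼ₖ p (pairs n) Zˢ none ≤ eighth
      𝔼Zˢ = 𝔼-tail θ shortTest (allColourings n) L (λ col → count-short n L (lookup col)) (ℕₚ.≤-reflexive (length-allColourings n)) tail≤

      𝔼Zᵈ : 𝔼ₖ p (pairs n) Zᵈ none ≤ eighth
      𝔼Zᵈ = 𝔼-tail θ′ star (allFin n) 1 (star-size n) (ℕₚ.≤-trans (ℕₚ.≤-reflexive (length-tabulate (λ i → i))) (n≤2^n n)) tail′≤

      1≤ι2^ : ∀ k → 1ℚ ≤ ι (2 ℕ.^ k)
      1≤ι2^ k = subst (_≤ ι (2 ℕ.^ k)) ι-1 (ι-mono (ℕₚ.m^n>0 2 k))

      pow-ι2^ : ∀ k l → pow (ι (2 ℕ.^ k)) l ≡ pow (lit 2) (k ℕ.* l)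
      pow-ι2^ k l = trans (cong (λ y → pow y l) (ι-2^ k)) (sym (pow-* (lit 2) k l))

      -- A colouring with 2x short edges would contribute θ^(2x) = 2^(2ix), and ix ≥ n makes this
      -- outweigh the factor 2^(-2n).
      short-< : ∀ T col → Zˢ T < 1ℚ → short L (lookup col) T ℕ.< 2 ℕ.* x
      short-< T col Z<1 = ℕₚ.≰⇒> λ 2x≤ → <⇒≱ Z<1 (tests-exceed shortTest T (2 ℕ.* x) (0≤ι θ) 0≤c
        (subst (λ y → 1ℚ ≤ pow ½ (2 ℕ.* n) * y) (sym (pow-ι2^ i (2 ℕ.* x))) (2-powers-exceed {2 ℕ.* n} {i ℕ.* (2 ℕ.* x)} 2n≤))
        (allColourings-complete col) (pow-monotone (1≤ι2^ i) 2x≤))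
        where
        2n≤ : 2 ℕ.* n ℕ.≤ i ℕ.* (2 ℕ.* x)
        2n≤ = ℕₚ.≤-trans (ℕₚ.*-monoʳ-≤ 2 n≤ix) (ℕₚ.≤-reflexive (l i x))
          where
          l : ∀ i x → 2 ℕ.* (i ℕ.* x) ≡ i ℕ.* (2 ℕ.* x)
          l = ℕ-Solver.solve-∀

      degree-< : ∀ T v → Zᵈ T < 1ℚ → degree T v ℕ.< Δ
      degree-< T v Z<1 = ℕₚ.≰⇒> λ Δ≤ → <⇒≱ Z<1 (tests-exceed star T Δ (0≤ι θ′) 0≤c
        (subst (λ y → 1ℚ ≤ pow ½ (2 ℕ.* n) * y) (sym (pow-ι2^ i′ Δ)) (2-powers-exceed 2n≤i′Δ))
        (∈-allFin v) (pow-monotone (1≤ι2^ i′) (ℕₚ.≤-trans Δ≤ (degree-≤-star T v))))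

    module _ (ω₁ : Graph n) (D W : List (Fin n)) (R′ : ℕ) (tour : Tour ω₁ R′ D W) (R′≤R₀ : R′ ℕ.≤ R₀) (|D| : length D ≡ Y) (D! : Unique D) where

      private
        Bs : List (List (Fin n))
        Bs = blocks K r W

        agreeTest : Code → Fin n × Fin n → Bool
        agreeTest code = agrees (paint Bs code)

        big : Code → Bool
        big code = H ℕ.* H ≤ᵇ 8 ℕ.* count (agreeTest code) (pairs n)

        -- Only codes with at least H²/8 agreeing pairs are tested; by `agrees-many` the code of a
        -- colouring with few monochromatic edges is among them.
        codes : List Code
        codes = keep big (allCodes r)

        Z² : Graph n → ℚ
        Z² ω = pow (lit 2) (4 ℕ.* x) * tests ½ agreeTest codes ω

        W≤ : length W ℕ.≤ r ℕ.* K
        W≤ = ℕₚ.≤-trans (tour-length tour) (ℕₚ.≤-trans (ℕₚ.≤-reflexive (cong (2 ℕ.*_) |D|)) 2Y≤rK)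

        0≤Z² : ∀ ω → 0ℚ ≤ Z² ω
        0≤Z² ω = 0≤* (0≤pow (4 ℕ.* x) (0≤lit 2)) (0≤tests agreeTest codes ω 0≤½)

        -- At most 2^(2r) codes have moment at most 2^(-j) each, and `codes≤j` leaves 1/8 after the
        -- factor 2^(4x).
        𝔼Z² : 𝔼ₖ p₂ (pairs n) Z² none ≤ eighth
        𝔼Z² = begin
            𝔼ₖ p₂ (pairs n) Z² none
          ≡⟨ 𝔼ₖ-* p₂ (pairs n) c (tests ½ agreeTest codes) none ⟩
            c * 𝔼ₖ p₂ (pairs n) (tests ½ agreeTest codes) none
          ≤⟨ *-monoˡ 0≤c₂ (𝔼ₖ-tests p₂ ½ agreeTest (pow ½ j) codes
               (λ code code∈ → sprinkle (count (agreeTest code) (pairs n)) (ℕₚ.≤ᵇ⇒≤ _ _ (subst T (sym (proj₂ (∈-keep⁻ big (allCodes r) code∈))) _))) none) ⟩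
            c * (ι (length codes) * pow ½ j)
          ≤⟨ *-monoˡ 0≤c₂ (*-monoʳ (0≤pow j 0≤½) (≤-trans (ι-mono |codes|) (≤-reflexive (ι-2^ (2 ℕ.* r))))) ⟩
            c * (pow (lit 2) (2 ℕ.* r) * pow ½ j)
          ≡⟨ trans (sym (*-assoc c _ _)) (cong (_* pow ½ j) (sym (pow-+ (lit 2) (4 ℕ.* x) (2 ℕ.* r)))) ⟩
            pow (lit 2) (4 ℕ.* x ℕ.+ 2 ℕ.* r) * pow ½ j
          ≤⟨ 2-powers-cancel {4 ℕ.* x ℕ.+ 2 ℕ.* r} {j} codes≤j ⟩
            eighth ∎
          where
          open ≤-Reasoning
          c : ℚ
          c = pow (lit 2) (4 ℕ.* x)
          0≤c₂ : 0ℚ ≤ c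
          0≤c₂ = 0≤pow (4 ℕ.* x) (0≤lit 2)
          |codes| : length codes ℕ.≤ 2 ℕ.^ (2 ℕ.* r)
          |codes| = ℕₚ.≤-trans (ℕₚ.≤-reflexive (length-keep big (allCodes r))) (ℕₚ.≤-trans (count≤length big (allCodes r)) (length-allCodes r))

        -- Suppose there are fewer than 4x monochromatic edges. Those in ω₁ break few blocks, so the
        -- code is tested; those in ω₂ include all its edges on agreeing pairs, so this code alone
        -- makes `Z²` at least 1.
        many-mono : ∀ ω₂ (σ : Fin n → Bool) → Z² ω₂ < 1ℚ → 4 ℕ.* x ℕ.≤ mono σ (ω₁ ∪ ω₂)
        many-mono ω₂ σ Z<1 = ℕₚ.≮⇒≥ λ few → <⇒≱ Z<1 (tests-exceed agreeTest ω₂ (4 ℕ.* x) 0≤½ (0≤pow (4 ℕ.* x) (0≤lit 2))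
            (≤-reflexive (sym (trans (*-comm (pow (lit 2) (4 ℕ.* x)) _) (pow-½-2 (4 ℕ.* x)))))
            (code∈ few)
            (pow-antitone 0≤½ (≤-by ½ 0≤½ refl) (ℕₚ.≤-trans (agrees-mono σ K r W D D! (tour-⊇ {n} {ω₁} tour) W≤ ω₂)
               (ℕₚ.≤-trans (proj₂ (mono-∪ σ ω₁ ω₂)) (ℕₚ.<⇒≤ few)))))
          where
          code : Code
          code = codeOf σ Bs
          ∈-keep⁺ : ∀ {A : Set} (q : A → Bool) {xs a} → a ∈ xs → q a ≡ true → a ∈ keep q xs
          ∈-keep⁺ q {y ∷ _} (here refl) qa rewrite qa = here refl
          ∈-keep⁺ q {y ∷ _} (there a∈)  qa with q y
          ... | true  = there (∈-keep⁺ q a∈ qa)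
          ... | false = ∈-keep⁺ q a∈ qa
          T⇒≡ : ∀ {b} → T b → b ≡ true
          T⇒≡ {true} _ = refl
          module _ (few : mono σ (ω₁ ∪ ω₂) ℕ.< 4 ℕ.* x) where
            steps≤ : monoSteps σ W ℕ.≤ R₀ ℕ.+ 2 ℕ.* (4 ℕ.* x)
            steps≤ = ℕₚ.≤-trans (tour-monoSteps σ tour) (ℕₚ.+-mono-≤ R′≤R₀ (ℕₚ.*-monoʳ-≤ 2
              (ℕₚ.≤-trans (sumOver-⊆ _ (pairsOf-unique D!) (λ e∈ → subst (λ es → _ ∈ es) (sym (pairs-pairsOf n)) (pairsOf-⊆ D! (λ {y} _ → ∈-allFin y) e∈)))
                 (ℕₚ.≤-trans (proj₁ (mono-∪ σ ω₁ ω₂)) (ℕₚ.<⇒≤ few)))))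
            code∈ : code ∈ codes
            code∈ = ∈-keep⁺ big (codeOf-∈ σ K r W) (T⇒≡ (ℕₚ.≤⇒≤ᵇ (agrees-many σ K r W D D! (tour-⊇ {n} {ω₁} tour) W≤ H 4≤H
              (ℕₚ.≤-trans (ℕₚ.+-monoʳ-≤ H (ℕₚ.*-monoʳ-≤ K steps≤)) (ℕₚ.≤-trans room (ℕₚ.≤-reflexive (sym |D|)))))))

        -- If d pairs are reversed, then 4x ≤ mono ≤ 2d + short ≤ 2d + 2x, hence d ≥ x.
        far : ∀ ω₂ → Z² ω₂ < 1ℚ → Zˢ (ω₁ ∪ ω₂) < 1ℚ → Zᵈ (ω₁ ∪ ω₂) < 1ℚ → x ℕ.≤ distance (ω₁ ∪ ω₂)
        far ω₂ Z²<1 Zˢ<1 Zᵈ<1 = distance-≥ G x≤npairs λ ω′ col tr →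
            let d = count (differ G ω′) (pairs n) in
            ℕₚ.*-cancelˡ-≤ 2 (ℕₚ.+-cancelʳ-≤ (2 ℕ.* x) (2 ℕ.* x) (2 ℕ.* d) (begin
              2 ℕ.* x ℕ.+ 2 ℕ.* x              ≡⟨ l x ⟩
              4 ℕ.* x                          ≤⟨ many-mono ω₂ (lookup col) Z²<1 ⟩
              mono (lookup col) G              ≤⟨ mono-≤-reversals G ω′ (lookup col) tr L 1≤L (λ v → ℕₚ.*-monoʳ-≤ 4 (ℕₚ.<⇒≤ (degree-< G v Zᵈ<1))) ⟩
              2 ℕ.* d ℕ.+ short L (lookup col) G ≤⟨ ℕₚ.+-monoʳ-≤ (2 ℕ.* d) (ℕₚ.<⇒≤ (short-< G col Zˢ<1)) ⟩
              2 ℕ.* d ℕ.+ 2 ℕ.* x              ∎))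
          where
          open ℕₚ.≤-Reasoning
          G : Graph n
          G = ω₁ ∪ ω₂
          l : ∀ x → 2 ℕ.* x ℕ.+ 2 ℕ.* x ≡ 4 ℕ.* x
          l = ℕ-Solver.solve-∀
          1≤L : 1 ℕ.≤ L
          1≤L = ℕₚ.≤-trans 1≤Δ (ℕₚ.m≤n*m Δ 4)

        -- If some Z is at least 1, its own term covers X; otherwise the distance does.
        pointwise : ∀ ω₂ → X ≤ F′ (ω₁ ∪ ω₂) + X * Z² ω₂
        pointwise ω₂ with <-≤-connex (Z² ω₂) 1ℚ | <-≤-connex (Zˢ G) 1ℚ | <-≤-connex (Zᵈ G) 1ℚ
          where G = ω₁ ∪ ω₂
        ... | inj₂ 1≤Z | _        | _        = ≤-by _ (0≤+ (0≤F′ (ω₁ ∪ ω₂)) (0≤* 0≤X (0≤gap 1≤Z))) (l X (F′ (ω₁ ∪ ω₂)) (Z² ω₂))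
          where
          l : ∀ X f Z → f + X * Z ≡ X + (f + X * (Z - 1ℚ))
          l = solve-∀ ℚ-ring
        ... | inj₁ _   | inj₂ 1≤Z | _        = ≤-by _ (0≤+ (0≤+ (0≤ι (distance (ω₁ ∪ ω₂))) (0≤* 0≤X (0≤Z² ω₂))) (0≤* 0≤X (0≤+ (0≤gap 1≤Z) (0≤Zᵈ (ω₁ ∪ ω₂)))))
                                                    (l X (F (ω₁ ∪ ω₂)) (Zˢ (ω₁ ∪ ω₂)) (Zᵈ (ω₁ ∪ ω₂)) (Z² ω₂))
          where
          l : ∀ X f a b Z → f + X * (a + b) + X * Z ≡ X + (f + X * Z + X * ((a - 1ℚ) + b))
          l = solve-∀ ℚ-ring
        ... | inj₁ _   | inj₁ _   | inj₂ 1≤Z = ≤-by _ (0≤+ (0≤+ (0≤ι (distance (ω₁ ∪ ω₂))) (0≤* 0≤X (0≤Z² ω₂))) (0≤* 0≤X (0≤+ (0≤Zˢ (ω₁ ∪ ω₂)) (0≤gap 1≤Z))))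
                                                    (l X (F (ω₁ ∪ ω₂)) (Zˢ (ω₁ ∪ ω₂)) (Zᵈ (ω₁ ∪ ω₂)) (Z² ω₂))
          where
          l : ∀ X f a b Z → f + X * (a + b) + X * Z ≡ X + (f + X * Z + X * (a + (b - 1ℚ)))
          l = solve-∀ ℚ-ring
        ... | inj₁ a   | inj₁ b   | inj₁ c   = ≤-by _ (0≤+ (0≤gap (ι-mono (far ω₂ a b c))) (0≤+ (0≤* 0≤X (0≤+ (0≤Zˢ (ω₁ ∪ ω₂)) (0≤Zᵈ (ω₁ ∪ ω₂)))) (0≤* 0≤X (0≤Z² ω₂))))
                                                    (l X (F (ω₁ ∪ ω₂)) (X * (Zˢ (ω₁ ∪ ω₂) + Zᵈ (ω₁ ∪ ω₂))) (X * Z² ω₂))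
          where
          l : ∀ X f a b → f + a + b ≡ X + ((f - X) + (a + b))
          l = solve-∀ ℚ-ring

      conditional : X * (1ℚ - eighth) ≤ 𝔼ₖ p₂ (pairs n) (λ ω₂ → F′ (ω₁ ∪ ω₂)) none
      conditional = ≤-by _ (0≤+ (0≤gap total) (0≤* 0≤X (0≤gap 𝔼Z²))) (l X E (𝔼ₖ p₂ (pairs n) Z² none) eighth)
        where
        E : ℚ
        E = 𝔼ₖ p₂ (pairs n) (λ ω₂ → F′ (ω₁ ∪ ω₂)) none
        l : ∀ X E Z e → E ≡ X * (1ℚ - e) + ((E + X * Z - X) + X * (e - Z))
        l = solve-∀ ℚ-ring
        total : X ≤ E + X * 𝔼ₖ p₂ (pairs n) Z² none
        total = begin
            X
          ≡⟨ 𝔼-const p₂ (length (pairs n)) X ⟨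
            𝔼ₖ p₂ (pairs n) (λ _ → X) none
          ≤⟨ 𝔼ₖ-mono p₂ 0≤p₂ p₂≤1 (pairs n) none (λ ω₂ _ → pointwise ω₂) ⟩
            𝔼ₖ p₂ (pairs n) (λ ω₂ → F′ (ω₁ ∪ ω₂) + X * Z² ω₂) none
          ≡⟨ trans (𝔼ₖ-+ p₂ (pairs n) (λ ω₂ → F′ (ω₁ ∪ ω₂)) (λ ω₂ → X * Z² ω₂) none) (cong (E +_) (𝔼ₖ-* p₂ (pairs n) X Z² none)) ⟩
            E + X * 𝔼ₖ p₂ (pairs n) Z² none ∎
          where open ≤-Reasoning

    private
      -- Since w = 1/R₀, the subtracted term is at least X once there are R₀ roots, and the left
      -- side is negative or zero. With fewer roots the forest exists and `conditional` applies.
      per-ω₁ : ∀ ω₁ → X * (1ℚ - eighth) + (- (X * w)) * ι (roots ω₁) ≤ 𝔼ₖ p₂ (pairs n) (λ ω₂ → F′ (ω₁ ∪ ω₂)) none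
      per-ω₁ ω₁ with ℕₚ.≤-total (roots ω₁) R₀
      ... | inj₂ R₀≤ = ≤-trans nonpositive
          (subst (_≤ 𝔼ₖ p₂ (pairs n) (λ ω₂ → F′ (ω₁ ∪ ω₂)) none) (𝔼-const p₂ (length (pairs n)) 0ℚ)
                 (𝔼ₖ-mono p₂ 0≤p₂ p₂≤1 (pairs n) none (λ ω₂ _ → 0≤F′ (ω₁ ∪ ω₂))))
        where
        l : ∀ X w e r → 0ℚ ≡ (X * (1ℚ - e) + (- (X * w)) * r) + X * ((w * r - 1ℚ) + e)
        l = solve-∀ ℚ-ring
        nonpositive : X * (1ℚ - eighth) + (- (X * w)) * ι (roots ω₁) ≤ 0ℚ
        nonpositive = ≤-by _ (0≤* 0≤X (0≤+ (0≤gap (subst (_≤ w * ι (roots ω₁)) wR₀ (*-monoˡ 0≤w (ι-mono R₀≤)))) (0≤* 0≤½ (0≤* 0≤½ 0≤½))))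
                             (l X w eighth (ι (roots ω₁)))
      ... | inj₁ ≤R₀ with tour-exists ω₁ u₀ Y Y+u₀≤n
      ...   | R′ , D , W , tour , R′≤ , |D| , D! =
        ≤-trans (≤-by _ (0≤* (0≤* 0≤X 0≤w) (0≤ι (roots ω₁))) (l (X * (1ℚ - eighth)) (X * w) (ι (roots ω₁))))
                (conditional ω₁ D W R′ tour (ℕₚ.≤-trans R′≤ ≤R₀) |D| D!)
        where
        l : ∀ a b r → a ≡ (a + (- b) * r) + b * r
        l = solve-∀ ℚ-ring

    -- Four failures cost X/8 each: the codes inside `conditional`, the roots through w, short edges
    -- and degrees inside `F′`.
    𝔼-distance-≥ : X * ½ ≤ 𝔼ₖ p (pairs n) F none
    𝔼-distance-≥ = ≤-by _ (0≤+ (0≤gap all) (0≤* 0≤X (0≤+ (0≤gap wroots) (0≤+ (0≤gap 𝔼Zˢ) (0≤gap 𝔼Zᵈ)))))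
        (l X (𝔼ₖ p (pairs n) F none) (𝔼ₖ p (pairs n) Zˢ none) (𝔼ₖ p (pairs n) Zᵈ none) w M)
      where
      M : ℚ
      M = 𝔼ₖ p₁ (pairs n) (λ ω → ι (roots ω)) none
      open Roots n u₀ p₁ z N 0≤p₁ p₁≤1 0≤z z≤1 0≤N Nz drift using (𝔼-roots-≤)
      wroots : w * M ≤ eighth
      wroots = ≤-trans (*-monoˡ 0≤w (𝔼-roots-≤ none)) wN
      all : X * (1ℚ - eighth) + (- (X * w)) * M ≤ 𝔼ₖ p (pairs n) F none + X * (𝔼ₖ p (pairs n) Zˢ none + 𝔼ₖ p (pairs n) Zᵈ none)
      all = begin
          X * (1ℚ - eighth) + (- (X * w)) * M
        ≡⟨ trans (𝔼ₖ-+ p₁ (pairs n) (λ _ → X * (1ℚ - eighth)) (λ ω → (- (X * w)) * ι (roots ω)) none)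
                 (cong₂ _+_ (𝔼-const p₁ (length (pairs n)) (X * (1ℚ - eighth))) (𝔼ₖ-* p₁ (pairs n) (- (X * w)) (λ ω → ι (roots ω)) none)) ⟨
          𝔼ₖ p₁ (pairs n) (λ ω₁ → X * (1ℚ - eighth) + (- (X * w)) * ι (roots ω₁)) none
        ≤⟨ 𝔼ₖ-mono p₁ 0≤p₁ p₁≤1 (pairs n) none (λ ω₁ _ → per-ω₁ ω₁) ⟩
          𝔼ₖ p₁ (pairs n) (λ ω₁ → 𝔼ₖ p₂ (pairs n) (λ ω₂ → F′ (ω₁ ∪ ω₂)) none) none
        ≡⟨ 𝔼ₖ-∪ p₁ p₂ (pairs n) F′-ext none none ⟨
          𝔼ₖ p (pairs n) F′ none
        ≡⟨ trans (𝔼ₖ-+ p (pairs n) F (λ ω → X * (Zˢ ω + Zᵈ ω)) none)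
                 (cong (𝔼ₖ p (pairs n) F none +_) (trans (𝔼ₖ-* p (pairs n) X (λ ω → Zˢ ω + Zᵈ ω) none) (cong (X *_) (𝔼ₖ-+ p (pairs n) Zˢ Zᵈ none)))) ⟩
          𝔼ₖ p (pairs n) F none + X * (𝔼ₖ p (pairs n) Zˢ none + 𝔼ₖ p (pairs n) Zᵈ none) ∎
        where open ≤-Reasoning
      l : ∀ X f a b w M → f ≡ X * ½ + ((f + X * (a + b) - (X * (1ℚ - eighth) + (- (X * w)) * M)) + X * ((eighth - w * M) + ((eighth - a) + (eighth - b))))
      l = solve-∀ ℚ-ring

-- Choice of parameters for fixed ε and large n.

module Asymptotics where

  open import Defs using (pairs; npairs; inv)
  open Rationals
  open Powers
  open VertexPairs
  open Concentration
  open Exploration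
  open Distance
  open Tails using (eighth)
  open UpperBound
  open LowerBound
  open import Data.Nat as ℕ using (ℕ; zero; suc; _∸_)
  import Data.Nat.Properties as ℕₚ
  import Data.Nat.DivMod as DivMod
  open import Data.Bool using (false)
  open import Data.Fin as Fin using (Fin)
  open import Data.List using (List; []; _∷_; _++_; map; tabulate; length; allFin)
  open import Data.List.Properties using (length-++; length-map; length-tabulate)
  open import Data.Product using (_,_)
  open import Data.Rational hiding (floor)
  open import Data.Rational.Properties
  open import Relation.Binary.PropositionalEquality
  open import Tactic.RingSolver using (solve-∀)
  import Data.Nat.Tactic.RingSolver as ℕ-Solver

  length-pairsOf-≤ : ∀ {n} (vs : List (Fin n)) → length (pairsOf vs) ℕ.≤ length vs ℕ.* length vs
  length-pairsOf-≤ []       = ℕ.z≤n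
  length-pairsOf-≤ (v ∷ vs) = begin
      length (map (key v) vs ++ pairsOf vs) ≡⟨ trans (length-++ (map (key v) vs)) (cong (ℕ._+ length (pairsOf vs)) (length-map (key v) vs)) ⟩
      l ℕ.+ length (pairsOf vs)                       ≤⟨ ℕₚ.+-monoʳ-≤ l (length-pairsOf-≤ vs) ⟩
      l ℕ.+ l ℕ.* l                                   ≤⟨ ℕₚ.m≤m+n _ (suc l) ⟩
      l ℕ.+ l ℕ.* l ℕ.+ suc l                         ≡⟨ lem l ⟩
      suc l ℕ.* suc l                                 ∎
    where
    open ℕₚ.≤-Reasoning
    l : ℕ
    l = length vs
    lem : ∀ l → l ℕ.+ l ℕ.* l ℕ.+ suc l ≡ suc l ℕ.* suc l
    lem = ℕ-Solver.solve-∀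

  npairs-≤ : ∀ n → npairs n ℕ.≤ n ℕ.* n
  npairs-≤ n = subst₂ (λ a b → a ℕ.≤ b ℕ.* b) (cong length (sym (pairs-pairsOf n))) (length-tabulate {n = n} (λ i → i)) (length-pairsOf-≤ (allFin n))

  npairs-≥ : ∀ n → n ∸ 1 ℕ.≤ npairs n
  npairs-≥ zero    = ℕ.z≤n
  npairs-≥ (suc n) = subst (n ℕ.≤_) (sym (trans (cong length (pairs-pairsOf (suc n))) (trans (length-++ (map (key Fin.zero) vs)) (cong (ℕ._+ length (pairsOf vs)) (trans (length-map (key Fin.zero) vs) (length-tabulate Fin.suc))))))
      (ℕₚ.m≤m+n n (length (pairsOf vs)))
    where
    vs : List (Fin (suc n))
    vs = tabulate Fin.suc

  m<[1+m/n]*n : ∀ m n .{{_ : ℕ.NonZero n}} → m ℕ.< suc (m ℕ./ n) ℕ.* n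
  m<[1+m/n]*n m n = subst (ℕ._< suc (m ℕ./ n) ℕ.* n) (sym (DivMod.m≡m%n+[m/n]*n m n)) (ℕₚ.+-monoˡ-< (m ℕ./ n ℕ.* n) (DivMod.m%n<n m n))

  inv-≤ : ∀ {m n} → 1 ℕ.≤ m → m ℕ.≤ n → ι m * inv n ≤ 1ℚ
  inv-≤ {m} {n} 1≤m m≤n = subst (ι m * inv n ≤_) (ι-inv n (ℕₚ.≤-trans 1≤m m≤n)) (*-monoʳ (0≤inv n) (ι-mono m≤n))

  -- ε is replaced by the comparable 1/s with s an integer, so that all thresholds below are natural numbers.
  module Scale (s : ℕ) (ε : ℚ) (2≤s : 2 ℕ.≤ s) (0<ε : 0ℚ < ε) (ε<1 : ε < 1ℚ) (1≤sε : 1ℚ ≤ ι s * ε) (sε≤2 : ι s * ε ≤ lit 2) where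

    private
      u : ℚ
      u = inv s

      0≤u : 0ℚ ≤ u
      0≤u = 0≤inv s

      1≤s : 1 ℕ.≤ s
      1≤s = ℕₚ.≤-trans (ℕ.s≤s ℕ.z≤n) 2≤s

      su : ι s * u ≡ 1ℚ
      su = ι-inv s 1≤s

      0≤ε : 0ℚ ≤ ε
      0≤ε = <⇒≤ 0<ε

      ε≤1 : ε ≤ 1ℚ
      ε≤1 = <⇒≤ ε<1

    u≤ε : u ≤ ε
    u≤ε = subst₂ _≤_ (*-identityˡ u) (trans (l (ι s) ε u) (trans (cong (ε *_) su) (*-identityʳ ε))) (*-monoʳ 0≤u 1≤sε)
      where
      l : ∀ s ε u → s * ε * u ≡ ε * (s * u)
      l = solve-∀ ℚ-ring

    ε≤2u : ε ≤ lit 2 * u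
    ε≤2u = subst (_≤ lit 2 * u) (trans (l (ι s) ε u) (trans (cong (ε *_) su) (*-identityʳ ε))) (*-monoʳ 0≤u sε≤2)
      where
      l : ∀ s ε u → s * ε * u ≡ ε * (s * u)
      l = solve-∀ ℚ-ring

    2u≤1 : lit 2 * u ≤ 1ℚ
    2u≤1 = subst (λ a → a * u ≤ 1ℚ) (ι≡ℕtoℚ 2) (inv-≤ {2} {s} (ℕ.s≤s ℕ.z≤n) 2≤s)

    module _ (n : ℕ) (s≤n : s ℕ.≤ n) where

      private
        ν : ℚ
        ν = inv n

        1≤n : 1 ℕ.≤ n
        1≤n = ℕₚ.≤-trans 1≤s s≤n

        0≤ν : 0ℚ ≤ ν
        0≤ν = 0≤inv n

        nν : ι n * ν ≡ 1ℚ
        nν = ι-inv n 1≤n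

      2ν≤1 : lit 2 * ν ≤ 1ℚ
      2ν≤1 = subst (λ a → a * ν ≤ 1ℚ) (ι≡ℕtoℚ 2) (inv-≤ {2} {n} (ℕ.s≤s ℕ.z≤n) (ℕₚ.≤-trans 2≤s s≤n))

      0≤p : 0ℚ ≤ (1ℚ + ε) * ν
      0≤p = 0≤* (0≤+ 0≤1 0≤ε) 0≤ν

      p≤2ν : (1ℚ + ε) * ν ≤ lit 2 * ν
      p≤2ν = *-monoʳ 0≤ν (+-monoʳ-≤ 1ℚ ε≤1)

      p≤1 : (1ℚ + ε) * ν ≤ 1ℚ
      p≤1 = ≤-trans p≤2ν 2ν≤1

      𝔼-upper : ∀ ω → 𝔼ₖ ((1ℚ + ε) * ν) (pairs n) (λ ω → ι (distance ω)) ω ≤ lit 400 * (ε * ε * ε) * ι n + (lit 100 + lit 12 * ι s)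
      𝔼-upper ω = begin
          𝔼ₖ ((1ℚ + ε) * ν) (pairs n) (λ ω → ι (distance ω)) ω
        ≤⟨ Potential.𝔼-distance-≤ n L ((1ℚ + ε) * ν) e f ν 0≤p p≤1 (0≤* (0≤lit 2) 0≤u) 2u≤1 (0≤* 0≤½ (0≤ι s)) ef 0≤ν nν fν≤1 (*-monoʳ 0≤ν (+-monoʳ-≤ 1ℚ ε≤2u)) L≥ L≤ ω ⟩
          lit 50 * (e * e * e) * ι n + lit 25 * (e * e) + lit 24 * f
        ≤⟨ ≤-by _ (0≤+ (0≤* (0≤* (0≤lit 400) (0≤+ (0≤* (0≤gap u≤ε) (0≤+ (0≤* 0≤ε 0≤ε) (0≤+ (0≤* 0≤ε 0≤u) (0≤* 0≤u 0≤u)))) ≤-refl)) (0≤ι n)) (0≤* (0≤lit 25) (0≤* (0≤gap 2u≤1) (0≤+ 0≤1 (0≤* (0≤lit 2) 0≤u))))) (l₂ u ε (ι n) (ι s)) ⟩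
          lit 400 * (ε * ε * ε) * ι n + (lit 25 + lit 12 * ι s)
        ≤⟨ +-monoʳ-≤ (lit 400 * (ε * ε * ε) * ι n) (+-monoˡ-≤ (lit 12 * ι s) 25≤100) ⟩
          lit 400 * (ε * ε * ε) * ι n + (lit 100 + lit 12 * ι s) ∎
        where
        open ≤-Reasoning
        instance _ = ℕ.>-nonZero 1≤s
        25≤100 : lit 25 ≤ lit 100
        25≤100 = ≤-by (lit 75) (0≤lit 75) refl
        -- Taking e = 2/s gives e ≥ ε with explicit inverse f = s/2, and 50e³ = 400/s³ ≤ 400ε³. L
        -- exceeds 2en = 4n/s by at most 1.
        e f : ℚ
        e = lit 2 * u
        f = ½ * ι s
        q L : ℕ
        q = (n ℕ.* 4) ℕ./ s
        L = suc q
        ef : e * f ≡ 1ℚ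
        ef = trans (l₁ u (ι s)) su
          where
          l₁ : ∀ u s → lit 2 * u * (½ * s) ≡ s * u
          l₁ = solve-∀ ℚ-ring
        fν≤1 : f * ν ≤ 1ℚ
        fν≤1 = ≤-trans (≤-by _ (0≤* 0≤½ (0≤* (0≤ι s) 0≤ν)) (l₁ (ι s) ν)) (inv-≤ 1≤s s≤n)
          where
          l₁ : ∀ s ν → s * ν ≡ ½ * s * ν + ½ * (s * ν)
          l₁ = solve-∀ ℚ-ring
        4n≤sL : n ℕ.* 4 ℕ.≤ L ℕ.* s
        4n≤sL = ℕₚ.<⇒≤ (m<[1+m/n]*n (n ℕ.* 4) s)
        sq≤4n : q ℕ.* s ℕ.≤ n ℕ.* 4
        sq≤4n = DivMod.m/n*n≤m (n ℕ.* 4) s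
        ι4n : ι (n ℕ.* 4) ≡ ι n * lit 4
        ι4n = trans (ι-* n 4) (cong (ι n *_) (ι≡ℕtoℚ 4))
        L≥ : lit 2 * e * ι n ≤ ι L
        L≥ = begin
            lit 2 * (lit 2 * u) * ι n   ≡⟨ trans (l₁ u (ι n)) (cong (_* u) (sym ι4n)) ⟩
            ι (n ℕ.* 4) * u             ≤⟨ *-monoʳ 0≤u (ι-mono 4n≤sL) ⟩
            ι (L ℕ.* s) * u             ≡⟨ trans (cong (_* u) (ι-* L s)) (trans (*-assoc (ι L) (ι s) u) (trans (cong (ι L *_) su) (*-identityʳ (ι L)))) ⟩
            ι L                         ∎
          where
          l₁ : ∀ u n → lit 2 * (lit 2 * u) * n ≡ n * lit 4 * u
          l₁ = solve-∀ ℚ-ring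
        L≤ : ι L ≤ lit 2 * e * ι n + 1ℚ
        L≤ = begin
            ι L                              ≡⟨ trans (ι-suc q) (+-comm 1ℚ (ι q)) ⟩
            ι q + 1ℚ                         ≡⟨ cong (_+ 1ℚ) (trans (cong (_* u) (ι-* q s)) (trans (*-assoc (ι q) (ι s) u) (trans (cong (ι q *_) su) (*-identityʳ (ι q))))) ⟨
            ι (q ℕ.* s) * u + 1ℚ             ≤⟨ +-monoˡ-≤ 1ℚ (*-monoʳ 0≤u (ι-mono sq≤4n)) ⟩
            ι (n ℕ.* 4) * u + 1ℚ             ≡⟨ cong (_+ 1ℚ) (trans (cong (_* u) ι4n) (l₁ u (ι n))) ⟩
            lit 2 * e * ι n + 1ℚ             ∎
          where
          l₁ : ∀ u n → n * lit 4 * u ≡ lit 2 * (lit 2 * u) * n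
          l₁ = solve-∀ ℚ-ring
        l₂ : ∀ u ε n s → lit 400 * (ε * ε * ε) * n + (lit 25 + lit 12 * s) ≡
             (lit 50 * ((lit 2 * u) * (lit 2 * u) * (lit 2 * u)) * n + lit 25 * ((lit 2 * u) * (lit 2 * u)) + lit 24 * (½ * s)) +
             (lit 400 * ((ε - u) * (ε * ε + (ε * u + u * u)) + 0ℚ) * n + lit 25 * ((1ℚ - lit 2 * u) * (1ℚ + lit 2 * u)))
        l₂ = solve-∀ ℚ-ring

    module Lower (μ : ℕ) (256≤μ : 256 ℕ.≤ μ) where

      -- The requirement κ ≥ 2^14 comes from `8·4snj≤H²`.
      κ : ℕ
      κ = 64 ℕ.* μ

      -- x = n/M has order n/s³. The choice i = 2M gives n ≤ ix, so that 2x short edges at base θ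
      -- outweigh 2^(2n); i′ = 128θ does the same for Δ edges at one vertex at base 2^i′.
      M i θ i′ N₀ : ℕ
      M = 256 ℕ.* (κ ℕ.* (s ℕ.* s ℕ.* s))
      i = 2 ℕ.* M
      θ = 2 ℕ.^ i
      i′ = 128 ℕ.* θ
      N₀ = 8 ℕ.* s ℕ.* M ℕ.+ (32 ℕ.* θ ℕ.+ (4 ℕ.* (2 ℕ.^ i′ ℕ.* 1) ℕ.+ (s ℕ.+ 6)))

      private
        1≤κ : 1 ℕ.≤ κ
        1≤κ = ℕₚ.*-mono-≤ {1} {64} (ℕ.s≤s ℕ.z≤n) (ℕₚ.≤-trans (ℕ.s≤s ℕ.z≤n) 256≤μ)

        s²x≥x : ∀ x → x ℕ.≤ s ℕ.* s ℕ.* x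
        s²x≥x x = ℕₚ.m≤n*m x (s ℕ.* s) {{ℕ.>-nonZero (ℕₚ.*-mono-≤ 1≤s 1≤s)}}

        1≤M : 1 ℕ.≤ M
        1≤M = ℕₚ.*-mono-≤ {1} {256} (ℕ.s≤s ℕ.z≤n) (ℕₚ.*-mono-≤ 1≤κ (ℕₚ.*-mono-≤ (ℕₚ.*-mono-≤ 1≤s 1≤s) 1≤s))

        1≤θ : 1 ℕ.≤ θ
        1≤θ = ℕₚ.m^n>0 2 i

      module _ (n : ℕ) (N₀≤n : N₀ ℕ.≤ n) where

        private
          instance
            M≢0 : ℕ.NonZero M
            M≢0 = ℕ.>-nonZero 1≤M
            32θ≢0 : ℕ.NonZero (32 ℕ.* θ)
            32θ≢0 = ℕ.>-nonZero (ℕₚ.*-mono-≤ {1} {32} (ℕ.s≤s ℕ.z≤n) 1≤θ)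

          8sM≤n : 8 ℕ.* s ℕ.* M ℕ.≤ n
          8sM≤n = ℕₚ.m+n≤o⇒m≤o (8 ℕ.* s ℕ.* M) N₀≤n

          rest₁ : 32 ℕ.* θ ℕ.+ (4 ℕ.* (2 ℕ.^ i′ ℕ.* 1) ℕ.+ (s ℕ.+ 6)) ℕ.≤ n
          rest₁ = ℕₚ.m+n≤o⇒n≤o (8 ℕ.* s ℕ.* M) N₀≤n

          32θ≤n : 32 ℕ.* θ ℕ.≤ n
          32θ≤n = ℕₚ.m+n≤o⇒m≤o (32 ℕ.* θ) rest₁

          rest₂ : 4 ℕ.* (2 ℕ.^ i′ ℕ.* 1) ℕ.+ (s ℕ.+ 6) ℕ.≤ n
          rest₂ = ℕₚ.m+n≤o⇒n≤o (32 ℕ.* θ) rest₁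

          s+6≤n : s ℕ.+ 6 ℕ.≤ n
          s+6≤n = ℕₚ.m+n≤o⇒n≤o (4 ℕ.* (2 ℕ.^ i′ ℕ.* 1)) rest₂

          s≤n : s ℕ.≤ n
          s≤n = ℕₚ.m+n≤o⇒m≤o s s+6≤n

          1≤n : 1 ℕ.≤ n
          1≤n = ℕₚ.≤-trans 1≤s s≤n

        x : ℕ
        x = n ℕ./ M

        private
          xM≤n : x ℕ.* M ℕ.≤ n
          xM≤n = DivMod.m/n*n≤m n M

          8s≤x : 8 ℕ.* s ℕ.≤ x
          8s≤x = subst (ℕ._≤ x) (DivMod.m*n/n≡m (8 ℕ.* s) M) (DivMod./-monoˡ-≤ M 8sM≤n)

          1≤x : 1 ℕ.≤ x
          1≤x = ℕₚ.≤-trans (ℕₚ.*-mono-≤ {1} {8} (ℕ.s≤s ℕ.z≤n) 1≤s) 8s≤x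

        n≤ix : n ℕ.≤ i ℕ.* x
        n≤ix = begin
            n                    ≤⟨ ℕₚ.<⇒≤ (m<[1+m/n]*n n M) ⟩
            suc x ℕ.* M          ≤⟨ ℕₚ.*-monoˡ-≤ M (ℕₚ.+-monoˡ-≤ x 1≤x) ⟩
            (x ℕ.+ x) ℕ.* M      ≡⟨ l x M ⟩
            2 ℕ.* M ℕ.* x        ∎
          where
          open ℕₚ.≤-Reasoning
          l : ∀ x M → (x ℕ.+ x) ℕ.* M ≡ 2 ℕ.* M ℕ.* x
          l = ℕ-Solver.solve-∀

        private
          -- Y is n/(8s) up to rounding, and 2Y = rK covers the walks. H = Y/2 is the number of
          -- painted vertices demanded, and j is the number of times the second graph has to halve a
          -- moment in order to beat all codes.
          K r H Y j Δ : ℕ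
          K = κ ℕ.* (s ℕ.* s)
          r = 64 ℕ.* x
          H = 16 ℕ.* (κ ℕ.* (s ℕ.* s ℕ.* x))
          Y = 32 ℕ.* (κ ℕ.* (s ℕ.* s ℕ.* x))
          j = 256 ℕ.* x
          Δ = n ℕ./ (32 ℕ.* θ)

          8sY : 8 ℕ.* (s ℕ.* Y) ≡ x ℕ.* M
          8sY = l s κ x
            where
            l : ∀ s κ x → 8 ℕ.* (s ℕ.* (32 ℕ.* (κ ℕ.* (s ℕ.* s ℕ.* x)))) ≡ x ℕ.* (256 ℕ.* (κ ℕ.* (s ℕ.* s ℕ.* s)))
            l = ℕ-Solver.solve-∀

          8sY≤n : 8 ℕ.* (s ℕ.* Y) ℕ.≤ n
          8sY≤n = ℕₚ.≤-trans (ℕₚ.≤-reflexive 8sY) xM≤n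

          Y≤n : Y ℕ.≤ n
          Y≤n = ℕₚ.≤-trans (ℕₚ.m≤n*m Y s {{ℕ.>-nonZero 1≤s}}) (ℕₚ.≤-trans (ℕₚ.m≤n*m (s ℕ.* Y) 8) 8sY≤n)

          room : H ℕ.+ K ℕ.* (64 ℕ.* s ℕ.+ 2 ℕ.* (4 ℕ.* x)) ℕ.≤ Y
          room = begin
              H ℕ.+ K ℕ.* (64 ℕ.* s ℕ.+ 2 ℕ.* (4 ℕ.* x))         ≡⟨ l₁ κ s x ⟩
              -- The passages between the 64s trees cost no more than 8x, because n is so large that
              -- 8s ≤ x.
              κ ℕ.* (s ℕ.* s) ℕ.* (24 ℕ.* x ℕ.+ 8 ℕ.* (8 ℕ.* s)) ≤⟨ ℕₚ.*-monoʳ-≤ K (ℕₚ.+-monoʳ-≤ (24 ℕ.* x) (ℕₚ.*-monoʳ-≤ 8 8s≤x)) ⟩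
              κ ℕ.* (s ℕ.* s) ℕ.* (24 ℕ.* x ℕ.+ 8 ℕ.* x)         ≡⟨ l₂ κ s x ⟩
              Y                                                  ∎
            where
            open ℕₚ.≤-Reasoning
            l₁ : ∀ κ s x → 16 ℕ.* (κ ℕ.* (s ℕ.* s ℕ.* x)) ℕ.+ κ ℕ.* (s ℕ.* s) ℕ.* (64 ℕ.* s ℕ.+ 2 ℕ.* (4 ℕ.* x)) ≡ κ ℕ.* (s ℕ.* s) ℕ.* (24 ℕ.* x ℕ.+ 8 ℕ.* (8 ℕ.* s))
            l₁ = ℕ-Solver.solve-∀
            l₂ : ∀ κ s x → κ ℕ.* (s ℕ.* s) ℕ.* (24 ℕ.* x ℕ.+ 8 ℕ.* x) ≡ 32 ℕ.* (κ ℕ.* (s ℕ.* s ℕ.* x))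
            l₂ = ℕ-Solver.solve-∀

          2Y≤rK : 2 ℕ.* Y ℕ.≤ r ℕ.* K
          2Y≤rK = ℕₚ.≤-reflexive (l κ s x)
            where
            l : ∀ κ s x → 2 ℕ.* (32 ℕ.* (κ ℕ.* (s ℕ.* s ℕ.* x))) ≡ 64 ℕ.* x ℕ.* (κ ℕ.* (s ℕ.* s))
            l = ℕ-Solver.solve-∀

          4≤H : 4 ℕ.≤ H
          4≤H = ℕₚ.*-mono-≤ {4} {16} (ℕ.s≤s (ℕ.s≤s (ℕ.s≤s (ℕ.s≤s ℕ.z≤n)))) (ℕₚ.*-mono-≤ 1≤κ (ℕₚ.≤-trans 1≤x (s²x≥x x)))

          codes≤j : 4 ℕ.* x ℕ.+ 2 ℕ.* r ℕ.+ 3 ℕ.≤ j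
          codes≤j = begin
              4 ℕ.* x ℕ.+ 2 ℕ.* (64 ℕ.* x) ℕ.+ 3       ≤⟨ ℕₚ.+-monoʳ-≤ (4 ℕ.* x ℕ.+ 2 ℕ.* (64 ℕ.* x)) (ℕₚ.*-mono-≤ {3} {124} (ℕ.s≤s (ℕ.s≤s (ℕ.s≤s ℕ.z≤n))) 1≤x) ⟩
              4 ℕ.* x ℕ.+ 2 ℕ.* (64 ℕ.* x) ℕ.+ 124 ℕ.* x ≡⟨ l x ⟩
              256 ℕ.* x                                ∎
            where
            open ℕₚ.≤-Reasoning
            l : ∀ x → 4 ℕ.* x ℕ.+ 2 ℕ.* (64 ℕ.* x) ℕ.+ 124 ℕ.* x ≡ 256 ℕ.* x
            l = ℕ-Solver.solve-∀

          1≤Δ : 1 ℕ.≤ Δ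
          1≤Δ = subst (ℕ._≤ Δ) (DivMod.m*n/n≡m 1 (32 ℕ.* θ)) (DivMod./-monoˡ-≤ (32 ℕ.* θ) (ℕₚ.≤-trans (ℕₚ.≤-reflexive (ℕₚ.*-identityˡ (32 ℕ.* θ))) 32θ≤n))

          tail≤ : 4 ℕ.* (θ ℕ.* (4 ℕ.* Δ)) ℕ.+ 3 ℕ.≤ n
          tail≤ = ℕₚ.*-cancelˡ-≤ 2 (begin
              2 ℕ.* (4 ℕ.* (θ ℕ.* (4 ℕ.* Δ)) ℕ.+ 3)  ≡⟨ l θ Δ ⟩
              Δ ℕ.* (32 ℕ.* θ) ℕ.+ 6                 ≤⟨ ℕₚ.+-mono-≤ (DivMod.m/n*n≤m n (32 ℕ.* θ)) (ℕₚ.m+n≤o⇒n≤o s s+6≤n) ⟩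
              n ℕ.+ n                                ≡⟨ cong (n ℕ.+_) (ℕₚ.+-identityʳ n) ⟨
              2 ℕ.* n                                ∎)
            where
            open ℕₚ.≤-Reasoning
            l : ∀ θ Δ → 2 ℕ.* (4 ℕ.* (θ ℕ.* (4 ℕ.* Δ)) ℕ.+ 3) ≡ Δ ℕ.* (32 ℕ.* θ) ℕ.+ 6
            l = ℕ-Solver.solve-∀

          2n≤i′Δ : 2 ℕ.* n ℕ.≤ i′ ℕ.* Δ
          2n≤i′Δ = begin
              2 ℕ.* n                          ≤⟨ ℕₚ.*-monoʳ-≤ 2 (ℕₚ.<⇒≤ (m<[1+m/n]*n n (32 ℕ.* θ))) ⟩
              2 ℕ.* (suc Δ ℕ.* (32 ℕ.* θ))     ≤⟨ ℕₚ.*-monoʳ-≤ 2 (ℕₚ.*-monoˡ-≤ (32 ℕ.* θ) (ℕₚ.+-monoˡ-≤ Δ 1≤Δ)) ⟩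
              2 ℕ.* ((Δ ℕ.+ Δ) ℕ.* (32 ℕ.* θ)) ≡⟨ l θ Δ ⟩
              128 ℕ.* θ ℕ.* Δ                  ∎
            where
            open ℕₚ.≤-Reasoning
            l : ∀ θ Δ → 2 ℕ.* ((Δ ℕ.+ Δ) ℕ.* (32 ℕ.* θ)) ≡ 128 ℕ.* θ ℕ.* Δ
            l = ℕ-Solver.solve-∀

          tail′≤ : 4 ℕ.* (2 ℕ.^ i′ ℕ.* 1) ℕ.+ 3 ℕ.≤ n
          tail′≤ = ℕₚ.≤-trans (ℕₚ.+-monoʳ-≤ (4 ℕ.* (2 ℕ.^ i′ ℕ.* 1)) (ℕₚ.≤-trans (ℕₚ.m≤m+n 3 3) (ℕₚ.m≤n+m 6 s))) rest₂

          x≤npairs : x ℕ.≤ npairs n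
          x≤npairs = ℕₚ.≤-trans (ℕₚ.≤-pred (ℕₚ.≤-trans (ℕₚ.+-monoˡ-≤ x 1≤x) (ℕₚ.≤-trans (ℕₚ.≤-reflexive (l x)) (ℕₚ.≤-trans (ℕₚ.*-monoʳ-≤ x (2≤M)) (ℕₚ.≤-trans xM≤n (ℕₚ.≤-reflexive (sym (ℕₚ.suc-pred n {{ℕ.>-nonZero 1≤n}})))))))) (npairs-≥ n)
            where
            l : ∀ x → x ℕ.+ x ≡ x ℕ.* 2
            l = ℕ-Solver.solve-∀
            2≤M : 2 ℕ.≤ M
            2≤M = ℕₚ.*-mono-≤ {2} {256} (ℕ.s≤s (ℕ.s≤s ℕ.z≤n)) (ℕₚ.*-mono-≤ 1≤κ (ℕₚ.*-mono-≤ (ℕₚ.*-mono-≤ 1≤s 1≤s) 1≤s))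

          -- With n ≤ ix = 512κs³x the left side is at most 2^22 κ s⁴x², and the right side is 2^8
          -- κ² s⁴x².
          8·4snj≤H² : 8 ℕ.* (4 ℕ.* s ℕ.* n ℕ.* j) ℕ.≤ H ℕ.* H
          8·4snj≤H² = begin
              8 ℕ.* (4 ℕ.* s ℕ.* n ℕ.* j)
            ≤⟨ ℕₚ.*-monoʳ-≤ 8 (ℕₚ.*-monoˡ-≤ j (ℕₚ.*-monoʳ-≤ (4 ℕ.* s) n≤ix)) ⟩
              8 ℕ.* (4 ℕ.* s ℕ.* (i ℕ.* x) ℕ.* j)
            ≡⟨ l₁ 8 4 2 256 s κ x ⟩
              256 ℕ.* ((8 ℕ.* 4 ℕ.* 2) ℕ.* (256 ℕ.* A))
            ≤⟨ ℕₚ.*-monoʳ-≤ 256 (ℕₚ.*-monoʳ-≤ 64 (ℕₚ.*-monoˡ-≤ A 256≤μ)) ⟩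
              256 ℕ.* (64 ℕ.* (μ ℕ.* A))
            ≡⟨ l₂ s κ x 16 64 μ ⟩
              H ℕ.* H ∎
            where
            open ℕₚ.≤-Reasoning
            A : ℕ
            A = κ ℕ.* (s ℕ.* s ℕ.* x ℕ.* (s ℕ.* s ℕ.* x))
            l₁ : ∀ e f g c s κ x → e ℕ.* (f ℕ.* s ℕ.* (g ℕ.* (c ℕ.* (κ ℕ.* (s ℕ.* s ℕ.* s))) ℕ.* x) ℕ.* (c ℕ.* x)) ≡ c ℕ.* ((e ℕ.* f ℕ.* g) ℕ.* (c ℕ.* (κ ℕ.* (s ℕ.* s ℕ.* x ℕ.* (s ℕ.* s ℕ.* x)))))
            l₁ = ℕ-Solver.solve-∀
            l₂ : ∀ s κ x c d μ → (c ℕ.* c) ℕ.* (d ℕ.* (μ ℕ.* (κ ℕ.* (s ℕ.* s ℕ.* x ℕ.* (s ℕ.* s ℕ.* x))))) ≡ c ℕ.* ((d ℕ.* μ) ℕ.* (s ℕ.* s ℕ.* x)) ℕ.* (c ℕ.* (κ ℕ.* (s ℕ.* s ℕ.* x)))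
            l₂ = ℕ-Solver.solve-∀

          -- As 4z = u/2, the first graph has density (1 + u/2)/n, and p₂ is chosen so that the
          -- union has density exactly p. N = 1/z = 8s bounds the mean number of roots, so R₀ = 64s
          -- makes wN equal to 1/8.
          ν z p p₁ gap q p₂ N w : ℚ
          ν = inv n
          z = eighth * u
          p = (1ℚ + ε) * ν
          p₁ = (1ℚ + lit 4 * z) * ν
          gap = 1ℚ - p₁

          0≤ν : 0ℚ ≤ ν
          0≤ν = 0≤inv n

          nν : ι n * ν ≡ 1ℚ
          nν = ι-inv n 1≤n

          0≤z : 0ℚ ≤ z
          0≤z = 0≤* (0≤* 0≤½ (0≤* 0≤½ 0≤½)) 0≤u

          p₁≤ : p₁ ≤ p
          p₁≤ = *-monoʳ 0≤ν (+-monoʳ-≤ 1ℚ 4z≤ε)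
            where
            4z≤ε : lit 4 * z ≤ ε
            4z≤ε = ≤-trans 4z≤u u≤ε
              where
              4z≤u : lit 4 * z ≤ u
              4z≤u = ≤-by (½ * u) (0≤* 0≤½ 0≤u) (l u)
                where
                l : ∀ u → u ≡ lit 4 * (eighth * u) + ½ * u
                l = solve-∀ ℚ-ring

          0≤p₁ : 0ℚ ≤ p₁
          0≤p₁ = 0≤* (0≤+ 0≤1 (0≤* (0≤lit 4) 0≤z)) 0≤ν

          p₁≤1 : p₁ ≤ 1ℚ
          p₁≤1 = ≤-trans p₁≤ (p≤1 n s≤n)

          ν≤½ : ν ≤ ½
          ν≤½ = subst (_≤ ½) (l ν) (*-monoˡ 0≤½ (2ν≤1 n s≤n))
            where
            l : ∀ ν → ½ * (lit 2 * ν) ≡ ν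
            l = solve-∀ ℚ-ring

          0<gap : 0ℚ < gap
          0<gap = <-≤-trans (positive⁻¹ (½ * ½)) (≤-by _ (0≤+ (0≤gap ν≤½) (0≤+ (0≤* (0≤* (0≤lit 4) 0≤z) (0≤gap ν≤½)) (0≤* 0≤½ (0≤* 0≤½ (0≤gap 2u≤1′))))) (l u ν))
            where
            2u≤1′ : u ≤ 1ℚ
            2u≤1′ = ≤-trans u≤ε ε≤1
            l : ∀ u ν → 1ℚ - (1ℚ + lit 4 * (eighth * u)) * ν ≡ ½ * ½ + ((½ - ν) + ((lit 4 * (eighth * u)) * (½ - ν) + ½ * (½ * (1ℚ - u))))
            l = solve-∀ ℚ-ring

          instance
            gap-pos : Positive gap
            gap-pos = positive 0<gap
            gap≢0 : NonZero gap
            gap≢0 = pos⇒nonZero gap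

          q = 1/ gap
          p₂ = (p - p₁) * q

          gq : gap * q ≡ 1ℚ
          gq = *-inverseʳ gap

          0≤q : 0ℚ ≤ q
          0≤q = <⇒≤ (positive⁻¹ q {{1/pos⇒pos gap}})

          1≤q : 1ℚ ≤ q
          1≤q = subst₂ _≤_ gq (*-identityˡ q) (*-monoʳ {x = gap} {1ℚ} 0≤q (≤-by p₁ 0≤p₁ (l p₁)))
            where
            l : ∀ a → 1ℚ ≡ (1ℚ - a) + a
            l = solve-∀ ℚ-ring

          p≡ : p₁ + p₂ - p₁ * p₂ ≡ p
          p≡ = trans (l p₁ p q) (trans (cong (λ y → p₁ + (p - p₁) * y) gq) (l′ p₁ p))
            where
            l : ∀ a p q → a + (p - a) * q - a * ((p - a) * q) ≡ a + (p - a) * ((1ℚ - a) * q)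
            l = solve-∀ ℚ-ring
            l′ : ∀ a p → a + (p - a) * 1ℚ ≡ p
            l′ = solve-∀ ℚ-ring

          0≤p₂ : 0ℚ ≤ p₂
          0≤p₂ = 0≤* (0≤gap p₁≤) 0≤q

          p₂≤1 : p₂ ≤ 1ℚ
          p₂≤1 = subst (p₂ ≤_) gq (*-monoʳ 0≤q (+-monoˡ-≤ (- p₁) (p≤1 n s≤n)))

          p₂≥ : ½ * u * ν ≤ p₂
          p₂≥ = begin
              ½ * u * ν          ≤⟨ ≤-by _ (0≤* (0≤gap u≤ε) 0≤ν) (l u ε ν) ⟩
              (p - p₁)           ≡⟨ *-identityʳ (p - p₁) ⟨
              (p - p₁) * 1ℚ      ≤⟨ *-monoˡ (0≤gap p₁≤) 1≤q ⟩
              p₂                 ∎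
            where
            open ≤-Reasoning
            l : ∀ u ε ν → (1ℚ + ε) * ν - (1ℚ + lit 4 * (eighth * u)) * ν ≡ ½ * u * ν + (ε - u) * ν
            l = solve-∀ ℚ-ring

          -- Every 4sn agreeing pairs halve the moment, since 4sn · p₂/2 ≥ 4sn · uν/4 = 1.
          sprinkle : ∀ c → H ℕ.* H ℕ.≤ 8 ℕ.* c → pow (1ℚ - p₂ + p₂ * ½) c ≤ pow ½ j
          sprinkle c H²≤ = begin
              pow (1ℚ - p₂ + p₂ * ½) c
            ≡⟨ cong (λ y → pow y c) (l p₂) ⟩
              pow (1ℚ - y) c
            ≤⟨ pow-antitone (0≤gap y≤1) (≤-by y 0≤y (l′ y)) kj≤c ⟩
              pow (1ℚ - y) (k ℕ.* j)
            ≡⟨ pow-* (1ℚ - y) k j ⟩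
              pow (pow (1ℚ - y) k) j
            ≤⟨ pow-mono-base j (0≤pow k (0≤gap y≤1)) (pow-halves y k 0≤y y≤1 1≤ky) ⟩
              pow ½ j ∎
            where
            open ≤-Reasoning
            k : ℕ
            k = 4 ℕ.* s ℕ.* n
            y : ℚ
            y = ½ * p₂
            0≤y : 0ℚ ≤ y
            0≤y = 0≤* 0≤½ 0≤p₂
            y≤1 : y ≤ 1ℚ
            y≤1 = ≤-trans (≤-by y 0≤y (l″ p₂)) p₂≤1
              where
              l″ : ∀ p → p ≡ ½ * p + ½ * p
              l″ = solve-∀ ℚ-ring
            l : ∀ p → 1ℚ - p + p * ½ ≡ 1ℚ - ½ * p
            l = solve-∀ ℚ-ring
            l′ : ∀ y → 1ℚ ≡ (1ℚ - y) + y
            l′ = solve-∀ ℚ-ring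
            kj≤c : k ℕ.* j ℕ.≤ c
            kj≤c = ℕₚ.*-cancelˡ-≤ 8 (ℕₚ.≤-trans 8·4snj≤H² H²≤)
            1≤ky : 1ℚ ≤ ι k * y
            1≤ky = begin
                1ℚ                                        ≡⟨ trans (l‴ (ι s) u (ι n) ν) (cong₂ _*_ su nν) ⟨
                lit 4 * ι s * ι n * (½ * (½ * u * ν))     ≤⟨ *-monoˡ (0≤* (0≤* (0≤lit 4) (0≤ι s)) (0≤ι n)) (*-monoˡ 0≤½ p₂≥) ⟩
                lit 4 * ι s * ι n * y                     ≡⟨ cong (_* y) (trans (ι-* (4 ℕ.* s) n) (cong (_* ι n) (trans (ι-* 4 s) (cong (_* ι s) (ι≡ℕtoℚ 4))))) ⟨
                ι k * y                                   ∎
              where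
              l‴ : ∀ s u n ν → lit 4 * s * n * (½ * (½ * u * ν)) ≡ (s * u) * (n * ν)
              l‴ = solve-∀ ℚ-ring

          N = lit 8 * ι s
          w = inv (64 ℕ.* s)

          Nz : N * z ≡ 1ℚ
          Nz = trans (l (ι s) u) su
            where
            l : ∀ s u → lit 8 * s * (eighth * u) ≡ s * u
            l = solve-∀ ℚ-ring

          wR₀ : w * ι (64 ℕ.* s) ≡ 1ℚ
          wR₀ = trans (*-comm w _) (ι-inv (64 ℕ.* s) (ℕₚ.*-mono-≤ {1} {64} (ℕ.s≤s ℕ.z≤n) 1≤s))

          wN : w * N ≤ eighth
          wN = ≤-reflexive (trans (l w (ι s)) (trans (cong (λ y → eighth * (w * y)) (sym (trans (ι-* 64 s) (cong (_* ι s) (ι≡ℕtoℚ 64))))) (trans (cong (eighth *_) wR₀) (*-identityʳ eighth))))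
            where
            l : ∀ w s → w * (lit 8 * s) ≡ eighth * (w * (lit 64 * s))
            l = solve-∀ ℚ-ring

          z≤1/8 : z ≤ eighth
          z≤1/8 = subst (z ≤_) (*-identityʳ eighth) (*-monoˡ (0≤* 0≤½ (0≤* 0≤½ 0≤½)) (≤-trans u≤ε ε≤1))

          z≤1 : z ≤ 1ℚ
          z≤1 = ≤-trans z≤1/8 (≤-by (lit 7 * eighth) (0≤* (0≤lit 7) (0≤* 0≤½ (0≤* 0≤½ 0≤½))) refl)

          u₀ : ℕ
          u₀ = n ∸ Y

          Y+u₀≡n : Y ℕ.+ u₀ ≡ n
          Y+u₀≡n = ℕₚ.m+[n∸m]≡n Y≤n

          ιY≤ : ι Y ≤ ι n * z
          ιY≤ = subst (_≤ ι n * z) (trans (cong (_* z) (trans (ι-* 8 (s ℕ.* Y)) (cong₂ _*_ (ι≡ℕtoℚ 8) (ι-* s Y)))) (trans (l (ι s) (ι Y) z) (trans (cong (_* ι Y) Nz) (*-identityˡ (ι Y))))) (*-monoʳ 0≤z (ι-mono 8sY≤n))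
            where
            l : ∀ s Y z → lit 8 * (s * Y) * z ≡ lit 8 * s * z * Y
            l = solve-∀ ℚ-ring

          ιu₀≥ : ι n * (1ℚ - z) ≤ ι u₀
          ιu₀≥ = ≤-by _ (0≤gap ιY≤) (trans (l (ι Y) (ι u₀) (ι n) z) (cong (λ m → ι n * (1ℚ - z) + (ι n * z - ι Y) + (m - ι n)) (trans (sym (ι-+ Y u₀)) (cong ι Y+u₀≡n))) ⟨⟩ l′ (ι n * (1ℚ - z) + (ι n * z - ι Y)) (ι n))
            where
            _⟨⟩_ : ∀ {a b c : ℚ} → a ≡ b → b ≡ c → a ≡ c
            _⟨⟩_ = trans
            l : ∀ Y u₀ n z → u₀ ≡ n * (1ℚ - z) + (n * z - Y) + ((Y + u₀) - n)
            l = solve-∀ ℚ-ring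
            l′ : ∀ a n → a + (n - n) ≡ a
            l′ = solve-∀ ℚ-ring

          -- One factor 1 - z comes from the at most zn vertices already found, the other from the
          -- supermartingale. The excess 4z beats both: (1 - z)²(1 + 4z) = 1 + z(2 - 7z + 4z²), at
          -- least 1 for z ≤ 1/8.
          drift : 1ℚ ≤ ι u₀ * p₁ * (1ℚ - z)
          drift = begin
              1ℚ
            ≤⟨ ≤-by _ (0≤* 0≤z (0≤+ (0≤+ (0≤* (0≤lit 7) (0≤gap z≤1/8)) (0≤* (0≤lit 9) (0≤* 0≤½ (0≤* 0≤½ 0≤½)))) (0≤* (0≤lit 4) (0≤* 0≤z 0≤z)))) (l z) ⟩
              (1ℚ - z) * ((1ℚ + lit 4 * z) * 1ℚ) * (1ℚ - z)
            ≡⟨ trans (cong (λ y → (1ℚ - z) * ((1ℚ + lit 4 * z) * y) * (1ℚ - z)) (sym nν)) (l′ z (ι n) ν) ⟩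
              ι n * (1ℚ - z) * p₁ * (1ℚ - z)
            ≤⟨ *-monoʳ (0≤gap z≤1) (*-monoʳ 0≤p₁ ιu₀≥) ⟩
              ι u₀ * p₁ * (1ℚ - z) ∎
            where
            open ≤-Reasoning
            l : ∀ z → (1ℚ - z) * ((1ℚ + lit 4 * z) * 1ℚ) * (1ℚ - z) ≡ 1ℚ + z * (lit 7 * (eighth - z) + lit 9 * eighth + lit 4 * (z * z))
            l = solve-∀ ℚ-ring
            l′ : ∀ z n ν → (1ℚ - z) * ((1ℚ + lit 4 * z) * (n * ν)) * (1ℚ - z) ≡ n * (1ℚ - z) * ((1ℚ + lit 4 * z) * ν) * (1ℚ - z)
            l′ = solve-∀ ℚ-ring

        𝔼-lower : ι x * ½ ≤ 𝔼ₖ ((1ℚ + ε) * inv n) (pairs n) (λ ω → ι (distance ω)) (λ _ → false)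
        𝔼-lower = subst (λ p → ι x * ½ ≤ 𝔼ₖ p (pairs n) (λ ω → ι (distance ω)) (λ _ → false)) p≡
          (Sprinkling.𝔼-distance-≥ n x K r H Y u₀ (64 ℕ.* s) j Δ i i′ p₁ p₂ ν z N w
            0≤p₁ p₁≤1 0≤p₂ p₂≤1 (subst (0ℚ ≤_) (sym p≡) (0≤p n s≤n)) (subst (_≤ 1ℚ) (sym p≡) (p≤1 n s≤n))
            0≤ν (≤-trans ν≤½ (≤-by ½ 0≤½ refl)) nν (subst (_≤ lit 2 * ν) (sym p≡) (p≤2ν n s≤n))
            0≤z z≤1 (0≤* (0≤lit 8) (0≤ι s)) Nz drift (0≤inv (64 ℕ.* s)) wR₀ wN
            (ℕₚ.≤-reflexive Y+u₀≡n) 2Y≤rK 4≤H room sprinkle codes≤j 1≤Δ x≤npairs n≤ix tail≤ 2n≤i′Δ tail′≤)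

-- Constants, concentration and the final statement.

module Main where

  open import Defs
  open Rationals
  open Concentration
  open VertexPairs using (pairs-unique)
  open Exploration
  open Distance
  open Asymptotics
  open import Data.Bool using (Bool; false; _∧_)
  open import Data.Nat as ℕ using (ℕ; zero; suc)
  import Data.Nat.Properties as ℕₚ
  open import Data.Integer using (+_)
  open import Data.List using (List)
  open import Data.Product using (Σ; _×_; _,_; proj₁; proj₂)
  open import Data.Sum using (_⊎_; inj₁; inj₂; [_,_]′)
  open import Data.Rational hiding (floor)
  open import Data.Rational.Properties
  open import Data.Empty using (⊥-elim)
  open import Relation.Nullary using (¬_; yes; no)
  open import Relation.Nullary.Decidable using (⌊_⌋; toWitness)
  open import Relation.Binary.PropositionalEquality
  open import Tactic.RingSolver using (solve-∀)

  0<* : ∀ {x y} → 0ℚ < x → 0ℚ < y → 0ℚ < x * y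
  0<* {x} {y} 0<x 0<y = subst (_< x * y) (*-zeroʳ x) (*-monoʳ-<-pos x {{positive 0<x}} 0<y)

  inverse : ∀ {x} → 0ℚ < x → Σ ℚ λ y → (0ℚ ≤ y) × (x * y ≡ 1ℚ)
  inverse {x} 0<x = 1/ x , <⇒≤ (positive⁻¹ (1/ x) {{1/pos⇒pos x}}) , *-inverseʳ x
    where
    instance
      x-pos : Positive x
      x-pos = positive 0<x
      x≢0 : NonZero x
      x≢0 = pos⇒nonZero x

  archimedes-* : ∀ {x} b → 0ℚ < x → Σ ℕ λ N → ∀ {n} → N ℕ.≤ n → b ≤ x * ι n
  archimedes-* {x} b 0<x with inverse 0<x
  ... | y , 0≤y , xy with archimedes (y * b)
  ...   | N , yb≤N = N , λ {n} N≤n → subst (_≤ x * ι n) (trans (sym (*-assoc x y b)) (trans (cong (_* b) xy) (*-identityˡ b)))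
                                           (*-monoˡ (<⇒≤ 0<x) (≤-trans yb≤N (ι-mono N≤n)))

  -- The downward search stops where (s - 1)ε < 1, so sε ≤ 2; and ε < 1 excludes s = 1.
  scale : ∀ ε → 0ℚ < ε → ε < 1ℚ → Σ ℕ λ s → (2 ℕ.≤ s) × (1ℚ ≤ ι s * ε) × (ι s * ε ≤ lit 2)
  scale ε 0<ε ε<1 with archimedes-* 1ℚ 0<ε
  ... | N , big = search N (subst (1ℚ ≤_) (*-comm ε (ι N)) (big ℕₚ.≤-refl))
    where
    step : ∀ k → ι (suc k) * ε ≡ ε + ι k * ε
    step k = trans (cong (_* ε) (ι-suc k)) (l (ι k) ε)
      where
      l : ∀ k ε → (1ℚ + k) * ε ≡ ε + k * ε
      l = solve-∀ ℚ-ring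
    at-least-2 : ∀ k → 1ℚ ≤ ι k * ε → 2 ℕ.≤ k
    at-least-2 zero          h = ⊥-elim (<-irrefl refl (<-≤-trans (toWitness {a? = 0ℚ <? 1ℚ} _) (subst (1ℚ ≤_) (trans (cong (_* ε) ι-0) (*-zeroˡ ε)) h)))
    at-least-2 (suc zero)    h = ⊥-elim (<-irrefl refl (≤-<-trans (subst (1ℚ ≤_) (trans (cong (_* ε) ι-1) (*-identityˡ ε)) h) ε<1))
    at-least-2 (suc (suc k)) h = ℕ.s≤s (ℕ.s≤s ℕ.z≤n)
    search : ∀ k → 1ℚ ≤ ι k * ε → Σ ℕ λ s → (2 ℕ.≤ s) × (1ℚ ≤ ι s * ε) × (ι s * ε ≤ lit 2)
    search zero    h = ⊥-elim (ℕₚ.<⇒≱ (at-least-2 zero h) ℕ.z≤n)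
    search (suc k) h with 1ℚ ≤? ι k * ε
    ... | yes h′ = search k h′
    ... | no ¬h′ = suc k , at-least-2 (suc k) h , h , subst (_≤ lit 2) (sym (step k)) (+-mono-≤ (<⇒≤ ε<1) (<⇒≤ (≰⇒> ¬h′)))

  opaque

    -- This is 2^(-28). From n ≤ 2Mx with 2M = 2^23 s³ and (sε)³ ≤ 8 it follows that 2c₁ε³n ≤ x/2,
    -- the bound for the mean.
    c₁ : ℚ
    c₁ = + 1 / 268435456

    0<c₁ : 0ℚ < c₁
    0<c₁ = toWitness {a? = 0ℚ <? c₁} _

    c₁≤1 : c₁ ≤ 1ℚ
    c₁≤1 = toWitness {a? = c₁ ≤? 1ℚ} _

    c₁-value : lit 2 * c₁ * (lit 2 * (lit 256 * (lit 64 * lit 256))) ≡ ½ * (½ * (½ * ½))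
    c₁-value = refl

  -- The mean takes 400, its constant terms 1 for large n, and the last unit is room for deviations.
  c₂ : ℚ
  c₂ = lit 402

  c₁≤c₂ : c₁ ≤ c₂
  c₁≤c₂ = ≤-trans c₁≤1 (≤-by (lit 401) (0≤lit 401) refl)

  opaque

    between? : ℚ → ℚ → ℚ → Bool
    between? x y z = ⌊ x ≤? y ⌋ ∧ ⌊ y ≤? z ⌋

    between?-unfold : ∀ x y z → between? x y z ≡ (⌊ x ≤? y ⌋ ∧ ⌊ y ≤? z ⌋)
    between?-unfold x y z = refl

    not-between : ∀ x y z → between? x y z ≡ false → (y < x) ⊎ (z < y)
    not-between x y z eq with x ≤? y | y ≤? z
    ... | no ¬a | _     = inj₁ (≰⇒> ¬a)
    ... | yes _ | no ¬b = inj₂ (≰⇒> ¬b)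

  WithinBounds : ℚ → (n : ℕ) → List Bool → Bool
  WithinBounds ε n T = between? (c₁ * (ε * ε * ε) * ι n) (ι (distBP n T)) (c₂ * (ε * ε * ε) * ι n)

  concentration : ∀ n p → 0ℚ ≤ p → p ≤ 1ℚ → ∀ w m → m ≡ 𝔼 p (npairs n) (λ T → ι (distBP n T)) → ∀ A → 0ℚ ≤ w →
    (∀ T → A T ≡ false → 1ℚ ≤ w * ((ι (distBP n T) - m) * (ι (distBP n T) - m))) → 1ℚ - w * (ι (npairs n) * p) ≤ Pr n p A
  concentration n p 0≤p p≤1 w m refl A 0≤w far =
    subst (1ℚ - w * (ι (npairs n) * p) ≤_) (sym (Pr-𝔼 n p A))
          (chebyshev p 0≤p p≤1 (npairs n) (λ T → ι (distBP n T)) w A 0≤w (distBP-Lipschitz n (npairs n)) (λ T _ → far T))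

  module Fixed (ε : ℚ) (0<ε : 0ℚ < ε) (ε<1 : ε < 1ℚ) (s : ℕ) (2≤s : 2 ℕ.≤ s) (1≤sε : 1ℚ ≤ ι s * ε) (sε≤2 : ι s * ε ≤ lit 2)
               (μ : ℕ) (μ≡256 : μ ≡ 256) where

    open Scale s ε 2≤s 0<ε ε<1 1≤sε sε≤2
    open Lower μ (ℕₚ.≤-reflexive (sym μ≡256)) using (N₀; x; n≤ix; 𝔼-lower)

    η : ℚ
    η = ε * ε * ε

    0<η : 0ℚ < η
    0<η = 0<* (0<* 0<ε 0<ε) 0<ε

    opaque

      mean : ℕ → ℚ
      mean n = 𝔼 ((1ℚ + ε) * inv n) (npairs n) (λ T → ι (distBP n T))

      mean-𝔼 : ∀ n → mean n ≡ 𝔼 ((1ℚ + ε) * inv n) (npairs n) (λ T → ι (distBP n T))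
      mean-𝔼 n = refl

    module _ (n : ℕ) (N₀≤n : N₀ ℕ.≤ n) (s≤n : s ℕ.≤ n) where

      mean-𝔼ₖ : mean n ≡ 𝔼ₖ ((1ℚ + ε) * inv n) (pairs n) (λ ω → ι (distance ω)) (λ _ → false)
      mean-𝔼ₖ = trans (mean-𝔼 n) (𝔼-𝔼ₖ ((1ℚ + ε) * inv n) (0≤p n s≤n) (p≤1 n s≤n) (λ T → ι (distBP n T)) (λ _ → false) (pairs-unique n))

      mean-≥ : lit 2 * (c₁ * η * ι n) ≤ mean n
      mean-≥ = begin
          lit 2 * (c₁ * η * ι n)
        ≤⟨ *-monoˡ (0≤lit 2) (*-monoˡ (<⇒≤ (0<* 0<c₁ 0<η)) (ι-mono (n≤ix n N₀≤n))) ⟩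
          lit 2 * (c₁ * η * ι (2 ℕ.* (256 ℕ.* (64 ℕ.* μ ℕ.* (s ℕ.* s ℕ.* s))) ℕ.* X))
        ≡⟨ cong (λ m → lit 2 * (c₁ * η * m)) cast ⟩
          lit 2 * (c₁ * η * (lit 2 * (lit 256 * (lit 64 * lit 256 * (ι s * ι s * ι s))) * ι X))
        ≡⟨ l c₁ (lit 2) (lit 256) (lit 64) ε (ι s) (ι X) ⟩
          C * ((ι s * ε) * ((ι s * ε) * (ι s * ε))) * ι X
        ≡⟨ cong (λ c → c * ((ι s * ε) * ((ι s * ε) * (ι s * ε))) * ι X) c₁-value ⟩
          (½ * (½ * (½ * ½))) * ((ι s * ε) * ((ι s * ε) * (ι s * ε))) * ι X
        ≤⟨ *-monoʳ (0≤ι X) (*-monoˡ (0≤* 0≤½ (0≤* 0≤½ (0≤* 0≤½ 0≤½))) (*-mono 0≤sε (0≤* (0≤lit 2) (0≤lit 2)) sε≤2 (*-mono 0≤sε (0≤lit 2) sε≤2 sε≤2))) ⟩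
          (½ * (½ * (½ * ½))) * (lit 2 * (lit 2 * lit 2)) * ι X
        ≡⟨ l′ (ι X) ⟩
          ι X * ½
        ≤⟨ 𝔼-lower n N₀≤n ⟩
          𝔼ₖ ((1ℚ + ε) * inv n) (pairs n) (λ ω → ι (distance ω)) (λ _ → false)
        ≡⟨ mean-𝔼ₖ ⟨
          mean n ∎
        where
        open ≤-Reasoning
        open Powers using (0≤½)
        X : ℕ
        X = x n N₀≤n
        0≤sε : 0ℚ ≤ ι s * ε
        0≤sε = 0≤* (0≤ι s) (<⇒≤ 0<ε)
        cast : ι (2 ℕ.* (256 ℕ.* (64 ℕ.* μ ℕ.* (s ℕ.* s ℕ.* s))) ℕ.* X) ≡ lit 2 * (lit 256 * (lit 64 * lit 256 * (ι s * ι s * ι s))) * ι X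
        cast = trans (ι-* (2 ℕ.* (256 ℕ.* (64 ℕ.* μ ℕ.* (s ℕ.* s ℕ.* s)))) X) (cong (_* ι X)
          (trans (ι-* 2 (256 ℕ.* (64 ℕ.* μ ℕ.* (s ℕ.* s ℕ.* s)))) (cong₂ _*_ (ι≡ℕtoℚ 2)
          (trans (ι-* 256 (64 ℕ.* μ ℕ.* (s ℕ.* s ℕ.* s))) (cong₂ _*_ (ι≡ℕtoℚ 256)
          (trans (ι-* (64 ℕ.* μ) (s ℕ.* s ℕ.* s)) (cong₂ _*_ (trans (ι-* 64 μ) (cong₂ _*_ (ι≡ℕtoℚ 64) (trans (cong ι μ≡256) (ι≡ℕtoℚ 256))))
          (trans (ι-* (s ℕ.* s) s) (cong (_* ι s) (ι-* s s))))))))))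
        C : ℚ
        C = lit 2 * c₁ * (lit 2 * (lit 256 * (lit 64 * lit 256)))
        l : ∀ c a b d ε s X → a * (c * (ε * ε * ε) * (a * (b * (d * b * (s * s * s))) * X)) ≡ a * c * (a * (b * (d * b))) * ((s * ε) * ((s * ε) * (s * ε))) * X
        l = solve-∀ ℚ-ring
        l′ : ∀ X → (½ * (½ * (½ * ½))) * (lit 2 * (lit 2 * lit 2)) * X ≡ X * ½
        l′ = solve-∀ ℚ-ring

      mean-≤ : lit 100 + lit 12 * ι s ≤ η * ι n → mean n ≤ lit 401 * η * ι n
      mean-≤ small = begin
          mean n                                                ≡⟨ mean-𝔼ₖ ⟩
          𝔼ₖ ((1ℚ + ε) * inv n) (pairs n) (λ ω → ι (distance ω)) (λ _ → false) ≤⟨ 𝔼-upper n s≤n (λ _ → false) ⟩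
          lit 400 * η * ι n + (lit 100 + lit 12 * ι s)          ≤⟨ +-monoʳ-≤ (lit 400 * η * ι n) small ⟩
          lit 400 * η * ι n + η * ι n                           ≡⟨ l η (ι n) ⟩
          lit 401 * η * ι n                                     ∎
        where
        open ≤-Reasoning
        l : ∀ η n → lit 400 * η * n + η * n ≡ lit 401 * η * n
        l = solve-∀ ℚ-ring

      -- With h = 1/(c₁η), v = h/n is the inverse of the allowed deviation c₁ηn. At most n² bits of
      -- density at most 2/n give variance at most 2n, so the failure probability is at most 2h²/n ≤
      -- δ.
      concentrated : ∀ δ h → 0ℚ ≤ h → c₁ * η * h ≡ 1ℚ → lit 100 + lit 12 * ι s ≤ η * ι n → lit 2 * (h * h) ≤ δ * ι n →
                     1ℚ - δ ≤ Pr n ((1ℚ + ε) * inv n) (WithinBounds ε n)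
      concentrated δ h 0≤h ch small large = begin
          1ℚ - δ
        ≤⟨ +-monoʳ-≤ 1ℚ (neg-antimono-≤ variance) ⟩
          1ℚ - v * v * (ι (npairs n) * p)
        ≤⟨ concentration n p (0≤p n s≤n) (p≤1 n s≤n) (v * v) (mean n) (mean-𝔼 n) (WithinBounds ε n) (0≤* 0≤v 0≤v) far ⟩
          Pr n p (WithinBounds ε n) ∎
        where
        open ≤-Reasoning
        p ν v g : ℚ
        ν = inv n
        p = (1ℚ + ε) * ν
        v = h * ν
        g = c₁ * η * ι n
        0≤ν : 0ℚ ≤ ν
        0≤ν = 0≤inv n
        0≤v : 0ℚ ≤ v
        0≤v = 0≤* 0≤h 0≤ν
        nν : ι n * ν ≡ 1ℚ
        nν = ι-inv n (ℕₚ.≤-trans (ℕₚ.≤-trans (ℕ.s≤s ℕ.z≤n) 2≤s) s≤n)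
        0≤ηn : 0ℚ ≤ η * ι n
        0≤ηn = 0≤* (<⇒≤ 0<η) (0≤ι n)
        0≤g : 0ℚ ≤ g
        0≤g = 0≤* (<⇒≤ (0<* 0<c₁ 0<η)) (0≤ι n)
        vg : v * g ≡ 1ℚ
        vg = trans (l h ν (c₁ * η) (ι n)) (cong₂ _*_ ch nν)
          where
          l : ∀ h ν c n → h * ν * (c * n) ≡ (c * h) * (n * ν)
          l = solve-∀ ℚ-ring
        variance : v * v * (ι (npairs n) * p) ≤ δ
        variance = begin
            v * v * (ι (npairs n) * p)
          ≤⟨ *-monoˡ (0≤* 0≤v 0≤v) (*-mono (0≤ι (npairs n)) (0≤* (0≤lit 2) 0≤ν) (≤-trans (ι-mono (npairs-≤ n)) (≤-reflexive (ι-* n n))) (p≤2ν n s≤n)) ⟩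
            v * v * (ι n * ι n * (lit 2 * ν))
          ≡⟨ l h ν (ι n) ⟩
            lit 2 * (h * h) * ν * (ι n * ν * (ι n * ν))
          ≡⟨ trans (cong (λ y → lit 2 * (h * h) * ν * (y * y)) nν) (l′ (lit 2 * (h * h)) ν) ⟩
            lit 2 * (h * h) * ν
          ≤⟨ *-monoʳ 0≤ν large ⟩
            δ * ι n * ν
          ≡⟨ trans (*-assoc δ (ι n) ν) (trans (cong (δ *_) nν) (*-identityʳ δ)) ⟩
            δ ∎
          where
          l : ∀ h ν n → h * ν * (h * ν) * (n * n * (lit 2 * ν)) ≡ lit 2 * (h * h) * ν * (n * ν * (n * ν))
          l = solve-∀ ℚ-ring
          l′ : ∀ a ν → a * ν * (1ℚ * 1ℚ) ≡ a * ν
          l′ = solve-∀ ℚ-ring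
        deviation : ∀ d → g ≤ d → 1ℚ ≤ v * v * (d * d)
        deviation d g≤d = begin
            1ℚ                      ≡⟨ cong₂ _*_ vg vg ⟨
            v * g * (v * g)         ≡⟨ l v g ⟩
            v * v * (g * g)         ≤⟨ *-monoˡ (0≤* 0≤v 0≤v) (*-mono 0≤g (≤-trans 0≤g g≤d) g≤d g≤d) ⟩
            v * v * (d * d)         ∎
          where
          l : ∀ v g → v * g * (v * g) ≡ v * v * (g * g)
          l = solve-∀ ℚ-ring
        flip : ∀ v a b → v * v * ((b - a) * (b - a)) ≡ v * v * ((a - b) * (a - b))
        flip = solve-∀ ℚ-ring
        far : ∀ T → WithinBounds ε n T ≡ false → 1ℚ ≤ v * v * ((ι (distBP n T) - mean n) * (ι (distBP n T) - mean n))
        -- Both failures deviate by at least g = c₁ηn: below, the mean is at least 2g; above, the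
        -- mean is at most 401ηn, and ηn ≥ g because c₁ ≤ 1.
        far T eq = [ below , above ]′ (not-between (c₁ * η * ι n) D (c₂ * η * ι n) eq)
          where
          D : ℚ
          D = ι (distBP n T)
          l₁ : ∀ g m d → m - d ≡ g + ((m - lit 2 * g) + (g - d))
          l₁ = solve-∀ ℚ-ring
          l₂ : ∀ c η n m d → d - m ≡ c * η * n + ((d - lit 402 * η * n) + (lit 401 * η * n - m) + (1ℚ - c) * (η * n))
          l₂ = solve-∀ ℚ-ring
          below : D < c₁ * η * ι n → 1ℚ ≤ v * v * ((D - mean n) * (D - mean n))
          below low = subst (1ℚ ≤_) (flip v D (mean n)) (deviation (mean n - D) (≤-by _ (0≤+ (0≤gap mean-≥) (0≤gap (<⇒≤ low))) (l₁ g (mean n) D)))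
          above : c₂ * η * ι n < D → 1ℚ ≤ v * v * ((D - mean n) * (D - mean n))
          above high = deviation (D - mean n) (≤-by _ (0≤+ (0≤+ (0≤gap (<⇒≤ high)) (0≤gap (mean-≤ small))) (0≤* (0≤gap c₁≤1) 0≤ηn)) (l₂ c₁ η (ι n) (mean n) D))

  -- The constant 256 enters through a variable μ because its multiples would be unfolded in unary.
  distance-bounds : ∀ μ → μ ≡ 256 → ∀ ε → 0ℚ < ε → ε < 1ℚ → ∀ δ → 0ℚ < δ →
    Σ ℕ λ N → ∀ n → N ℕ.≤ n → 1ℚ - δ ≤ Pr n ((1ℚ + ε) * inv n) (WithinBounds ε n)
  distance-bounds μ μ≡256 ε 0<ε ε<1 δ 0<δ = N₀ ℕ.+ (s ℕ.+ (proj₁ small ℕ.+ proj₁ large)) , bounds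
    where
    s : ℕ
    s = proj₁ (scale ε 0<ε ε<1)
    2≤s : 2 ℕ.≤ s
    2≤s = proj₁ (proj₂ (scale ε 0<ε ε<1))
    1≤sε : 1ℚ ≤ ι s * ε
    1≤sε = proj₁ (proj₂ (proj₂ (scale ε 0<ε ε<1)))
    sε≤2 : ι s * ε ≤ lit 2
    sε≤2 = proj₂ (proj₂ (proj₂ (scale ε 0<ε ε<1)))
    open Fixed ε 0<ε ε<1 s 2≤s 1≤sε sε≤2 μ μ≡256
    open Scale s ε 2≤s 0<ε ε<1 1≤sε sε≤2
    open Lower μ (ℕₚ.≤-reflexive (sym μ≡256)) using (N₀)
    h : ℚ
    h = proj₁ (inverse (0<* 0<c₁ 0<η))
    small : Σ ℕ λ N → ∀ {n} → N ℕ.≤ n → lit 100 + lit 12 * ι s ≤ η * ι n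
    small = archimedes-* (lit 100 + lit 12 * ι s) 0<η
    large : Σ ℕ λ N → ∀ {n} → N ℕ.≤ n → lit 2 * (h * h) ≤ δ * ι n
    large = archimedes-* (lit 2 * (h * h)) 0<δ
    bounds : ∀ n → N₀ ℕ.+ (s ℕ.+ (proj₁ small ℕ.+ proj₁ large)) ℕ.≤ n → 1ℚ - δ ≤ Pr n ((1ℚ + ε) * inv n) (WithinBounds ε n)
    bounds n N≤n = concentrated n (ℕₚ.m+n≤o⇒m≤o N₀ N≤n) (ℕₚ.m+n≤o⇒m≤o s rest₁) δ h
        (proj₁ (proj₂ (inverse (0<* 0<c₁ 0<η)))) (proj₂ (proj₂ (inverse (0<* 0<c₁ 0<η))))
        (proj₂ small (ℕₚ.m+n≤o⇒m≤o (proj₁ small) rest₂)) (proj₂ large (ℕₚ.m+n≤o⇒n≤o (proj₁ small) rest₂))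
      where
      rest₁ : s ℕ.+ (proj₁ small ℕ.+ proj₁ large) ℕ.≤ n
      rest₁ = ℕₚ.m+n≤o⇒n≤o N₀ N≤n
      rest₂ : proj₁ small ℕ.+ proj₁ large ℕ.≤ n
      rest₂ = ℕₚ.m+n≤o⇒n≤o s rest₁

  Pr-cong : ∀ n p {A B : List Bool → Bool} → (∀ T → A T ≡ B T) → Pr n p A ≡ Pr n p B
  Pr-cong n p {A} {B} h = trans (Pr-𝔼 n p A) (trans (𝔼-cong p (npairs n) (λ T → cong indicator (h T))) (sym (Pr-𝔼 n p B)))

  WithinBounds-unfold : ∀ ε n T → WithinBounds ε n T ≡
    (⌊ (c₁ * (ε * ε * ε) * ℕtoℚ n) ≤? ℕtoℚ (distBP n T) ⌋ ∧ ⌊ ℕtoℚ (distBP n T) ≤? (c₂ * (ε * ε * ε) * ℕtoℚ n) ⌋)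
  WithinBounds-unfold ε n T = trans
    (cong₂ (λ d m → between? (c₁ * (ε * ε * ε) * m) d (c₂ * (ε * ε * ε) * m)) (ι≡ℕtoℚ (distBP n T)) (ι≡ℕtoℚ n))
    (between?-unfold (c₁ * (ε * ε * ε) * ℕtoℚ n) (ℕtoℚ (distBP n T)) (c₂ * (ε * ε * ε) * ℕtoℚ n))

open Main using (c₁; c₂; 0<c₁; c₁≤c₂; distance-bounds; Pr-cong; WithinBounds-unfold)
open import Defs
open import Data.Nat using (ℕ; _≤_)
open import Data.Product using (Σ; _×_; _,_; proj₁; proj₂)
open import Data.Bool using (_∧_)
open import Data.Rational using (ℚ; 0ℚ; 1ℚ; _+_; _*_; _-_; _<_) renaming (_≤_ to _≤ℚ_)
open import Data.Rational.Properties using (_≤?_)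
open import Relation.Nullary.Decidable using (⌊_⌋)
open import Relation.Binary.PropositionalEquality using (refl; subst)

theorem1p6 : Σ ℚ λ c₁ → Σ ℚ λ c₂ → (0ℚ < c₁) × (c₁ ≤ℚ c₂) ×
    (∀ (ε : ℚ) → 0ℚ < ε → ε < 1ℚ →
    ∀ (δ : ℚ) → 0ℚ < δ →
    Σ ℕ λ N → ∀ (n : ℕ) → N ≤ n →
    (1ℚ - δ) ≤ℚ Pr n ((1ℚ + ε) * inv n)
    (λ T → ⌊ (c₁ * (ε * ε * ε) * ℕtoℚ n) ≤? ℕtoℚ (distBP n T) ⌋
    ∧ ⌊ ℕtoℚ (distBP n T) ≤? (c₂ * (ε * ε * ε) * ℕtoℚ n) ⌋))
theorem1p6 = c₁ , c₂ , 0<c₁ , c₁≤c₂ , λ ε 0<ε ε<1 δ 0<δ →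
  proj₁ (distance-bounds 256 refl ε 0<ε ε<1 δ 0<δ) , λ n N≤n →
  subst ((1ℚ - δ) ≤ℚ_) (Pr-cong n ((1ℚ + ε) * inv n) (WithinBounds-unfold ε n)) (proj₂ (distance-bounds 256 refl ε 0<ε ε<1 δ 0<δ) n N≤n)
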